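{- For $n\in\mathbb{N}$, let $G(n)$ denote the number of integer sequences $n-1\ge d_1\ge d_2\ge\dotsb\ge d_n\ge 0$ that are the degree sequence of some simple graph on $n$ vertices. Then there is a constant $c>0$ such that \[ G(n)=(c+o(1))\,\frac{4^n}{n^{3/4}}\qquad\text{as } n\to\infty. \]
   Context: A simple graph has no loops or multiple edges; the degree of a vertex is the number of edges incident to it. -}

module Defs where

open import Data.Nat using (ℕ; zero; suc; _+_; _*_; _∸_; _^_; _≤_; _<_; ∣_-_∣)
open import Data.Bool using (Bool; true; false; if_then_else_)
open import Data.Fin using (Fin; toℕ) renaming (_≤_ to _≤ᶠ_)
open import Data.Vec using (Vec; lookup)
open import Data.List using (List; length; map; allFin)
open import Data.Nat.ListAction using (sum)
open import Data.List.Relation.Unary.Unique.Propositional using (Unique)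
open import Data.List.Membership.Propositional using (_∈_)
open import Data.Product using (Σ; ∃; ∃-syntax; _×_)
open import Function.Bundles using (_⇔_)
open import Relation.Binary.PropositionalEquality using (_≡_)

record SimpleGraph (n : ℕ) : Set where
  field
    adj    : Fin n → Fin n → Bool
    sym    : ∀ i j → adj i j ≡ adj j i
    irrefl : ∀ i → adj i i ≡ false
open SimpleGraph public

degree : ∀ {n} → SimpleGraph n → Fin n → ℕ
degree {n} g i = sum (map (λ j → if adj g i j then 1 else 0) (allFin n))

IsDegreeSequence : ∀ {n} → Vec ℕ n → Set
IsDegreeSequence {n} d = Σ (SimpleGraph n) λ g → ∀ i → degree g i ≡ lookup d i

GraphicSeq : ∀ {n} → Vec ℕ n → Set
GraphicSeq {n} d =
  (∀ i → lookup d i ≤ n ∸ 1)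
  × (∀ i j → i ≤ᶠ j → lookup d j ≤ lookup d i)
  × IsDegreeSequence d

GraphicCount : ℕ → ℕ → Set
GraphicCount n m =
  ∃[ ds ] (Unique {A = Vec ℕ n} ds × (∀ d → (d ∈ ds) ⇔ GraphicSeq d) × length ds ≡ m)

-- For a counting function G, let a(n) = G(n)^4 * n^3 / 4^(4n) = (G(n) n^(3/4) / 4^n)^4,
-- represented by numerator and denominator.
num : (ℕ → ℕ) → ℕ → ℕ
num G n = G n ^ 4 * n ^ 3

den : ℕ → ℕ
den n = 4 ^ (4 * n)

-- G(n) = (c + o(1)) 4^n / n^(3/4) for some real c > 0, expressed (with c^4 = lim a(n)) as:
-- (i) a(n) is Cauchy: for every k, eventually |a(m) - a(n)| < 1/(k+1);
-- (ii) a(n) is eventually bounded below by 1/(k+1) for some k (i.e. the limit is > 0).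
AsymptoticToC4nOverN34 : (ℕ → ℕ) → Set
AsymptoticToC4nOverN34 G =
  (∀ k → ∃[ N ] ∀ m n → N ≤ m → N ≤ n →
     suc k * ∣ num G m * den n - num G n * den m ∣ < den m * den n)
  × (∃[ k ] ∃[ N ] ∀ n → N ≤ n → den n ≤ suc k * num G n)

{-# OPTIONS --safe #-}
{-
Reading the boundary of the Young diagram of a degree sequence d₁ ≥ ... ≥ dₙ from both ends at once gives a word of
n letters (up, down and two level steps), hence a lazy walk, which starts and ends at height 0. The conditions of Erdős
and Gallai say that the area under the walk is nonnegative whenever the walk is at height 0, and the degree sum is even
when the final area is. Conversely such a walk is lowered, by moves that correspond to transferring a unit from
a larger degree to a smaller one, to that of a threshold graph.

Let H, B and E be the generating functions, in words of probability 4⁻ⁿ, of these walks without the parity condition,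
of all walks from 0 to 0, and of the walks in H of final area 0. Cutting a walk from 0 to 0 at the last of its zeros at
which the area is minimal, and reversing pieces, gives H² = B E, where B = (1 - x)^(-1/2). Raising one letter of a walk
counted by E changes the area by an amount that tells the position of that letter; so n Eₙ is at most a multiple of Bₙ,
and √E has summable coefficients. As H = (1 - x)^(-1/4) √E, the coefficients of H are asymptotic to a constant times
n^(-3/4). The same identity holds with every walk counted with the sign (-1)^area; there B becomes
((1 + x/2) / (1 - x/2))^(1/2), whose coefficients are exponentially small, so even and odd areas are asymptotically
equally frequent. The boundary has one step less than two words of length n, so the last letter is restricted; this only
multiplies the generating functions by 1 - P for a series P with summable coefficients.

All estimates are made in ℚ through exact identities between binomial series, with error bounds that are multiples of
the coefficients βₙ of (1 - x)^(-1/2), and αₙ = n³ aₙ⁴ for the coefficients aₙ of (1 - x)^(-1/4) is monotone.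
-}
module Submission where

-- The delicate step is the passage from E to √E, since a square root of a summable series need not
-- be summable. Cutting at the first tie gives E = 1 / (1 - I) with I nonnegative, and this renewal
-- form yields 0 ≤ √E ≤ E coefficientwise. The area argument makes Eₙ of order n^(-3/2), the order
-- of the coefficients ψₙ of 2 - (1 - x)^(1/2). Summability is therefore always stated as domination
-- by a multiple of ψ: products stay dominated because ψ² ≤ 4ψ, and partial sums converge at rate β
-- because the tails of ψ telescope to β. The value of c is never identified. The count divided by
-- 4ⁿ aₙ is compared with the partial sums of √E (1 - P), up to half; this gives a Cauchy rate, and
-- these sums are at least 1/2 because the mass of P is at most 1/2. Fourth powers turn n^(3/4) into
-- n³, so that everything stays rational.

module Rationals where

  open import Data.Nat.Base as ℕ using (ℕ; zero; suc; z≤n; s≤s)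
  import Data.Nat.Properties as ℕ
  open import Data.Rational.Base public using (ℚ; 0ℚ; 1ℚ; ½; _≤_; _<_)
  import Data.Rational.Base as Raw
  import Data.Rational.Properties as Raw
  open import Data.Rational.Properties public
    using (≤-refl; ≤-reflexive; ≤-trans; ≤-antisym; ≤-total; <⇒≤; <-irrefl; ≤-<-trans; <-≤-trans; ≮⇒≥)
  open import Algebra.Bundles using (CommutativeRing)
  open import Algebra.Structures using (IsCommutativeRing)
  open import Data.Sum using (inj₁; inj₂)
  open import Relation.Binary.PropositionalEquality
  open import Relation.Nullary.Decidable using (dec⇒maybe)
  open import Tactic.RingSolver using (solve-∀)
  open import Tactic.RingSolver.Core.AlmostCommutativeRing using (AlmostCommutativeRing; fromCommutativeRing)
  open import Level using (0ℓ)

  infixl 6 _+_ _-_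
  infixl 7 _*_
  infix 8 -_

  -- The operations are opaque so that unification never unfolds their normalising definitions;
  -- they are unfolded only where the ring solver has to compute with numerals.
  opaque
    _+_ _*_ : ℚ → ℚ → ℚ
    _+_ = Raw._+_
    _*_ = Raw._*_

    -_ ∣_∣ : ℚ → ℚ
    -_ = Raw.-_
    ∣_∣ = Raw.∣_∣

    +-*-isCommutativeRing : IsCommutativeRing _≡_ _+_ _*_ -_ 0ℚ 1ℚ
    +-*-isCommutativeRing = Raw.+-*-isCommutativeRing

    0≤½ : 0ℚ ≤ ½
    0≤½ = Raw.nonNegative⁻¹ ½

    0≤1 : 0ℚ ≤ 1ℚ
    0≤1 = Raw.nonNegative⁻¹ 1ℚ

    0<1 : 0ℚ < 1ℚ
    0<1 = Raw.positive⁻¹ 1ℚ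

    0<½ : 0ℚ < ½
    0<½ = Raw.positive⁻¹ ½

    +-mono-≤ : ∀ {p q r s} → p ≤ q → r ≤ s → p + r ≤ q + s
    +-mono-≤ = Raw.+-mono-≤

    +-monoʳ-≤ : ∀ r {p q} → p ≤ q → r + p ≤ r + q
    +-monoʳ-≤ = Raw.+-monoʳ-≤

    +-monoˡ-≤ : ∀ r {p q} → p ≤ q → p + r ≤ q + r
    +-monoˡ-≤ = Raw.+-monoˡ-≤

    +-monoˡ-< : ∀ r {p q} → p < q → p + r < q + r
    +-monoˡ-< = Raw.+-monoˡ-<

    neg-antimono-≤ : ∀ {p q} → p ≤ q → - q ≤ - p
    neg-antimono-≤ = Raw.neg-antimono-≤

    *-monoʳ : ∀ {r p q} → 0ℚ ≤ r → p ≤ q → r * p ≤ r * q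
    *-monoʳ {r} 0≤r = Raw.*-monoˡ-≤-nonNeg r {{Raw.nonNegative 0≤r}}

    *-monoʳ-< : ∀ {r p q} → 0ℚ < r → p < q → r * p < r * q
    *-monoʳ-< {r} 0<r = Raw.*-monoʳ-<-pos r {{Raw.positive 0<r}}

    *-monoˡ-< : ∀ {r p q} → 0ℚ < r → p < q → p * r < q * r
    *-monoˡ-< {r} 0<r = Raw.*-monoˡ-<-pos r {{Raw.positive 0<r}}

    *-monoˡ : ∀ {r p q} → 0ℚ ≤ r → p ≤ q → p * r ≤ q * r
    *-monoˡ {r} 0≤r = Raw.*-monoʳ-≤-nonNeg r {{Raw.nonNegative 0≤r}}

    *-cancel-≤ : ∀ {r p q} → 0ℚ < r → r * p ≤ r * q → p ≤ q
    *-cancel-≤ {r} 0<r = Raw.*-cancelˡ-≤-pos r {{Raw.positive 0<r}}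

    0≤∣p∣ : ∀ p → 0ℚ ≤ ∣ p ∣
    0≤∣p∣ = Raw.0≤∣p∣

    0≤p⇒∣p∣≡p : ∀ {p} → 0ℚ ≤ p → ∣ p ∣ ≡ p
    0≤p⇒∣p∣≡p = Raw.0≤p⇒∣p∣≡p

    ∣-p∣≡∣p∣ : ∀ p → ∣ - p ∣ ≡ ∣ p ∣
    ∣-p∣≡∣p∣ = Raw.∣-p∣≡∣p∣

    ∣p+q∣≤∣p∣+∣q∣ : ∀ p q → ∣ p + q ∣ ≤ ∣ p ∣ + ∣ q ∣
    ∣p+q∣≤∣p∣+∣q∣ = Raw.∣p+q∣≤∣p∣+∣q∣

    ∣p*q∣≡∣p∣*∣q∣ : ∀ p q → ∣ p * q ∣ ≡ ∣ p ∣ * ∣ q ∣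
    ∣p*q∣≡∣p∣*∣q∣ = Raw.∣p*q∣≡∣p∣*∣q∣

    reciprocal : (p : ℚ) → 0ℚ < p → ℚ
    reciprocal p 0<p = Raw.1/_ p {{Raw.pos⇒nonZero p {{Raw.positive 0<p}}}}

    *-reciprocal : ∀ p (0<p : 0ℚ < p) → p * reciprocal p 0<p ≡ 1ℚ
    *-reciprocal p 0<p = Raw.*-inverseʳ p {{Raw.pos⇒nonZero p {{Raw.positive 0<p}}}}

    0<reciprocal : ∀ p (0<p : 0ℚ < p) → 0ℚ < reciprocal p 0<p
    0<reciprocal p 0<p = Raw.positive⁻¹ _ {{Raw.1/pos⇒pos p {{Raw.positive 0<p}}}}

  _-_ : ℚ → ℚ → ℚ
  p - q = p + (- q)

  ¼ 2ℚ 4ℚ : ℚ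
  ¼ = ½ * ½
  2ℚ = 1ℚ + 1ℚ
  4ℚ = 2ℚ + 2ℚ

  +-*-commutativeRing : CommutativeRing 0ℓ 0ℓ
  +-*-commutativeRing = record { isCommutativeRing = +-*-isCommutativeRing }

  open CommutativeRing +-*-commutativeRing public
    using (+-identityˡ; +-identityʳ; +-assoc; +-comm; *-identityˡ; *-identityʳ; *-assoc; *-comm; distribˡ; distribʳ)
    renaming (zeroˡ to *-zeroˡ; zeroʳ to *-zeroʳ; -‿inverseʳ to +-inverseʳ; -‿inverseˡ to +-inverseˡ)

  ℚ-ring : AlmostCommutativeRing 0ℓ 0ℓ
  ℚ-ring = fromCommutativeRing +-*-commutativeRing λ x → dec⇒maybe (0ℚ Raw.≟ x)

  opaque
    unfolding _+_

    difference : ∀ p q → q ≡ p + (q - p)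
    difference = solve-∀ ℚ-ring

    neg-square : ∀ p → (- p) * (- p) ≡ p * p
    neg-square = solve-∀ ℚ-ring

    neg-neg : ∀ p → - (- p) ≡ p
    neg-neg = solve-∀ ℚ-ring

    neg-sub : ∀ p q → - (p - q) ≡ q - p
    neg-sub = solve-∀ ℚ-ring

    suc-* : ∀ m n → n + m * n ≡ (1ℚ + m) * n
    suc-* = solve-∀ ℚ-ring

    ½+½ : 1ℚ ≡ ½ + ½
    ½+½ = refl

    ¼+¾ : 1ℚ ≡ ¼ + (½ + ¼)
    ¼+¾ = refl

  -- Inequalities are mostly proved by exhibiting the difference of the two sides.
  ≤-by : ∀ {p q d} → 0ℚ ≤ d → q ≡ p + d → p ≤ q
  ≤-by {p} {q} {d} 0≤d refl = subst (_≤ p + d) (+-identityʳ p) (+-monoʳ-≤ p 0≤d)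

  0≤+ : ∀ {p q} → 0ℚ ≤ p → 0ℚ ≤ q → 0ℚ ≤ p + q
  0≤+ {p} {q} a b = subst (_≤ p + q) (+-identityˡ 0ℚ) (+-mono-≤ a b)

  0≤* : ∀ {p q} → 0ℚ ≤ p → 0ℚ ≤ q → 0ℚ ≤ p * q
  0≤* {p} {q} a b = subst (_≤ p * q) (*-zeroʳ p) (*-monoʳ a b)

  0<* : ∀ {p q} → 0ℚ < p → 0ℚ < q → 0ℚ < p * q
  0<* {p} {q} a b = subst (_< p * q) (*-zeroʳ p) (*-monoʳ-< a b)

  0≤¼ : 0ℚ ≤ ¼
  0≤¼ = 0≤* 0≤½ 0≤½

  ½≤1 : ½ ≤ 1ℚ
  ½≤1 = ≤-by 0≤½ ½+½

  ¼≤1 : ¼ ≤ 1ℚ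
  ¼≤1 = ≤-by (0≤+ 0≤½ 0≤¼) ¼+¾

  0≤2 : 0ℚ ≤ 2ℚ
  0≤2 = 0≤+ 0≤1 0≤1

  0≤4 : 0ℚ ≤ 4ℚ
  0≤4 = 0≤+ 0≤2 0≤2

  0≤-difference : ∀ {p q} → p ≤ q → 0ℚ ≤ q - p
  0≤-difference {p} {q} p≤q = subst (_≤ q - p) (+-inverseʳ p) (+-monoˡ-≤ (- p) p≤q)

  *-mono : ∀ {p q r s} → 0ℚ ≤ p → p ≤ q → 0ℚ ≤ r → r ≤ s → p * r ≤ q * s
  *-mono 0≤p p≤q 0≤r r≤s = ≤-trans (*-monoʳ 0≤p r≤s) (*-monoˡ (≤-trans 0≤r r≤s) p≤q)

  *-cancel : ∀ {r p q} → 0ℚ < r → r * p ≡ r * q → p ≡ q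
  *-cancel 0<r e = ≤-antisym (*-cancel-≤ 0<r (≤-reflexive e)) (*-cancel-≤ 0<r (≤-reflexive (sym e)))

  ≤-of-squares : ∀ {p q} → 0ℚ ≤ q → p * p ≤ q * q → p ≤ q
  ≤-of-squares {p} {q} 0≤q h = ≮⇒≥ λ q<p →
    <-irrefl refl (≤-<-trans h (≤-<-trans (*-monoʳ 0≤q (<⇒≤ q<p))
      (*-monoˡ-< (≤-<-trans 0≤q q<p) q<p)))

  0≤neg : ∀ {p} → p ≤ 0ℚ → 0ℚ ≤ - p
  0≤neg {p} h = subst (_≤ - p) (trans (sym (+-identityˡ _)) (+-inverseʳ 0ℚ)) (neg-antimono-≤ h)

  square-nonneg : ∀ p → 0ℚ ≤ p * p
  square-nonneg p with ≤-total 0ℚ p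
  ... | inj₁ h = 0≤* h h
  ... | inj₂ h = subst (0ℚ ≤_) (neg-square p) (0≤* (0≤neg h) (0≤neg h))

  ≤-abs : ∀ p → p ≤ ∣ p ∣
  ≤-abs p with ≤-total 0ℚ p
  ... | inj₁ h = ≤-reflexive (sym (0≤p⇒∣p∣≡p h))
  ... | inj₂ h = ≤-trans h (0≤∣p∣ p)

  -abs≤ : ∀ p → - ∣ p ∣ ≤ p
  -abs≤ p = subst (- ∣ p ∣ ≤_) (neg-neg p)
    (neg-antimono-≤ (subst (- p ≤_) (∣-p∣≡∣p∣ p) (≤-abs (- p))))

  abs-≤ : ∀ {p q} → p ≤ q → - p ≤ q → ∣ p ∣ ≤ q
  abs-≤ {p} {q} a b with ≤-total 0ℚ p
  ... | inj₁ h = subst (_≤ q) (sym (0≤p⇒∣p∣≡p h)) a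
  ... | inj₂ h = subst (_≤ q) (trans (sym (0≤p⇒∣p∣≡p (0≤neg h))) (∣-p∣≡∣p∣ p)) b

  ι : ℕ → ℚ
  ι zero = 0ℚ
  ι (suc n) = 1ℚ + ι n

  0≤ι : ∀ n → 0ℚ ≤ ι n
  0≤ι zero = ≤-refl
  0≤ι (suc n) = 0≤+ 0≤1 (0≤ι n)

  0<ι : ∀ n → 0ℚ < ι (suc n)
  0<ι n = <-≤-trans 0<1 (≤-by (0≤ι n) refl)

  ι-+ : ∀ m n → ι (m ℕ.+ n) ≡ ι m + ι n
  ι-+ zero n = sym (+-identityˡ _)
  ι-+ (suc m) n = trans (cong (1ℚ +_) (ι-+ m n)) (sym (+-assoc 1ℚ (ι m) (ι n)))

  ι-* : ∀ m n → ι (m ℕ.* n) ≡ ι m * ι n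
  ι-* zero n = sym (*-zeroˡ _)
  ι-* (suc m) n = trans (ι-+ n (m ℕ.* n)) (trans (cong (ι n +_) (ι-* m n)) (suc-* (ι m) (ι n)))

  ι-mono : ∀ {m n} → m ℕ.≤ n → ι m ≤ ι n
  ι-mono {n = n} z≤n = 0≤ι n
  ι-mono (s≤s h) = +-monoʳ-≤ 1ℚ (ι-mono h)

  ι-mono-< : ∀ {m n} → m ℕ.< n → ι m < ι n
  ι-mono-< {m} h = <-≤-trans (subst (_< ι (suc m)) (+-identityˡ _) (+-monoˡ-< (ι m) 0<1)) (ι-mono h)

  ι-cancel-< : ∀ {m n} → ι m < ι n → m ℕ.< n
  ι-cancel-< {m} {n} h with ℕ.<-≤-connex m n
  ... | inj₁ m<n = m<n
  ... | inj₂ n≤m with () ← <-irrefl refl (<-≤-trans h (ι-mono n≤m))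

  ι-cancel-≤ : ∀ {m n} → ι m ≤ ι n → m ℕ.≤ n
  ι-cancel-≤ {m} {n} h with ℕ.≤-<-connex m n
  ... | inj₁ m≤n = m≤n
  ... | inj₂ n<m with () ← <-irrefl refl (<-≤-trans (ι-mono-< n<m) h)

  inv : ℕ → ℚ
  inv n = reciprocal (ι (suc n)) (0<ι n)

  ι*inv : ∀ n → ι (suc n) * inv n ≡ 1ℚ
  ι*inv n = *-reciprocal _ (0<ι n)

  0<inv : ∀ n → 0ℚ < inv n
  0<inv n = 0<reciprocal _ (0<ι n)

  0≤inv : ∀ n → 0ℚ ≤ inv n
  0≤inv n = <⇒≤ (0<inv n)

-- Sequences as formal power series, and the binomial series

module Sequences where

  open Rationals
  open import Data.Nat.Base as ℕ using (ℕ; zero; suc; z≤n; s≤s)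
  import Data.Nat.Properties as ℕ
  open import Data.Product using (_,_)
  open import Relation.Binary.PropositionalEquality
  open import Algebra.Bundles using (CommutativeRing)
  open import Algebra.Structures using (IsCommutativeRing)
  open import Tactic.RingSolver using (solve-∀)
  import Algebra.Properties.Ring as RingProperties
  import Algebra.Solver.Ring.NaturalCoefficients.Default as SemiringSolver
  open import Level using (0ℓ)

  infix 4 _≈_
  infixl 6 _⊕_
  infixl 7 _⋆_
  infixr 8 _·_

  Seq : Set
  Seq = ℕ → ℚ

  _≈_ : Seq → Seq → Set
  a ≈ b = ∀ n → a n ≡ b n

  ≈-sym : ∀ {a b} → a ≈ b → b ≈ a
  ≈-sym p n = sym (p n)

  ≈-trans : ∀ {a b c} → a ≈ b → b ≈ c → a ≈ c
  ≈-trans p q n = trans (p n) (q n)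

  0s δ : Seq
  0s _ = 0ℚ
  δ zero = 1ℚ
  δ (suc _) = 0ℚ

  _⊕_ _⋆_ : Seq → Seq → Seq
  (a ⊕ b) n = a n + b n

  tail : Seq → Seq
  tail a n = a (suc n)

  (a ⋆ b) zero = a 0 * b 0
  (a ⋆ b) (suc n) = a 0 * b (suc n) + (tail a ⋆ b) n

  ⊖_ : Seq → Seq
  (⊖ a) n = - a n

  _·_ : ℚ → Seq → Seq
  (c · a) n = c * a n

  -- On generating functions: multiplication by x, and the Euler operator x d/dx.
  X D : Seq → Seq
  X a zero = 0ℚ
  X a (suc n) = a n
  D a n = ι n * a n

  private
    opaque
      unfolding _+_

      ring₁ : ∀ a x y b → a + (x + y * b) ≡ (a + x) + y * b
      ring₁ = solve-∀ ℚ-ring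

      ring₂ : ∀ x y z → x * y + z ≡ z + y * x
      ring₂ = solve-∀ ℚ-ring

      ring₃ : ∀ a b c u v → (a + b) * c + (u + v) ≡ (a * c + u) + (b * c + v)
      ring₃ = solve-∀ ℚ-ring

      ring₄ : ∀ s a b u → (s * a) * b + s * u ≡ s * (a * b + u)
      ring₄ = solve-∀ ℚ-ring

      ring₅ : ∀ a b c u v → (a * b) * c + (a * u + v) ≡ a * (b * c + u) + v
      ring₅ = solve-∀ ℚ-ring

      ring₆ : ∀ x → 1ℚ * x + 0ℚ ≡ x
      ring₆ = solve-∀ ℚ-ring

      ring₇ : ∀ x u → 0ℚ * x + u ≡ u
      ring₇ = solve-∀ ℚ-ring

      ring₈ : ∀ a b → 0ℚ * (a * b) ≡ (0ℚ * a) * b + a * (0ℚ * b)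
      ring₈ = solve-∀ ℚ-ring

      ring₉ : ∀ n a b u v w → n * u ≡ v + w →
              (1ℚ + n) * (a * b + u) ≡ ((0ℚ * a) * b + (u + v)) + (a * ((1ℚ + n) * b) + w)
      ring₉ n a b u v w eq = trans (expand n a b u) (trans (cong (λ z → (1ℚ + n) * (a * b) + (u + z)) eq) (collect n a b u v w))
        where
        expand : ∀ n a b u → (1ℚ + n) * (a * b + u) ≡ (1ℚ + n) * (a * b) + (u + n * u)
        expand = solve-∀ ℚ-ring
        collect : ∀ n a b u v w → (1ℚ + n) * (a * b) + (u + (v + w)) ≡ ((0ℚ * a) * b + (u + v)) + (a * ((1ℚ + n) * b) + w)
        collect = solve-∀ ℚ-ring

      ring₁₀ : ∀ n a → (1ℚ + n) * a ≡ a + n * a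
      ring₁₀ = solve-∀ ℚ-ring

  ⋆-cong : ∀ {a a′ b b′} → a ≈ a′ → b ≈ b′ → a ⋆ b ≈ a′ ⋆ b′
  ⋆-cong p q zero = cong₂ _*_ (p 0) (q 0)
  ⋆-cong p q (suc n) = cong₂ _+_ (cong₂ _*_ (p 0) (q (suc n))) (⋆-cong (λ k → p (suc k)) q n)

  -- The product is defined by peeling the left factor from its front; commutativity needs the same
  -- sum peeled from its other end.
  ⋆-last : ∀ a b n → (a ⋆ b) (suc n) ≡ (a ⋆ tail b) n + a (suc n) * b 0
  ⋆-last a b zero = refl
  ⋆-last a b (suc n) = trans (cong (a 0 * b (suc (suc n)) +_) (⋆-last (tail a) b n)) (ring₁ _ _ _ _)

  ⋆-comm : ∀ a b → a ⋆ b ≈ b ⋆ a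
  ⋆-comm a b zero = *-comm (a 0) (b 0)
  ⋆-comm a b (suc n) = begin
    a 0 * b (suc n) + (tail a ⋆ b) n ≡⟨ cong (a 0 * b (suc n) +_) (⋆-comm (tail a) b n) ⟩
    a 0 * b (suc n) + (b ⋆ tail a) n ≡⟨ ring₂ _ _ _ ⟩
    (b ⋆ tail a) n + b (suc n) * a 0 ≡⟨ ⋆-last b a n ⟨
    (b ⋆ a) (suc n)                  ∎
    where open ≡-Reasoning

  ⋆-distribʳ : ∀ c a b → (a ⊕ b) ⋆ c ≈ a ⋆ c ⊕ b ⋆ c
  ⋆-distribʳ c a b zero = distribʳ (c 0) (a 0) (b 0)
  ⋆-distribʳ c a b (suc n) =
    trans (cong ((a 0 + b 0) * c (suc n) +_) (⋆-distribʳ c (tail a) (tail b) n)) (ring₃ _ _ _ _ _)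

  ·-⋆ : ∀ s a b → (s · a) ⋆ b ≈ s · (a ⋆ b)
  ·-⋆ s a b zero = *-assoc s (a 0) (b 0)
  ·-⋆ s a b (suc n) = trans (cong ((s * a 0) * b (suc n) +_) (·-⋆ s (tail a) b n)) (ring₄ _ _ _ _)

  ⋆-assoc : ∀ a b c → (a ⋆ b) ⋆ c ≈ a ⋆ (b ⋆ c)
  ⋆-assoc a b c zero = *-assoc (a 0) (b 0) (c 0)
  ⋆-assoc a b c (suc n) = begin
    (a 0 * b 0) * c (suc n) + ((a 0 · tail b ⊕ tail a ⋆ b) ⋆ c) n
      ≡⟨ cong ((a 0 * b 0) * c (suc n) +_) (⋆-distribʳ c (a 0 · tail b) (tail a ⋆ b) n) ⟩
    (a 0 * b 0) * c (suc n) + (((a 0 · tail b) ⋆ c) n + ((tail a ⋆ b) ⋆ c) n)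
      ≡⟨ cong₂ (λ u v → (a 0 * b 0) * c (suc n) + (u + v)) (·-⋆ (a 0) (tail b) c n) (⋆-assoc (tail a) b c n) ⟩
    (a 0 * b 0) * c (suc n) + (a 0 * (tail b ⋆ c) n + (tail a ⋆ (b ⋆ c)) n)
      ≡⟨ ring₅ _ _ _ _ _ ⟩
    a 0 * (b 0 * c (suc n) + (tail b ⋆ c) n) + (tail a ⋆ (b ⋆ c)) n ∎
    where open ≡-Reasoning

  ⋆-zeroʳ-below : ∀ a {b} n → (∀ k → k ℕ.≤ n → b k ≡ 0ℚ) → (a ⋆ b) n ≡ 0ℚ
  ⋆-zeroʳ-below a zero z = trans (cong (a 0 *_) (z 0 z≤n)) (*-zeroʳ (a 0))
  ⋆-zeroʳ-below a (suc n) z = trans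
    (cong₂ _+_ (trans (cong (a 0 *_) (z (suc n) ℕ.≤-refl)) (*-zeroʳ (a 0)))
               (⋆-zeroʳ-below (tail a) n (λ k k≤n → z k (ℕ.m≤n⇒m≤1+n k≤n))))
    (+-identityˡ 0ℚ)

  ⋆-identityˡ : ∀ a → δ ⋆ a ≈ a
  ⋆-identityˡ a zero = *-identityˡ (a 0)
  ⋆-identityˡ a (suc n) =
    trans (cong (1ℚ * a (suc n) +_) (trans (⋆-comm 0s a n) (⋆-zeroʳ-below a n (λ _ _ → refl)))) (ring₆ _)

  ⋆-isCommutativeRing : IsCommutativeRing _≈_ _⊕_ _⋆_ ⊖_ 0s δ
  ⋆-isCommutativeRing = record
    { isRing = record
      { +-isAbelianGroup = record
        { isGroup = record
          { isMonoid = record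
            { isSemigroup = record
              { isMagma = record
                { isEquivalence = record { refl = λ _ → refl ; sym = ≈-sym ; trans = ≈-trans }
                ; ∙-cong = λ p q n → cong₂ _+_ (p n) (q n) }
              ; assoc = λ a b c n → +-assoc (a n) (b n) (c n) }
            ; identity = (λ a n → +-identityˡ (a n)) , (λ a n → +-identityʳ (a n)) }
          ; inverse = (λ a n → +-inverseˡ (a n)) , (λ a n → +-inverseʳ (a n))
          ; ⁻¹-cong = λ p n → cong -_ (p n) }
        ; comm = λ a b n → +-comm (a n) (b n) }
      ; *-cong = ⋆-cong
      ; *-assoc = ⋆-assoc
      ; *-identity = ⋆-identityˡ , λ a → ≈-trans (⋆-comm a δ) (⋆-identityˡ a)
      ; distrib = (λ a b c → ≈-trans (⋆-comm a (b ⊕ c)) (≈-trans (⋆-distribʳ a b c)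
                     (λ n → cong₂ _+_ (⋆-comm b a n) (⋆-comm c a n))))
                , ⋆-distribʳ }
    ; *-comm = ⋆-comm }

  ⋆-commutativeRing : CommutativeRing 0ℓ 0ℓ
  ⋆-commutativeRing = record { isCommutativeRing = ⋆-isCommutativeRing }

  X-⋆ : ∀ a b → X a ⋆ b ≈ X (a ⋆ b)
  X-⋆ a b zero = *-zeroˡ (b 0)
  X-⋆ a b (suc n) = ring₇ (b (suc n)) ((a ⋆ b) n)

  tail-D : ∀ a → tail (D a) ≈ tail a ⊕ D (tail a)
  tail-D a n = ring₁₀ (ι n) (a (suc n))

  D-⋆ : ∀ a b → D (a ⋆ b) ≈ D a ⋆ b ⊕ a ⋆ D b
  D-⋆ a b zero = ring₈ (a 0) (b 0)
  D-⋆ a b (suc n) = trans (ring₉ (ι n) (a 0) (b (suc n)) ((tail a ⋆ b) n) ((D (tail a) ⋆ b) n) ((tail a ⋆ D b) n) (D-⋆ (tail a) b n))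
    (cong (λ z → ((0ℚ * a 0) * b (suc n) + z) + (a 0 * D b (suc n) + (tail a ⋆ D b) n))
      (sym (trans (⋆-cong (tail-D a) (λ _ → refl) n) (⋆-distribʳ b (tail a) (D (tail a)) n))))

  ⋆-last-only : ∀ a b n → (∀ k → k ℕ.< n → b k ≡ 0ℚ) → (a ⋆ b) n ≡ a 0 * b n
  ⋆-last-only a b zero z = refl
  ⋆-last-only a b (suc n) z =
    trans (cong (a 0 * b (suc n) +_) (⋆-zeroʳ-below (tail a) n (λ k k≤n → z k (s≤s k≤n)))) (+-identityʳ _)

  -- Strong induction: once b vanishes below k, the k-th coefficient of the product is `a 0 * b k`.
  ⋆-cancelˡ-zero : ∀ a b → 0ℚ < a 0 → a ⋆ b ≈ 0s → b ≈ 0s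
  ⋆-cancelˡ-zero a b 0<a₀ h n = below (suc n) n (ℕ.n<1+n n)
    where
    below : ∀ n k → k ℕ.< n → b k ≡ 0ℚ
    below (suc n) k (s≤s k≤n) = *-cancel 0<a₀
      (trans (sym (⋆-last-only a b k (λ j j<k → below n j (ℕ.<-≤-trans j<k k≤n)))) (trans (h k) (sym (*-zeroʳ (a 0)))))

  ⋆-nonneg : ∀ {a b} n → (∀ k → k ℕ.≤ n → 0ℚ ≤ a k) → (∀ k → k ℕ.≤ n → 0ℚ ≤ b k) → 0ℚ ≤ (a ⋆ b) n
  ⋆-nonneg zero p q = 0≤* (p 0 z≤n) (q 0 z≤n)
  ⋆-nonneg (suc n) p q = 0≤+ (0≤* (p 0 z≤n) (q (suc n) ℕ.≤-refl))
    (⋆-nonneg n (λ k k≤n → p (suc k) (s≤s k≤n)) (λ k k≤n → q k (ℕ.m≤n⇒m≤1+n k≤n)))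

  ⋆-monoʳ : ∀ {a b c} n → (∀ k → k ℕ.≤ n → 0ℚ ≤ a k) → (∀ k → k ℕ.≤ n → b k ≤ c k) → (a ⋆ b) n ≤ (a ⋆ c) n
  ⋆-monoʳ zero p q = *-monoʳ (p 0 z≤n) (q 0 z≤n)
  ⋆-monoʳ (suc n) p q = +-mono-≤ (*-monoʳ (p 0 z≤n) (q (suc n) ℕ.≤-refl))
    (⋆-monoʳ n (λ k k≤n → p (suc k) (s≤s k≤n)) (λ k k≤n → q k (ℕ.m≤n⇒m≤1+n k≤n)))

  ⋆-dominated : ∀ {a b u v} n → (∀ k → k ℕ.≤ n → ∣ a k ∣ ≤ u k) → (∀ k → k ℕ.≤ n → ∣ b k ∣ ≤ v k) →
                ∣ (a ⋆ b) n ∣ ≤ (u ⋆ v) n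
  ⋆-dominated {a} {b} {u} {v} zero p q = subst (_≤ (u ⋆ v) 0) (sym (∣p*q∣≡∣p∣*∣q∣ (a 0) (b 0)))
    (*-mono (0≤∣p∣ _) (p 0 z≤n) (0≤∣p∣ _) (q 0 z≤n))
  ⋆-dominated {a} {b} {u} {v} (suc n) p q = ≤-trans (∣p+q∣≤∣p∣+∣q∣ _ _)
    (+-mono-≤ (subst (_≤ u 0 * v (suc n)) (sym (∣p*q∣≡∣p∣*∣q∣ (a 0) (b (suc n))))
                (*-mono (0≤∣p∣ _) (p 0 z≤n) (0≤∣p∣ _) (q (suc n) ℕ.≤-refl)))
              (⋆-dominated n (λ k k≤n → p (suc k) (s≤s k≤n)) (λ k k≤n → q k (ℕ.m≤n⇒m≤1+n k≤n))))

  open CommutativeRing ⋆-commutativeRing using () renaming (distribˡ to distribˡ-⋆; ring to ⋆-ring; commutativeSemiring to ⋆-commutativeSemiring)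
  open RingProperties ⋆-ring public using (-‿distribʳ-*; -‿distribˡ-*)

  open SemiringSolver ⋆-commutativeSemiring public using (solve; _:+_; _:*_; _:=_)

  ⋆-swap-middle : ∀ a b c d → (a ⋆ b) ⋆ (c ⋆ d) ≈ (a ⋆ c) ⋆ (b ⋆ d)
  ⋆-swap-middle = solve 4 (λ a b c d → (a :* b) :* (c :* d) := (a :* c) :* (b :* d)) λ _ → refl

  ⋆-cancelˡ : ∀ a {b c} → 0ℚ < a 0 → a ⋆ b ≈ a ⋆ c → b ≈ c
  ⋆-cancelˡ a {b} {c} 0<a₀ h n = trans (difference (c n) (b n)) (trans (cong (c n +_) (b-c n)) (+-identityʳ (c n)))
    where
    b-c : b ⊕ (⊖ c) ≈ 0s
    b-c = ⋆-cancelˡ-zero a (b ⊕ (⊖ c)) 0<a₀ λ k → trans (distribˡ-⋆ a b (⊖ c) k)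
      (trans (cong₂ _+_ (h k) (sym (-‿distribʳ-* a c k))) (+-inverseʳ ((a ⋆ c) k)))

  -- (a + b)(a - b) = 0, and a + b can be cancelled because its constant term is 2. The
  -- normalisation at 0 fixes the sign of the root.
  ⋆-sqrt-unique : ∀ {a b} → a 0 ≡ 1ℚ → b 0 ≡ 1ℚ → a ⋆ a ≈ b ⋆ b → a ≈ b
  ⋆-sqrt-unique {a} {b} a₀ b₀ h =
    ⋆-cancelˡ (a ⊕ b) (subst₂ (λ x y → 0ℚ < x + y) (sym a₀) (sym b₀) (<-≤-trans 0<1 (≤-by 0≤1 refl)))
      λ k → trans (⋆-distribʳ a a b k) (trans (cong₂ _+_ (h k) (⋆-comm b a k))
        (trans (+-comm _ _) (sym (⋆-distribʳ b a b k))))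

  -- The coefficients of (1 - x)^(-α).
  binomial : ℚ → Seq
  binomial α zero = 1ℚ
  binomial α (suc n) = (ι n + α) * inv n * binomial α n

  private
    opaque
      unfolding _+_

      ring₁₁ : ∀ m n i b → (1ℚ + m) * (n * i * b) ≡ n * ((1ℚ + m) * i) * b
      ring₁₁ = solve-∀ ℚ-ring

      ring₁₂ : ∀ n α b → (n + α) * 1ℚ * b ≡ n * b + α * b
      ring₁₂ = solve-∀ ℚ-ring

      ring₁₃ : ∀ u v α β p → (u + α * p) + (v + β * p) ≡ (u + v) + (α + β) * p
      ring₁₃ = solve-∀ ℚ-ring

  -- The differential equation (1 - x) f′ = α f, coefficient by coefficient. Together with
  -- `binomial-unique` it is the means of recognising a series as a power of 1 - x.
  binomial-step : ∀ α n → ι (suc n) * binomial α (suc n) ≡ ι n * binomial α n + α * binomial α n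
  binomial-step α n = trans (ring₁₁ (ι n) (ι n + α) (inv n) (binomial α n))
    (trans (cong (λ z → (ι n + α) * z * binomial α n) (ι*inv n)) (ring₁₂ (ι n) α (binomial α n)))

  binomial-unique : ∀ α a → a 0 ≡ 1ℚ → (∀ n → ι (suc n) * a (suc n) ≡ ι n * a n + α * a n) → a ≈ binomial α
  binomial-unique α a a₀ step zero = a₀
  binomial-unique α a a₀ step (suc n) = *-cancel (0<ι n) (trans (step n)
    (trans (cong (λ z → ι n * z + α * z) (binomial-unique α a a₀ step n)) (sym (binomial-step α n))))

  binomial-D : ∀ α → D (binomial α) ≈ X (D (binomial α)) ⊕ α · X (binomial α)
  binomial-D α zero = trans (*-zeroˡ _) (sym (trans (+-identityˡ _) (*-zeroʳ α)))
  binomial-D α (suc n) = binomial-step α n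

  -- By the Leibniz rule for `D`, the product solves the differential equation with exponent α + β.
  binomial-⋆ : ∀ α β → binomial α ⋆ binomial β ≈ binomial (α + β)
  binomial-⋆ α β = binomial-unique (α + β) (a ⋆ b) (*-identityˡ 1ℚ) λ n → begin
    ι (suc n) * (a ⋆ b) (suc n) ≡⟨ D-⋆ a b (suc n) ⟩
    (D a ⋆ b) (suc n) + (a ⋆ D b) (suc n) ≡⟨ cong₂ _+_ (half α β n) (trans (⋆-comm a (D b) (suc n)) (half β α n)) ⟩
    ((D a ⋆ b) n + α * (a ⋆ b) n) + ((D b ⋆ a) n + β * (b ⋆ a) n)
      ≡⟨ cong₂ (λ y z → ((D a ⋆ b) n + α * (a ⋆ b) n) + (y + β * z)) (⋆-comm (D b) a n) (⋆-comm b a n) ⟩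
    ((D a ⋆ b) n + α * (a ⋆ b) n) + ((a ⋆ D b) n + β * (a ⋆ b) n)
      ≡⟨ ring₁₃ _ _ α β _ ⟩
    ((D a ⋆ b) n + (a ⋆ D b) n) + (α + β) * (a ⋆ b) n ≡⟨ cong (_+ (α + β) * (a ⋆ b) n) (D-⋆ a b n) ⟨
    ι n * (a ⋆ b) n + (α + β) * (a ⋆ b) n ∎
    where
    open ≡-Reasoning
    a b : Seq
    a = binomial α
    b = binomial β
    half : ∀ α β n → (D (binomial α) ⋆ binomial β) (suc n) ≡ (D (binomial α) ⋆ binomial β) n + α * (binomial α ⋆ binomial β) n
    half α β n = trans (⋆-cong (binomial-D α) (λ _ → refl) (suc n)) (trans (⋆-distribʳ (binomial β) (X (D (binomial α))) (α · X (binomial α)) (suc n))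
      (cong₂ _+_ (X-⋆ (D (binomial α)) (binomial β) (suc n))
                 (trans (·-⋆ α (X (binomial α)) (binomial β) (suc n)) (cong (α *_) (X-⋆ (binomial α) (binomial β) (suc n))))))

-- Words in four letters and their mean values

module Words where

  open Rationals
  open Sequences
  open import Data.Nat.Base as ℕ using (ℕ; zero; suc)
  open import Data.Bool.Base using (Bool; true; false)
  open import Data.List.Base using (List; []; _∷_; _∷ʳ_; reverse)
  open import Data.List.Properties using (unfold-reverse)
  open import Relation.Binary.PropositionalEquality
  open import Tactic.RingSolver using (solve-∀)

  -- A letter stands for a pair of bits, one from each end of the boundary, and its step is their
  -- difference; `z₀` and `z₁` are the pairs of equal bits. A word of n letters is thus a simple
  -- walk of 2n half steps, whence the central binomial coefficients.
  data Letter : Set where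
    dn z₀ z₁ up : Letter

  Word : Set
  Word = List Letter

  ⟦_⟧ : Bool → ℚ
  ⟦ true ⟧ = 1ℚ
  ⟦ false ⟧ = 0ℚ

  opaque
    Σ₄ : (Letter → ℚ) → ℚ
    Σ₄ f = (f dn + f z₀) + (f z₁ + f up)

  -- The mean of f over the 4ⁿ words of length n.
  E : ℕ → (Word → ℚ) → ℚ
  E zero f = f []
  E (suc n) f = ¼ * Σ₄ λ l → E n λ w → f (l ∷ w)

  means : (Word → ℚ) → Seq
  means f n = E n f

  infixl 7 _⊛_
  -- Sum over all cuts of a word into two pieces. The pieces of a uniformly random word are
  -- independent and uniform, so `means` turns this into the product of power series (`E-⊛`).
  _⊛_ : (Word → ℚ) → (Word → ℚ) → Word → ℚ
  (f ⊛ g) [] = f [] * g []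
  (f ⊛ g) (l ∷ w) = f [] * g (l ∷ w) + ((λ u → f (l ∷ u)) ⊛ g) w

  private
    opaque
      unfolding _+_

      ring₁ : ∀ a b c d a′ b′ c′ d′ → ((a + a′) + (b + b′)) + ((c + c′) + (d + d′)) ≡ ((a + b) + (c + d)) + ((a′ + b′) + (c′ + d′))
      ring₁ = solve-∀ ℚ-ring

      ring₂ : ∀ s a b c d → (s * a + s * b) + (s * c + s * d) ≡ s * ((a + b) + (c + d))
      ring₂ = solve-∀ ℚ-ring

      ring₃ : ∀ s t u → s * (t * u) ≡ t * (s * u)
      ring₃ = solve-∀ ℚ-ring

      ring₄ : ∀ f x y → ¼ * (f * x + y) ≡ f * (¼ * x) + ¼ * y
      ring₄ = solve-∀ ℚ-ring

      quarters : ∀ x → ¼ * ((x + x) + (x + x)) ≡ x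
      quarters = solve-∀ ℚ-ring

  opaque
    unfolding Σ₄

    Σ₄-cong : ∀ {f g} → (∀ l → f l ≡ g l) → Σ₄ f ≡ Σ₄ g
    Σ₄-cong p = cong₂ _+_ (cong₂ _+_ (p dn) (p z₀)) (cong₂ _+_ (p z₁) (p up))

    Σ₄-+ : ∀ f g → Σ₄ (λ l → f l + g l) ≡ Σ₄ f + Σ₄ g
    Σ₄-+ f g = ring₁ _ _ _ _ _ _ _ _

    Σ₄-* : ∀ s f → Σ₄ (λ l → s * f l) ≡ s * Σ₄ f
    Σ₄-* s f = ring₂ s _ _ _ _

    Σ₄-mono : ∀ {f g} → (∀ l → f l ≤ g l) → Σ₄ f ≤ Σ₄ g
    Σ₄-mono p = +-mono-≤ (+-mono-≤ (p dn) (p z₀)) (+-mono-≤ (p z₁) (p up))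

    Σ₄-const : ∀ x → ¼ * Σ₄ (λ _ → x) ≡ x
    Σ₄-const x = quarters x

    Σ₄-swap : ∀ (f : Letter → Letter → ℚ) → Σ₄ (λ l → Σ₄ (f l)) ≡ Σ₄ (λ m → Σ₄ λ l → f l m)
    Σ₄-swap f = trans (cong₂ _+_ (sym (Σ₄-+ (f dn) (f z₀))) (sym (Σ₄-+ (f z₁) (f up))))
      (sym (Σ₄-+ (λ m → f dn m + f z₀ m) (λ m → f z₁ m + f up m)))

    Σ₄-⋆ : ∀ (m : Letter → Seq) a n → ((λ k → Σ₄ λ l → m l k) ⋆ a) n ≡ Σ₄ (λ l → (m l ⋆ a) n)
    Σ₄-⋆ m a n = trans (⋆-distribʳ a (m dn ⊕ m z₀) (m z₁ ⊕ m up) n)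
      (cong₂ _+_ (⋆-distribʳ a (m dn) (m z₀) n) (⋆-distribʳ a (m z₁) (m up) n))

    Σ₄-expand : ∀ f → Σ₄ f ≡ (f dn + f z₀) + (f z₁ + f up)
    Σ₄-expand f = refl

  E-cong : ∀ n {f g} → (∀ w → f w ≡ g w) → E n f ≡ E n g
  E-cong zero p = p []
  E-cong (suc n) p = cong (¼ *_) (Σ₄-cong λ l → E-cong n λ w → p (l ∷ w))

  E-+ : ∀ n f g → E n (λ w → f w + g w) ≡ E n f + E n g
  E-+ zero f g = refl
  E-+ (suc n) f g = trans (cong (¼ *_) (trans (Σ₄-cong λ l → E-+ n _ _) (Σ₄-+ _ _))) (distribˡ ¼ _ _)

  E-* : ∀ n s f → E n (λ w → s * f w) ≡ s * E n f
  E-* zero s f = refl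
  E-* (suc n) s f = trans (cong (¼ *_) (trans (Σ₄-cong λ l → E-* n s _) (Σ₄-* s _))) (ring₃ ¼ s _)

  E-mono : ∀ n {f g} → (∀ w → f w ≤ g w) → E n f ≤ E n g
  E-mono zero p = p []
  E-mono (suc n) p = *-monoʳ 0≤¼ (Σ₄-mono λ l → E-mono n λ w → p (l ∷ w))

  E-const : ∀ n c → E n (λ _ → c) ≡ c
  E-const zero c = refl
  E-const (suc n) c = trans (cong (¼ *_) (Σ₄-cong λ _ → E-const n c)) (Σ₄-const c)

  E-nonneg : ∀ n {f} → (∀ w → 0ℚ ≤ f w) → 0ℚ ≤ E n f
  E-nonneg n p = subst (_≤ E n _) (E-const n 0ℚ) (E-mono n p)

  E-neg : ∀ n f → E n (λ w → - f w) ≡ - E n f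
  E-neg n f = trans (E-cong n λ w → neg-as-* (f w)) (trans (E-* n (- 1ℚ) f) (sym (neg-as-* (E n f))))
    where
    opaque
      unfolding _+_
      neg-as-* : ∀ x → - x ≡ (- 1ℚ) * x
      neg-as-* = solve-∀ ℚ-ring

  E-abs : ∀ n {f g} → (∀ w → ∣ f w ∣ ≤ g w) → ∣ E n f ∣ ≤ E n g
  E-abs n {f} {g} p = abs-≤ (E-mono n λ w → ≤-trans (≤-abs (f w)) (p w))
    (subst (_≤ E n g) (E-neg n f) (E-mono n λ w → ≤-trans (≤-abs (- f w)) (subst (_≤ g w) (sym (∣-p∣≡∣p∣ (f w))) (p w))))

  E-⊛ : ∀ f g → means (f ⊛ g) ≈ means f ⋆ means g
  E-⊛ f g zero = refl
  E-⊛ f g (suc n) = begin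
    ¼ * Σ₄ (λ l → E n λ w → f [] * g (l ∷ w) + (after l ⊛ g) w)
      ≡⟨ cong (¼ *_) (Σ₄-cong λ l → trans (E-+ n _ _) (cong₂ _+_ (E-* n (f []) _) (E-⊛ (after l) g n))) ⟩
    ¼ * Σ₄ (λ l → f [] * E n (λ w → g (l ∷ w)) + (means (after l) ⋆ means g) n)
      ≡⟨ cong (¼ *_) (trans (Σ₄-+ _ _) (cong (_+ Σ₄ λ l → (means (after l) ⋆ means g) n) (Σ₄-* (f []) _))) ⟩
    ¼ * (f [] * Σ₄ (λ l → E n λ w → g (l ∷ w)) + Σ₄ (λ l → (means (after l) ⋆ means g) n))
      ≡⟨ ring₄ (f []) _ _ ⟩
    f [] * E (suc n) g + ¼ * Σ₄ (λ l → (means (after l) ⋆ means g) n)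
      ≡⟨ cong (λ z → f [] * E (suc n) g + ¼ * z) (sym (Σ₄-⋆ m (means g) n)) ⟩
    f [] * E (suc n) g + ¼ * ((λ k → Σ₄ λ l → means (after l) k) ⋆ means g) n
      ≡⟨ cong (f [] * E (suc n) g +_) (·-⋆ ¼ (λ k → Σ₄ λ l → means (after l) k) (means g) n) ⟨
    f [] * E (suc n) g + (tail (means f) ⋆ means g) n ∎
    where
    open ≡-Reasoning
    after : Letter → Word → ℚ
    after l u = f (l ∷ u)
    m : Letter → Seq
    m l = means (after l)

  E-snoc : ∀ n f → E (suc n) f ≡ ¼ * Σ₄ λ l → E n λ w → f (w ∷ʳ l)
  E-snoc zero f = refl
  E-snoc (suc n) f = begin
    ¼ * Σ₄ (λ l → E (suc n) λ w → f (l ∷ w))            ≡⟨ cong (¼ *_) (Σ₄-cong λ l → E-snoc n λ w → f (l ∷ w)) ⟩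
    ¼ * Σ₄ (λ l → ¼ * Σ₄ λ m → E n λ w → f (l ∷ w ∷ʳ m)) ≡⟨ cong (¼ *_) (trans (Σ₄-* ¼ (λ l → Σ₄ (F l)))
        (trans (cong (¼ *_) (Σ₄-swap F)) (sym (Σ₄-* ¼ (λ m → Σ₄ λ l → F l m))))) ⟩
    ¼ * Σ₄ (λ m → E (suc n) λ w → f (w ∷ʳ m))           ∎
    where
    open ≡-Reasoning
    F : Letter → Letter → ℚ
    F l m = E n λ w → f (l ∷ w ∷ʳ m)

  E-reverse : ∀ n f → E n (λ w → f (reverse w)) ≡ E n f
  E-reverse zero f = refl
  E-reverse (suc n) f = trans
    (cong (¼ *_) (Σ₄-cong λ l → trans (E-cong n λ w → cong f (unfold-reverse l w)) (E-reverse n λ w → f (w ∷ʳ l))))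
    (sym (E-snoc n f))

-- Classes of walks and their decompositions

module Walks where

  open Rationals
  open Sequences
  open Words
  open import Data.Nat.Base as ℕ using (zero; suc; z≤n)
  open import Data.Integer.Base as ℤ using (ℤ; +_; -[1+_]; +≤+)
  open import Data.Bool.Base using (Bool; true; false; _∧_; not)
  open import Data.List.Base using ([]; _∷_)
  open import Data.Unit using (⊤; tt)
  open import Relation.Binary.PropositionalEquality
  open import Tactic.RingSolver using (solve-∀)

  step : Letter → ℤ → ℤ
  step dn y = ℤ.pred y
  step z₀ y = y
  step z₁ y = y
  step up y = ℤ.suc y

  isZero : ℤ → Bool
  isZero (+ zero) = true
  isZero (+ suc _) = false
  isZero -[1+ _ ] = false

  isEmpty : Word → Bool
  isEmpty [] = true
  isEmpty (_ ∷ _) = false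

  bridge : ℤ → Word → Bool
  bridge y [] = isZero y
  bridge y (l ∷ w) = bridge (step l y) w

  -- A walk is read from height y with accumulated area t, the area being tested whenever the height is 0.
  -- `nonneg y t false` rejects a negative area. With `true`, the origin of the area is instead moved to each
  -- new minimum, so that `nonneg` accepts all bridges, while `tied` (area 0 at the end) accepts the bridges
  -- whose final area is minimal.
  mutual
    nonneg : ℤ → ℤ → Bool → Word → Bool
    nonneg (+ zero) -[1+ _ ] true w = nonneg′ (+ zero) (+ zero) true w
    nonneg (+ zero) -[1+ _ ] false w = false
    nonneg y t c w = nonneg′ y t c w

    nonneg′ : ℤ → ℤ → Bool → Word → Bool
    nonneg′ y t c [] = isZero y
    nonneg′ y t c (l ∷ w) = nonneg (step l y) (t ℤ.+ step l y) c w

  mutual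
    tied : ℤ → ℤ → Bool → Word → Bool
    tied (+ zero) -[1+ _ ] true w = tied′ (+ zero) (+ zero) true w
    tied (+ zero) -[1+ _ ] false w = false
    tied y t c w = tied′ y t c w

    tied′ : ℤ → ℤ → Bool → Word → Bool
    tied′ y t c [] = isZero y ∧ isZero t
    tied′ y t c (l ∷ w) = tied (step l y) (t ℤ.+ step l y) c w

  mutual
    -- `positive′` exempts the current point from the test. Started at height and area 0 it
    -- therefore describes what follows the last tie.
    positive : ℤ → ℤ → Word → Bool
    positive (+ zero) (+ zero) w = false
    positive (+ zero) -[1+ _ ] w = false
    positive y t w = positive′ y t w

    positive′ : ℤ → ℤ → Word → Bool
    positive′ y t [] = isZero y
    positive′ y t (l ∷ w) = positive (step l y) (t ℤ.+ step l y) w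

  mutual
    -- The renewal blocks of `Eₛ false`: area 0 is reached at a zero for the first time at the end,
    -- the areas at earlier zeros being positive.
    firstTie : ℤ → ℤ → Word → Bool
    firstTie (+ zero) (+ zero) w = isEmpty w
    firstTie (+ zero) -[1+ _ ] w = false
    firstTie y t w = firstTie′ y t w

    firstTie′ : ℤ → ℤ → Word → Bool
    firstTie′ y t [] = false
    firstTie′ y t (l ∷ w) = firstTie (step l y) (t ℤ.+ step l y) w

  -- The bit that a letter takes from the high end. That end supplies one step less than there are
  -- letters, so the words of degree sequences are required to finish with this bit false.
  descends : Letter → Bool
  descends dn = true
  descends z₀ = false
  descends z₁ = true
  descends up = false

  mutual
    nonnegDesc : ℤ → ℤ → Bool → Bool → Word → Bool
    nonnegDesc (+ zero) -[1+ _ ] true f w = nonnegDesc′ (+ zero) (+ zero) true f w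
    nonnegDesc (+ zero) -[1+ _ ] false f w = false
    nonnegDesc y t c f w = nonnegDesc′ y t c f w

    nonnegDesc′ : ℤ → ℤ → Bool → Bool → Word → Bool
    nonnegDesc′ y t c f [] = isZero y ∧ f
    nonnegDesc′ y t c f (l ∷ w) = nonnegDesc (step l y) (t ℤ.+ step l y) c (descends l) w

  -- The flag remembers whether the letter just read descends. With a first letter put in front, as
  -- in `P`, the accepted words are `z₁` and the excursions above the axis.
  primitive′ : ℤ → Bool → Word → Bool
  primitive′ y f [] = isZero y ∧ f
  primitive′ y f (l ∷ w) = not (isZero y) ∧ primitive′ (step l y) (descends l) w

  -- What follows the last tie (`Kₛ`) is the same class for both flags, while ties mean different
  -- things. Eliminating this common factor is the source of H² = B E.
  H Eₛ Kₛ I P : Bool → Word → ℚ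
  H c w = ⟦ nonneg (+ 0) (+ 0) c w ⟧
  Eₛ c w = ⟦ tied (+ 0) (+ 0) c w ⟧
  Kₛ _ w = ⟦ positive′ (+ 0) (+ 0) w ⟧
  I _ w = ⟦ firstTie′ (+ 0) (+ 0) w ⟧
  P _ [] = 0ℚ
  P _ (l ∷ w) = ⟦ primitive′ (step l (+ 0)) (descends l) w ⟧

  private
    opaque
      unfolding _+_

      ring₁ : ∀ x b c → (0ℚ * x + b) + c ≡ b + c
      ring₁ = solve-∀ ℚ-ring

      ring₂ : ∀ b c → (1ℚ * c + b) + 0ℚ ≡ b + c
      ring₂ = solve-∀ ℚ-ring

      ring₃ : ∀ x → 0ℚ * x + 0ℚ ≡ 0ℚ
      ring₃ = solve-∀ ℚ-ring

      ring₄ : ∀ x → 1ℚ * x + 0ℚ ≡ x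
      ring₄ = solve-∀ ℚ-ring

      ring₅ : ∀ x → 0ℚ * x + 1ℚ ≡ 1ℚ
      ring₅ = solve-∀ ℚ-ring

      ring₆ : ∀ x b → 0ℚ * x + b ≡ b
      ring₆ = solve-∀ ℚ-ring

      ring₇ : ∀ x f → x * 0ℚ + f ≡ f
      ring₇ = solve-∀ ℚ-ring

  ⊛-zeroˡ : ∀ g w → ((λ _ → 0ℚ) ⊛ g) w ≡ 0ℚ
  ⊛-zeroˡ g [] = *-zeroˡ _
  ⊛-zeroˡ g (l ∷ w) = trans (ring₆ _ _) (⊛-zeroˡ g w)

  ⊛-emptyˡ : ∀ g w → ((λ u → ⟦ isEmpty u ⟧) ⊛ g) w ≡ g w
  ⊛-emptyˡ g [] = *-identityˡ _
  ⊛-emptyˡ g (l ∷ w) = trans (cong (λ z → 1ℚ * g (l ∷ w) + z) (⊛-zeroˡ g w)) (ring₄ _)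

  -- Cut a walk at its last tie.
  nonneg-decompose : ∀ y t c w → ⟦ nonneg y t c w ⟧ ≡ ((λ u → ⟦ tied y t c u ⟧) ⊛ Kₛ true) w + ⟦ positive y t w ⟧
  nonneg-decompose (+ zero) -[1+ t ] true [] = sym (ring₄ 1ℚ)
  nonneg-decompose (+ zero) -[1+ t ] true (l ∷ w) =
    trans (nonneg-decompose (step l (+ 0)) (+ 0 ℤ.+ step l (+ 0)) true w) (sym (ring₂ _ _))
  nonneg-decompose (+ zero) -[1+ t ] false w = sym (trans (cong (_+ 0ℚ) (⊛-zeroˡ (Kₛ true) w)) (+-identityˡ 0ℚ))
  nonneg-decompose (+ zero) (+ zero) c [] = sym (ring₄ 1ℚ)
  nonneg-decompose (+ zero) (+ zero) c (l ∷ w) =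
    trans (nonneg-decompose (step l (+ 0)) (+ 0 ℤ.+ step l (+ 0)) c w) (sym (ring₂ _ _))
  nonneg-decompose (+ zero) (+ suc t) c [] = sym (ring₅ 1ℚ)
  nonneg-decompose (+ zero) (+ suc t) c (l ∷ w) =
    trans (nonneg-decompose (step l (+ 0)) (+ suc t ℤ.+ step l (+ 0)) c w) (sym (ring₁ _ _ _))
  nonneg-decompose (+ suc y) t c [] = sym (ring₃ 1ℚ)
  nonneg-decompose (+ suc y) t c (l ∷ w) =
    trans (nonneg-decompose (step l (+ suc y)) (t ℤ.+ step l (+ suc y)) c w) (sym (ring₁ _ _ _))
  nonneg-decompose -[1+ y ] t c [] = sym (ring₃ 1ℚ)
  nonneg-decompose -[1+ y ] t c (l ∷ w) =
    trans (nonneg-decompose (step l -[1+ y ]) (t ℤ.+ step l -[1+ y ]) c w) (sym (ring₁ _ _ _))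

  H-decompose : ∀ c w → H c w ≡ (Eₛ c ⊛ Kₛ c) w
  H-decompose c w = trans (nonneg-decompose (+ 0) (+ 0) c w) (+-identityʳ _)

  -- Cut at the first tie: from there on the walk starts afresh at height and area 0.
  tied-decompose : ∀ y t w → ⟦ tied y t false w ⟧ ≡ ((λ u → ⟦ firstTie y t u ⟧) ⊛ Eₛ false) w
  tied-decompose (+ zero) (+ zero) w = sym (⊛-emptyˡ (Eₛ false) w)
  tied-decompose (+ zero) -[1+ t ] w = sym (⊛-zeroˡ (Eₛ false) w)
  tied-decompose (+ zero) (+ suc t) [] = sym (*-zeroˡ _)
  tied-decompose (+ zero) (+ suc t) (l ∷ w) =
    trans (tied-decompose (step l (+ 0)) (+ suc t ℤ.+ step l (+ 0)) w) (sym (ring₆ _ _))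
  tied-decompose (+ suc y) t [] = sym (*-zeroˡ _)
  tied-decompose (+ suc y) t (l ∷ w) =
    trans (tied-decompose (step l (+ suc y)) (t ℤ.+ step l (+ suc y)) w) (sym (ring₆ _ _))
  tied-decompose -[1+ y ] t [] = sym (*-zeroˡ _)
  tied-decompose -[1+ y ] t (l ∷ w) =
    trans (tied-decompose (step l -[1+ y ]) (t ℤ.+ step l -[1+ y ]) w) (sym (ring₆ _ _))

  -- This is E = 1 / (1 - I), from which √E is later seen to have nonnegative coefficients bounded
  -- by those of E.
  E-renewal : ∀ w → Eₛ false w ≡ ⟦ isEmpty w ⟧ + (I false ⊛ Eₛ false) w
  E-renewal [] = sym (trans (cong (λ z → 1ℚ + z) (*-zeroˡ _)) (+-identityʳ 1ℚ))
  E-renewal (l ∷ w) = trans (tied-decompose (step l (+ 0)) (+ 0 ℤ.+ step l (+ 0)) w)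
    (sym (trans (+-identityˡ _) (ring₆ _ _)))

  -- A walk above the axis has nonnegative area, and so has one that has just come down to the axis.
  Admissible : ℤ → ℤ → Bool → Set
  Admissible (+ zero) t f = f ≡ true → + 0 ℤ.≤ t
  Admissible (+ suc _) t f = + 0 ℤ.≤ t
  Admissible -[1+ _ ] t f = ⊤

  nonneg+nonneg : ∀ {t} y → + 0 ℤ.≤ t → + 0 ℤ.≤ t ℤ.+ + y
  nonneg+nonneg y (+≤+ _) = +≤+ z≤n

  admissible-above : ∀ {y t} l → + 0 ℤ.≤ t → Admissible (step l (+ y)) (t ℤ.+ step l (+ y)) (descends l)
  admissible-above {zero} dn p = tt
  admissible-above {suc zero} dn p = λ _ → nonneg+nonneg 0 p
  admissible-above {suc (suc y)} dn p = nonneg+nonneg (suc y) p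
  admissible-above {zero} z₀ p = λ _ → nonneg+nonneg 0 p
  admissible-above {suc y} z₀ p = nonneg+nonneg (suc y) p
  admissible-above {zero} z₁ p = λ _ → nonneg+nonneg 0 p
  admissible-above {suc y} z₁ p = nonneg+nonneg (suc y) p
  admissible-above {y} up p = nonneg+nonneg (suc y) p

  admissible-below : ∀ y t l → Admissible (step l -[1+ y ]) (t ℤ.+ step l -[1+ y ]) (descends l)
  admissible-below y t dn = tt
  admissible-below y t z₀ = tt
  admissible-below y t z₁ = tt
  admissible-below zero t up = λ ()
  admissible-below (suc y) t up = tt

  primitive-ascending : ∀ w → primitive′ (+ 0) false w ≡ false
  primitive-ascending [] = refl
  primitive-ascending (l ∷ w) = refl

  -- Cut a walk before its last block.
  desc-decompose : ∀ y t c f w → Admissible y t f →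
    ⟦ nonnegDesc y t c f w ⟧ ≡ ((λ u → ⟦ nonneg y t c u ⟧) ⊛ P c) w + ⟦ primitive′ y f w ⟧
  desc-decompose (+ zero) -[1+ t ] true false [] adm = sym (ring₇ 1ℚ 0ℚ)
  desc-decompose (+ zero) -[1+ t ] true false (l ∷ w) adm = trans
    (desc-decompose (step l (+ 0)) (+ 0 ℤ.+ step l (+ 0)) true (descends l) w (admissible-above {0} l (+≤+ z≤n))) (sym (ring₂ _ _))
  -- A descending letter reaches the axis from above or along it, and neither can make the area
  -- negative. So the last block always passes the test, which is why it splits off as an
  -- independent factor.
  desc-decompose (+ zero) -[1+ t ] c true w adm with () ← adm refl
  desc-decompose (+ zero) -[1+ t ] false false w adm = sym (trans
    (cong₂ _+_ (⊛-zeroˡ (P false) w) (cong ⟦_⟧ (primitive-ascending w))) (+-identityˡ 0ℚ))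
  desc-decompose (+ zero) (+ t) c f [] adm = sym (ring₇ 1ℚ ⟦ f ⟧)
  desc-decompose (+ zero) (+ t) c f (l ∷ w) adm = trans
    (desc-decompose (step l (+ 0)) (+ t ℤ.+ step l (+ 0)) c (descends l) w (admissible-above {0} l (+≤+ z≤n))) (sym (ring₂ _ _))
  desc-decompose (+ suc y) t c f [] adm = sym (ring₃ 0ℚ)
  desc-decompose (+ suc y) t c f (l ∷ w) adm = trans
    (desc-decompose (step l (+ suc y)) (t ℤ.+ step l (+ suc y)) c (descends l) w (admissible-above {suc y} l adm)) (sym (ring₁ _ _ _))
  desc-decompose -[1+ y ] t c f [] adm = sym (ring₃ 0ℚ)
  desc-decompose -[1+ y ] t c f (l ∷ w) adm = trans
    (desc-decompose (step l -[1+ y ]) (t ℤ.+ step l -[1+ y ]) c (descends l) w (admissible-below y t l)) (sym (ring₁ _ _ _))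

  HD : Bool → Word → ℚ
  HD c w = ⟦ nonnegDesc (+ 0) (+ 0) c false w ⟧

  HD-decompose : ∀ c w → HD c w ≡ (H c ⊛ P c) w
  HD-decompose c w = trans (desc-decompose (+ 0) (+ 0) c false w (λ ()))
    (trans (cong (λ b → (H c ⊛ P c) w + ⟦ b ⟧) (primitive-ascending w)) (+-identityʳ _))

-- Reversing a walk, and its effect on the area

module Reversal where

  open Rationals
  open Sequences
  open Words
  open Walks
  open import Data.Nat.Base as ℕ using (zero; suc; z≤n)
  open import Data.Integer.Base as ℤ using (ℤ; +_; -[1+_]; +≤+; -≤+)
  import Data.Integer.Properties as ℤ
  import Data.Integer.Tactic.RingSolver as ℤ
  open import Data.Bool.Base using (true; false; _∧_)
  open import Data.List.Base using ([]; _∷_; _++_; _∷ʳ_; reverse; length)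
  open import Data.List.Properties using (unfold-reverse; reverse-++; reverse-involutive)
  open import Data.Product using (_×_; _,_; proj₁; proj₂)
  open import Data.Sum using (_⊎_; inj₁; inj₂)
  open import Relation.Binary.PropositionalEquality
  open import Tactic.RingSolver using (solve-∀)

  end area : ℤ → Word → ℤ
  end y [] = y
  end y (l ∷ w) = end (step l y) w
  area y [] = + 0
  area y (l ∷ w) = step l y ℤ.+ area (step l y) w

  value : Letter → ℤ
  value l = step l (+ 0)

  step-value : ∀ l y → step l y ≡ value l ℤ.+ y
  step-value dn y = refl
  step-value z₀ y = sym (ℤ.+-identityˡ y)
  step-value z₁ y = sym (ℤ.+-identityˡ y)
  step-value up y = refl

  end-shift : ∀ y w → end y w ≡ end (+ 0) w ℤ.+ y
  end-shift y [] = sym (ℤ.+-identityˡ y)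
  end-shift y (l ∷ w) = trans (end-shift (step l y) w) (trans (cong (λ z → end (+ 0) w ℤ.+ z) (step-value l y))
    (trans (sym (ℤ.+-assoc (end (+ 0) w) (value l) y)) (cong (ℤ._+ y) (sym (end-shift (value l) w)))))

  end-++ : ∀ y u v → end y (u ++ v) ≡ end (end y u) v
  end-++ y [] v = refl
  end-++ y (l ∷ u) v = end-++ (step l y) u v

  area-++ : ∀ y u v → area y (u ++ v) ≡ area y u ℤ.+ area (end y u) v
  area-++ y [] v = sym (ℤ.+-identityˡ _)
  area-++ y (l ∷ u) v = trans (cong (λ z → step l y ℤ.+ z) (area-++ (step l y) u v)) (sym (ℤ.+-assoc (step l y) _ _))

  area-shift : ∀ y w → area y w ≡ area (+ 0) w ℤ.+ + length w ℤ.* y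
  area-shift y [] = sym (trans (ℤ.+-identityˡ _) (ℤ.*-zeroˡ y))
  area-shift y (l ∷ w) = trans (cong₂ ℤ._+_ (step-value l y) (trans (area-shift (step l y) w)
      (cong (λ z → area (+ 0) w ℤ.+ + length w ℤ.* z) (step-value l y))))
    (trans (regroup (value l) y (area (+ 0) w) (+ length w))
      (cong (λ z → (value l ℤ.+ z) ℤ.+ + length (l ∷ w) ℤ.* y) (sym (area-shift (value l) w))))
    where
    regroup : ∀ v y a n → (v ℤ.+ y) ℤ.+ (a ℤ.+ n ℤ.* (v ℤ.+ y)) ≡ (v ℤ.+ (a ℤ.+ n ℤ.* v)) ℤ.+ (+ 1 ℤ.+ n) ℤ.* y
    regroup = ℤ.solve-∀

  end-∷ʳ : ∀ w l → end (+ 0) (w ∷ʳ l) ≡ value l ℤ.+ end (+ 0) w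
  end-∷ʳ w l = trans (end-++ (+ 0) w (l ∷ [])) (step-value l _)

  end-reverse : ∀ w → end (+ 0) (reverse w) ≡ end (+ 0) w
  end-reverse [] = refl
  end-reverse (l ∷ w) = begin
    end (+ 0) (reverse (l ∷ w))          ≡⟨ cong (end (+ 0)) (unfold-reverse l w) ⟩
    end (+ 0) (reverse w ∷ʳ l)           ≡⟨ end-∷ʳ (reverse w) l ⟩
    value l ℤ.+ end (+ 0) (reverse w)    ≡⟨ cong (λ z → value l ℤ.+ z) (end-reverse w) ⟩
    value l ℤ.+ end (+ 0) w              ≡⟨ ℤ.+-comm (value l) _ ⟩
    end (+ 0) w ℤ.+ value l              ≡⟨ end-shift (value l) w ⟨
    end (value l) w                      ∎
    where open ≡-Reasoning

  -- At the mirrored time the reversed walk has height `end` minus the original height. Summing over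
  -- all `suc (length w)` points gives the identity.
  area-reverse : ∀ w → area (+ 0) (reverse w) ℤ.+ area (+ 0) w ≡ + suc (length w) ℤ.* end (+ 0) w
  area-reverse [] = refl
  area-reverse (l ∷ w) = begin
    area (+ 0) (reverse (l ∷ w)) ℤ.+ (value l ℤ.+ area (value l) w)
      ≡⟨ cong₂ (λ x y → area (+ 0) x ℤ.+ (value l ℤ.+ y)) (unfold-reverse l w) (area-shift (value l) w) ⟩
    area (+ 0) (reverse w ∷ʳ l) ℤ.+ (value l ℤ.+ (area (+ 0) w ℤ.+ n ℤ.* value l))
      ≡⟨ cong (λ z → z ℤ.+ (value l ℤ.+ (area (+ 0) w ℤ.+ n ℤ.* value l))) (area-++ (+ 0) (reverse w) (l ∷ [])) ⟩
    (area (+ 0) (reverse w) ℤ.+ (step l (end (+ 0) (reverse w)) ℤ.+ + 0)) ℤ.+ (value l ℤ.+ (area (+ 0) w ℤ.+ n ℤ.* value l))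
      ≡⟨ cong (λ z → (area (+ 0) (reverse w) ℤ.+ (z ℤ.+ + 0)) ℤ.+ (value l ℤ.+ (area (+ 0) w ℤ.+ n ℤ.* value l)))
           (trans (step-value l _) (cong (λ z → value l ℤ.+ z) (end-reverse w))) ⟩
    (area (+ 0) (reverse w) ℤ.+ ((value l ℤ.+ end (+ 0) w) ℤ.+ + 0)) ℤ.+ (value l ℤ.+ (area (+ 0) w ℤ.+ n ℤ.* value l))
      ≡⟨ regroup₁ (area (+ 0) (reverse w)) (value l) (end (+ 0) w) (area (+ 0) w) n ⟩
    (area (+ 0) (reverse w) ℤ.+ area (+ 0) w) ℤ.+ (end (+ 0) w ℤ.+ (+ 2 ℤ.+ n) ℤ.* value l)
      ≡⟨ cong (λ z → z ℤ.+ (end (+ 0) w ℤ.+ (+ 2 ℤ.+ n) ℤ.* value l)) (area-reverse w) ⟩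
    (+ 1 ℤ.+ n) ℤ.* end (+ 0) w ℤ.+ (end (+ 0) w ℤ.+ (+ 2 ℤ.+ n) ℤ.* value l)
      ≡⟨ regroup₂ (end (+ 0) w) (value l) n ⟩
    (+ 2 ℤ.+ n) ℤ.* (end (+ 0) w ℤ.+ value l) ≡⟨ cong ((+ 2 ℤ.+ n) ℤ.*_) (end-shift (value l) w) ⟨
    (+ 2 ℤ.+ n) ℤ.* end (value l) w ∎
    where
    open ≡-Reasoning
    n : ℤ
    n = + length w
    regroup₁ : ∀ r v e a n → (r ℤ.+ ((v ℤ.+ e) ℤ.+ + 0)) ℤ.+ (v ℤ.+ (a ℤ.+ n ℤ.* v)) ≡ (r ℤ.+ a) ℤ.+ (e ℤ.+ (+ 2 ℤ.+ n) ℤ.* v)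
    regroup₁ = ℤ.solve-∀
    regroup₂ : ∀ e v n → (+ 1 ℤ.+ n) ℤ.* e ℤ.+ (e ℤ.+ (+ 2 ℤ.+ n) ℤ.* v) ≡ (+ 2 ℤ.+ n) ℤ.* (e ℤ.+ v)
    regroup₂ = ℤ.solve-∀

  area-reverse-bridge : ∀ w → end (+ 0) w ≡ + 0 → area (+ 0) (reverse w) ≡ ℤ.- area (+ 0) w
  area-reverse-bridge w e = begin
    area (+ 0) (reverse w)                                            ≡⟨ expand _ (area (+ 0) w) ⟩
    (area (+ 0) (reverse w) ℤ.+ area (+ 0) w) ℤ.- area (+ 0) w        ≡⟨ cong (ℤ._- area (+ 0) w) (area-reverse w) ⟩
    + suc (length w) ℤ.* end (+ 0) w ℤ.- area (+ 0) w                 ≡⟨ cong (λ z → + suc (length w) ℤ.* z ℤ.- area (+ 0) w) e ⟩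
    + suc (length w) ℤ.* + 0 ℤ.- area (+ 0) w                         ≡⟨ cong (ℤ._- area (+ 0) w) (ℤ.*-zeroʳ (+ suc (length w))) ⟩
    + 0 ℤ.- area (+ 0) w                                              ≡⟨ ℤ.+-identityˡ _ ⟩
    ℤ.- area (+ 0) w                                                  ∎
    where
    open ≡-Reasoning
    expand : ∀ r a → r ≡ (r ℤ.+ a) ℤ.- a
    expand = ℤ.solve-∀

  isZero-sound : ∀ {y} → isZero y ≡ true → y ≡ + 0
  isZero-sound {+ zero} _ = refl

  ∧-true : ∀ {a b} → a ∧ b ≡ true → a ≡ true × b ≡ true
  ∧-true {true} {true} _ = refl , refl

  nonneg-unfold : ∀ y t w → nonneg y t false w ≡ true → nonneg′ y t false w ≡ true × (y ≡ + 0 → + 0 ℤ.≤ t)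
  nonneg-unfold (+ zero) (+ t) w p = p , λ _ → +≤+ z≤n
  nonneg-unfold (+ suc y) t w p = p , λ ()
  nonneg-unfold -[1+ y ] t w p = p , λ ()

  nonneg-fold : ∀ y t w → nonneg′ y t false w ≡ true → (y ≡ + 0 → + 0 ℤ.≤ t) → nonneg y t false w ≡ true
  nonneg-fold (+ zero) (+ t) w p q = p
  nonneg-fold (+ zero) -[1+ t ] w p q with () ← q refl
  nonneg-fold (+ suc y) t w p q = p
  nonneg-fold -[1+ y ] t w p q = p

  nonneg-end : ∀ y t c w → nonneg y t c w ≡ true → end y w ≡ + 0
  nonneg-end (+ zero) -[1+ t ] true [] p = refl
  nonneg-end (+ zero) -[1+ t ] true (l ∷ w) p = nonneg-end (step l (+ 0)) (+ 0 ℤ.+ step l (+ 0)) true w p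
  nonneg-end (+ zero) (+ t) c [] p = refl
  nonneg-end (+ zero) (+ t) c (l ∷ w) p = nonneg-end (step l (+ 0)) (+ t ℤ.+ step l (+ 0)) c w p
  nonneg-end (+ suc y) t c (l ∷ w) p = nonneg-end (step l (+ suc y)) (t ℤ.+ step l (+ suc y)) c w p
  nonneg-end -[1+ y ] t c (l ∷ w) p = nonneg-end (step l -[1+ y ]) (t ℤ.+ step l -[1+ y ]) c w p

  -- The tests rephrased for prefixes ending at height 0, the form in which a walk can be reversed;
  -- `nonneg-complete` is the converse.
  nonneg-prefix : ∀ y t u v → nonneg y t false (u ++ v) ≡ true → end y u ≡ + 0 → + 0 ℤ.≤ t ℤ.+ area y u
  nonneg-prefix y t [] v p e = subst (+ 0 ℤ.≤_) (sym (ℤ.+-identityʳ t)) (proj₂ (nonneg-unfold y t v p) e)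
  nonneg-prefix y t (l ∷ u) v p e = subst (+ 0 ℤ.≤_) (ℤ.+-assoc t (step l y) _)
    (nonneg-prefix (step l y) (t ℤ.+ step l y) u v (proj₁ (nonneg-unfold y t (l ∷ u ++ v) p)) e)

  nonneg-complete : ∀ y t w → end y w ≡ + 0 → (∀ u v → w ≡ u ++ v → end y u ≡ + 0 → + 0 ℤ.≤ t ℤ.+ area y u) →
                    nonneg y t false w ≡ true
  nonneg-complete y t [] refl q = nonneg-fold (+ 0) t [] refl λ e → subst (+ 0 ℤ.≤_) (ℤ.+-identityʳ t) (q [] [] refl e)
  nonneg-complete y t (l ∷ w) e q = nonneg-fold y t (l ∷ w)
    (nonneg-complete (step l y) (t ℤ.+ step l y) w e
      λ u v eq z → subst (+ 0 ℤ.≤_) (sym (ℤ.+-assoc t (step l y) _)) (q (l ∷ u) v (cong (l ∷_) eq) z))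
    λ z → subst (+ 0 ℤ.≤_) (ℤ.+-identityʳ t) (q [] (l ∷ w) refl z)

  reset : ℤ → ℤ → ℤ
  reset (+ zero) -[1+ _ ] = + 0
  reset y t = t

  tied-reset : ∀ y t w → tied y t true w ≡ tied′ y (reset y t) true w
  tied-reset (+ zero) (+ t) w = refl
  tied-reset (+ zero) -[1+ t ] w = refl
  tied-reset (+ suc y) t w = refl
  tied-reset -[1+ y ] t w = refl

  ≤-reset : ∀ y t → t ℤ.≤ reset y t
  ≤-reset (+ zero) (+ t) = ℤ.≤-refl
  ≤-reset (+ zero) -[1+ t ] = -≤+
  ≤-reset (+ suc y) t = ℤ.≤-refl
  ≤-reset -[1+ y ] t = ℤ.≤-refl

  0≤reset : ∀ t → + 0 ℤ.≤ reset (+ 0) t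
  0≤reset (+ t) = +≤+ z≤n
  0≤reset -[1+ t ] = +≤+ z≤n

  reset-cases : ∀ y t → reset y t ≡ t ⊎ (y ≡ + 0 × reset y t ≡ + 0)
  reset-cases (+ zero) (+ t) = inj₁ refl
  reset-cases (+ zero) -[1+ t ] = inj₂ (refl , refl)
  reset-cases (+ suc y) t = inj₁ refl
  reset-cases -[1+ y ] t = inj₁ refl

  -- Moving the origin can only increase the recorded area, and an accepted walk finishes with
  -- record 0. So no suffix starting at a zero has positive area, which says that the final area is
  -- minimal.
  tied-sound : ∀ y t w → tied y t true w ≡ true →
    reset y t ℤ.+ area y w ℤ.≤ + 0 × (∀ u v → w ≡ u ++ v → end y u ≡ + 0 → area (+ 0) v ℤ.≤ + 0)
  tied-sound y t [] p with ∧-true {isZero y} (trans (sym (tied-reset y t [])) p)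
  ... | _ , z = ℤ.≤-reflexive (trans (ℤ.+-identityʳ _) (isZero-sound z)) , λ { [] [] refl e → ℤ.≤-refl }
  tied-sound y t (l ∷ w) p with tied-sound (step l y) (reset y t ℤ.+ step l y) w (trans (sym (tied-reset y t (l ∷ w))) p)
  ... | bound , suffix = bound′ , λ
    { [] v refl refl → ℤ.≤-trans (ℤ.i≤j⇒i≤k+j (reset (+ 0) t) {{ℤ.nonNegative (0≤reset t)}} ℤ.≤-refl) bound′
    ; (_ ∷ u) v refl e → suffix u v refl e }
    where
    bound′ : reset y t ℤ.+ area y (l ∷ w) ℤ.≤ + 0
    bound′ = ℤ.≤-trans (ℤ.≤-reflexive (sym (ℤ.+-assoc (reset y t) (step l y) _)))
      (ℤ.≤-trans (ℤ.+-monoˡ-≤ (area (step l y) w) (≤-reset (step l y) _)) bound)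

  tied-complete : ∀ y t w → end y w ≡ + 0 → reset y t ℤ.+ area y w ℤ.≤ + 0 →
    (∀ u v → w ≡ u ++ v → end y u ≡ + 0 → area (+ 0) v ℤ.≤ + 0) → tied y t true w ≡ true
  tied-complete _ t [] refl bound suffix = trans (tied-reset (+ 0) t [])
    (cong isZero (ℤ.≤-antisym (subst (ℤ._≤ + 0) (ℤ.+-identityʳ _) bound) (0≤reset t)))
  tied-complete y t (l ∷ w) e bound suffix = trans (tied-reset y t (l ∷ w))
    (tied-complete (step l y) (reset y t ℤ.+ step l y) w e bound′ λ u v eq → suffix (l ∷ u) v (cong (l ∷_) eq))
    where
    bound′ : reset (step l y) (reset y t ℤ.+ step l y) ℤ.+ area (step l y) w ℤ.≤ + 0
    bound′ with reset-cases (step l y) (reset y t ℤ.+ step l y)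
    ... | inj₁ eq = subst (λ z → z ℤ.+ area (step l y) w ℤ.≤ + 0) (sym eq)
                      (subst (ℤ._≤ + 0) (sym (ℤ.+-assoc (reset y t) (step l y) _)) bound)
    -- After a move of the origin, the rest of the walk is a suffix starting at a zero, and its area
    -- is at most 0 by assumption.
    ... | inj₂ (at0 , eq) = subst₂ (λ a z → z ℤ.+ area a w ℤ.≤ + 0) (sym at0) (sym eq)
                      (subst (ℤ._≤ + 0) (sym (ℤ.+-identityˡ _)) (suffix (l ∷ []) w refl at0))

  tied-end : ∀ y t c w → tied y t c w ≡ true → end y w ≡ + 0
  tied-end (+ zero) -[1+ t ] true [] p = refl
  tied-end (+ zero) -[1+ t ] true (l ∷ w) p = tied-end (step l (+ 0)) (+ 0 ℤ.+ step l (+ 0)) true w p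
  tied-end (+ zero) (+ t) c [] p = refl
  tied-end (+ zero) (+ t) c (l ∷ w) p = tied-end (step l (+ 0)) (+ t ℤ.+ step l (+ 0)) c w p
  tied-end (+ suc y) t c (l ∷ w) p = tied-end (step l (+ suc y)) (t ℤ.+ step l (+ suc y)) c w p
  tied-end -[1+ y ] t c (l ∷ w) p = tied-end (step l -[1+ y ]) (t ℤ.+ step l -[1+ y ]) c w p

  -- A prefix of the reversed walk ending at a zero is a reversed suffix of w starting at a zero,
  -- and reversal negates the area of a bridge. So minimality of the final area becomes
  -- nonnegativity at all zeros.
  tied-reverse : ∀ w → tied (+ 0) (+ 0) true w ≡ true → nonneg (+ 0) (+ 0) false (reverse w) ≡ true
  tied-reverse w p = nonneg-complete (+ 0) (+ 0) (reverse w) (trans (end-reverse w) e) λ u v eq z →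
    subst (+ 0 ℤ.≤_) (trans (cong ℤ.-_ (area-reverse-bridge u z)) (trans (ℤ.neg-involutive _) (sym (ℤ.+-identityˡ _))))
      (ℤ.neg-mono-≤ (proj₂ (tied-sound (+ 0) (+ 0) w p) (reverse v) (reverse u) (split u v eq) (end-rest u v eq z)))
    where
    e : end (+ 0) w ≡ + 0
    e = tied-end (+ 0) (+ 0) true w p
    split : ∀ u v → reverse w ≡ u ++ v → w ≡ reverse v ++ reverse u
    split u v eq = trans (sym (reverse-involutive w)) (trans (cong reverse eq) (reverse-++ u v))
    end-rest : ∀ u v → reverse w ≡ u ++ v → end (+ 0) u ≡ + 0 → end (+ 0) (reverse v) ≡ + 0
    end-rest u v eq z = trans (end-reverse v) (trans (cong (λ a → end a v) (sym z))
      (trans (sym (end-++ (+ 0) u v)) (trans (cong (end (+ 0)) (sym eq)) (trans (end-reverse w) e))))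

  reverse-tied : ∀ w → nonneg (+ 0) (+ 0) false (reverse w) ≡ true → tied (+ 0) (+ 0) true w ≡ true
  reverse-tied w p = tied-complete (+ 0) (+ 0) w e (subst (ℤ._≤ + 0) (sym (ℤ.+-identityˡ _)) (suffix [] w refl refl)) suffix
    where
    e : end (+ 0) w ≡ + 0
    e = trans (sym (end-reverse w)) (nonneg-end (+ 0) (+ 0) false (reverse w) p)
    suffix : ∀ u v → w ≡ u ++ v → end (+ 0) u ≡ + 0 → area (+ 0) v ℤ.≤ + 0
    suffix u v eq z = subst (ℤ._≤ + 0) (trans (cong ℤ.-_ (trans (ℤ.+-identityˡ _) (area-reverse-bridge v z′))) (ℤ.neg-involutive _))
      (ℤ.neg-mono-≤ (nonneg-prefix (+ 0) (+ 0) (reverse v) (reverse u)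
        (subst (λ x → nonneg (+ 0) (+ 0) false x ≡ true) (trans (cong reverse eq) (reverse-++ u v)) p)
        (trans (end-reverse v) z′)))
      where
      z′ : end (+ 0) v ≡ + 0
      z′ = trans (cong (λ a → end a v) (sym z)) (trans (sym (end-++ (+ 0) u v)) (trans (cong (end (+ 0)) (sym eq)) e))

  bool-ext : ∀ {a b} → (a ≡ true → b ≡ true) → (b ≡ true → a ≡ true) → a ≡ b
  bool-ext {false} {false} p q = refl
  bool-ext {false} {true} p q = q refl
  bool-ext {true} {b} p q = sym (p refl)

  tied≡nonneg-reverse : ∀ w → tied (+ 0) (+ 0) true w ≡ nonneg (+ 0) (+ 0) false (reverse w)
  tied≡nonneg-reverse w = bool-ext (tied-reverse w) (reverse-tied w)

-- Walks weighted by a character of their area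

module Weighted where

  open Rationals
  open Sequences
  open Words
  open Walks
  open Reversal
  open import Data.Nat.Base as ℕ using (zero; suc)
  open import Data.Integer.Base as ℤ using (ℤ; +_; -[1+_])
  import Data.Integer.Properties as ℤ
  open import Data.Bool.Base using (true; false)
  open import Data.List.Base using ([]; _∷_; reverse)
  open import Data.Sum using (_⊎_; inj₁; inj₂)
  open import Relation.Binary.PropositionalEquality
  open import Tactic.RingSolver using (solve-∀)

  private
    opaque
      unfolding _+_

      ring₁ : ∀ f g → (f * 1ℚ) * (g * 1ℚ) ≡ (f * g) * 1ℚ
      ring₁ = solve-∀ ℚ-ring

      ring₂ : ∀ f g x → (f * 1ℚ) * (g * x) ≡ (f * g) * x
      ring₂ = solve-∀ ℚ-ring

      ring₃ : ∀ a s x → s * (a * x) ≡ a * (s * x)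
      ring₃ = solve-∀ ℚ-ring

      ring₄ : ∀ s a b c → (s * a) * b + s * c ≡ s * (a * b + c)
      ring₄ = solve-∀ ℚ-ring

      ring₅ : ∀ g x y → (0ℚ * 1ℚ) * (g * x) ≡ (0ℚ * g) * y
      ring₅ = solve-∀ ℚ-ring

      ring₆ : ∀ x → 0ℚ * x ≡ 0ℚ
      ring₆ = solve-∀ ℚ-ring

      ring₇ : ∀ x → x * 1ℚ ≡ x
      ring₇ = solve-∀ ℚ-ring

  ⊛-congˡ : ∀ {f f′} g → (∀ w → f w ≡ f′ w) → ∀ w → (f ⊛ g) w ≡ (f′ ⊛ g) w
  ⊛-congˡ g p [] = cong (_* g []) (p [])
  ⊛-congˡ g p (l ∷ w) = cong₂ (λ a b → a * g (l ∷ w) + b) (p []) (⊛-congˡ g (λ u → p (l ∷ u)) w)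

  ⊛-scaleˡ : ∀ s f g w → ((λ u → s * f u) ⊛ g) w ≡ s * (f ⊛ g) w
  ⊛-scaleˡ s f g [] = *-assoc s _ _
  ⊛-scaleˡ s f g (l ∷ w) = trans (cong (λ z → (s * f []) * g (l ∷ w) + z) (⊛-scaleˡ s (λ u → f (l ∷ u)) g w))
    (ring₄ s (f []) (g (l ∷ w)) _)

  ⟦⟧-cases : ∀ b → ⟦ b ⟧ ≡ 0ℚ ⊎ b ≡ true
  ⟦⟧-cases true = inj₂ refl
  ⟦⟧-cases false = inj₁ refl

  tied-area : ∀ y t w → tied y t false w ≡ true → t ℤ.+ area y w ≡ + 0
  tied-area (+ zero) (+ zero) [] p = refl
  tied-area (+ zero) (+ t) (l ∷ w) p =
    trans (sym (ℤ.+-assoc (+ t) (step l (+ 0)) _)) (tied-area (step l (+ 0)) (+ t ℤ.+ step l (+ 0)) w p)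
  tied-area (+ suc y) t (l ∷ w) p =
    trans (sym (ℤ.+-assoc t (step l (+ suc y)) _)) (tied-area (step l (+ suc y)) (t ℤ.+ step l (+ suc y)) w p)
  tied-area -[1+ y ] t (l ∷ w) p =
    trans (sym (ℤ.+-assoc t (step l -[1+ y ]) _)) (tied-area (step l -[1+ y ]) (t ℤ.+ step l -[1+ y ]) w p)

  -- Applied to the trivial character and to the parity sign, so that plain and signed counts share
  -- one proof. Invariance under negation is what makes the weight compatible with reversal.
  module Weight (χ : ℤ → ℚ) (χ-0 : χ (+ 0) ≡ 1ℚ) (χ-+ : ∀ x y → χ (x ℤ.+ y) ≡ χ x * χ y)
    (χ-neg : ∀ x → χ (ℤ.- x) ≡ χ x) where

    weigh : ℤ → (Word → ℚ) → Word → ℚ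
    weigh y f w = f w * χ (area y w)

    -- Areas add under cutting exactly when the second piece starts at height 0; hence the condition
    -- that f is supported on walks ending there.
    weigh-⊛ : ∀ y f g → (∀ u → f u ≡ 0ℚ ⊎ end y u ≡ + 0) → ∀ w → (weigh y f ⊛ weigh (+ 0) g) w ≡ weigh y (f ⊛ g) w
    weigh-⊛ y f g s [] = subst (λ x → (f [] * x) * (g [] * x) ≡ (f [] * g []) * x) (sym χ-0) (ring₁ _ _)
    weigh-⊛ y f g s (l ∷ w) = begin
      (f [] * χ (+ 0)) * (g (l ∷ w) * χ (area (+ 0) (l ∷ w))) + ((λ u → weigh y f (l ∷ u)) ⊛ weigh (+ 0) g) w
        ≡⟨ cong₂ _+_ first rest ⟩
      (f [] * g (l ∷ w)) * χ (area y (l ∷ w)) + (f-after ⊛ g) w * χ (area y (l ∷ w))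
        ≡⟨ distribʳ (χ (area y (l ∷ w))) _ _ ⟨
      (f [] * g (l ∷ w) + (f-after ⊛ g) w) * χ (area y (l ∷ w)) ∎
      where
      open ≡-Reasoning
      f-after : Word → ℚ
      f-after u = f (l ∷ u)
      y′ : ℤ
      y′ = step l y
      first : (f [] * χ (+ 0)) * (g (l ∷ w) * χ (area (+ 0) (l ∷ w))) ≡ (f [] * g (l ∷ w)) * χ (area y (l ∷ w))
      first rewrite χ-0 with s []
      ... | inj₁ f0 rewrite f0 = ring₅ _ _ _
      ... | inj₂ refl = ring₂ _ _ _
      rest : ((λ u → weigh y f (l ∷ u)) ⊛ weigh (+ 0) g) w ≡ (f-after ⊛ g) w * χ (area y (l ∷ w))
      rest = begin
        ((λ u → f (l ∷ u) * χ (y′ ℤ.+ area y′ u)) ⊛ weigh (+ 0) g) w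
          ≡⟨ ⊛-congˡ (weigh (+ 0) g) (λ u → trans (cong (f (l ∷ u) *_) (χ-+ y′ _)) (ring₃ (χ y′) (f (l ∷ u)) _)) w ⟩
        ((λ u → χ y′ * weigh y′ f-after u) ⊛ weigh (+ 0) g) w ≡⟨ ⊛-scaleˡ (χ y′) (weigh y′ f-after) (weigh (+ 0) g) w ⟩
        χ y′ * (weigh y′ f-after ⊛ weigh (+ 0) g) w ≡⟨ cong (χ y′ *_) (weigh-⊛ y′ f-after g (λ u → s (l ∷ u)) w) ⟩
        χ y′ * ((f-after ⊛ g) w * χ (area y′ w))     ≡⟨ ring₃ ((f-after ⊛ g) w) (χ y′) _ ⟩
        (f-after ⊛ g) w * (χ y′ * χ (area y′ w))     ≡⟨ cong ((f-after ⊛ g) w *_) (χ-+ y′ _) ⟨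
        (f-after ⊛ g) w * χ (y′ ℤ.+ area y′ w)       ∎

    weighted : (Word → ℚ) → Seq
    weighted f = means (weigh (+ 0) f)

    weighted-⊛ : ∀ {f} g → (∀ u → f u ≡ 0ℚ ⊎ end (+ 0) u ≡ + 0) → weighted (f ⊛ g) ≈ weighted f ⋆ weighted g
    weighted-⊛ {f} g s n = trans (E-cong n λ w → sym (weigh-⊛ (+ 0) f g s w)) (E-⊛ _ _ n)

    weighted-cong : ∀ {f g} → (∀ w → f w ≡ g w) → weighted f ≈ weighted g
    weighted-cong p n = E-cong n λ w → cong (_* χ (area (+ 0) w)) (p w)

    Eₛ-support : ∀ c u → Eₛ c u ≡ 0ℚ ⊎ end (+ 0) u ≡ + 0
    Eₛ-support c u with ⟦⟧-cases (tied (+ 0) (+ 0) c u)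
    ... | inj₁ z = inj₁ z
    ... | inj₂ p = inj₂ (tied-end (+ 0) (+ 0) c u p)

    H-support : ∀ c u → H c u ≡ 0ℚ ⊎ end (+ 0) u ≡ + 0
    H-support c u with ⟦⟧-cases (nonneg (+ 0) (+ 0) c u)
    ... | inj₁ z = inj₁ z
    ... | inj₂ p = inj₂ (nonneg-end (+ 0) (+ 0) c u p)

    weighted-H : ∀ c → weighted (H c) ≈ weighted (Eₛ c) ⋆ weighted (Kₛ c)
    weighted-H c = ≈-trans (weighted-cong (H-decompose c)) (weighted-⊛ (Kₛ c) (Eₛ-support c))

    weighted-HD : ∀ c → weighted (HD c) ≈ weighted (H c) ⋆ weighted (P c)
    weighted-HD c = ≈-trans (weighted-cong (HD-decompose c)) (weighted-⊛ (P c) (H-support c))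

    -- These walks have area 0 and so weight 1. The same series E, and the same √E, therefore serves
    -- the plain and the signed count.
    weighted-E : weighted (Eₛ false) ≈ means (Eₛ false)
    weighted-E n = E-cong n pointwise
      where
      pointwise : ∀ w → weigh (+ 0) (Eₛ false) w ≡ Eₛ false w
      pointwise w with tied (+ 0) (+ 0) false w in eq
      ... | false = ring₆ _
      ... | true = trans (cong (λ z → 1ℚ * χ z) (trans (sym (ℤ.+-identityˡ _)) (tied-area (+ 0) (+ 0) w eq)))
                     (trans (cong (1ℚ *_) χ-0) (ring₇ 1ℚ))

    weighted-reverse : weighted (Eₛ true) ≈ weighted (H false)
    weighted-reverse n = trans (E-cong n pointwise) (E-reverse n (weigh (+ 0) (H false)))
      where
      pointwise : ∀ w → weigh (+ 0) (Eₛ true) w ≡ weigh (+ 0) (H false) (reverse w)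
      pointwise w rewrite tied≡nonneg-reverse w with nonneg (+ 0) (+ 0) false (reverse w) in eq
      ... | false = trans (ring₆ _) (sym (ring₆ _))
      ... | true = cong (1ℚ *_) (sym (trans (cong χ (area-reverse-bridge w
                     (trans (sym (end-reverse w)) (nonneg-end (+ 0) (+ 0) false (reverse w) eq)))) (χ-neg _)))

    -- Write h, e, k for the series of `H false`, `Eₛ false`, `Kₛ`. Then h = e k, and all bridges
    -- give h k because reversal identifies `Eₛ true` with `H false`. Hence h² = (e k) h = (h k) e.
    H-squared : weighted (H false) ⋆ weighted (H false) ≈ weighted (H true) ⋆ means (Eₛ false)
    H-squared n = begin
      (h ⋆ h) n        ≡⟨ ⋆-cong (λ m → trans (weighted-H false m) (⋆-cong weighted-E (λ _ → refl) m)) (λ _ → refl) n ⟩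
      ((e ⋆ k) ⋆ h) n  ≡⟨ solve 3 (λ e k h → (e :* k) :* h := (h :* k) :* e) (λ _ → refl) e k h n ⟩
      ((h ⋆ k) ⋆ e) n  ≡⟨ ⋆-cong (λ m → sym (trans (weighted-H true m) (⋆-cong weighted-reverse (λ _ → refl) m))) (λ _ → refl) n ⟩
      (weighted (H true) ⋆ e) n ∎
      where
      open ≡-Reasoning
      h e k : Seq
      h = weighted (H false)
      e = means (Eₛ false)
      k = weighted (Kₛ false)

-- Counting bridges and their last letters

module Bridges where

  open Rationals
  open Sequences
  open Words
  open Walks
  open Reversal
  open Weighted
  open import Data.Nat.Base as ℕ using (ℕ; zero; suc)
  open import Data.Integer.Base as ℤ using (ℤ; +_; -[1+_])
  import Data.Integer.Properties as ℤ
  import Data.Integer.Tactic.RingSolver as ℤ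
  open import Data.Bool.Base using (Bool; true; false; _∧_; not)
  open import Data.List.Base using ([]; _∷_)
  open import Relation.Binary.PropositionalEquality
  open import Tactic.RingSolver using (solve-∀)

  private
    opaque
      unfolding _+_

      ring₁ : ∀ n y b c d → (2ℚ + n + y) * (¼ * ((b + c) + (c + d))) ≡ ¼ * ((2ℚ + n + y) * (b + c + c) + (1ℚ + n + (1ℚ + y)) * d)
      ring₁ = solve-∀ ℚ-ring

      ring₂ : ∀ n y b c → ¼ * ((2ℚ + n + y) * (b + c + c) + (n - (1ℚ + y)) * c)
                ≡ ¼ * ((2ℚ + n + y) * b + (1ℚ + n - y) * c + 2ℚ * ((1ℚ + n + y) * c))
      ring₂ = solve-∀ ℚ-ring

      ring₃ : ∀ n y b c → ¼ * ((2ℚ + n + y) * b + (1ℚ + n - y) * c + 2ℚ * ((n - y) * b))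
                ≡ ¼ * ((1ℚ + n + (y - 1ℚ)) * b + (1ℚ + n - y) * (b + b + c))
      ring₃ = solve-∀ ℚ-ring

      ring₄ : ∀ n y a b c → ¼ * ((n - (y - 1ℚ)) * a + (1ℚ + n - y) * (b + b + c)) ≡ (1ℚ + n - y) * (¼ * ((a + b) + (b + c)))
      ring₄ = solve-∀ ℚ-ring

      ring₅ : ∀ n y → 1ℚ + (1ℚ + n) + y ≡ 2ℚ + n + y
      ring₅ = solve-∀ ℚ-ring

      ring₆ : ∀ n a b c → (1ℚ + n) * (¼ * ((a + b) + (b + c)))
                ≡ ¼ * ((n - (- (1ℚ + 0ℚ))) * a + (1ℚ + n) * (b + b) + (1ℚ + n + 0ℚ) * c)
      ring₆ = solve-∀ ℚ-ring

      ring₇ : ∀ n b → ¼ * ((1ℚ + n + (- (1ℚ + 0ℚ))) * b + (1ℚ + n) * (b + b) + (n - 0ℚ) * b) ≡ n * b + ½ * b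
      ring₇ = solve-∀ ℚ-ring

      ring₉ : ∀ y → - (1ℚ + y) ≡ 1ℚ + (- (1ℚ + (1ℚ + y)))
      ring₉ = solve-∀ ℚ-ring

      ring₁₀ : ∀ y → (1ℚ + y) - 1ℚ ≡ y
      ring₁₀ = solve-∀ ℚ-ring

      zeros : ∀ n → (1ℚ + n + 0ℚ) * 0ℚ ≡ (n - 0ℚ) * 0ℚ
      zeros = solve-∀ ℚ-ring

      zero-left : ∀ a b → a * 0ℚ ≡ b * 0ℚ
      zero-left = solve-∀ ℚ-ring

      minus-one : (1ℚ + 0ℚ + (- (1ℚ + 0ℚ))) * 1ℚ ≡ (0ℚ - (- (1ℚ + 0ℚ))) * 0ℚ
      minus-one = refl

      at-zero : ∀ a → a * 0ℚ ≡ (0ℚ - 0ℚ) * 1ℚ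
      at-zero = solve-∀ ℚ-ring

  ζ : ℤ → ℚ
  ζ (+ n) = ι n
  ζ -[1+ n ] = - ι (suc n)

  ζ-suc : ∀ y → ζ (ℤ.suc y) ≡ 1ℚ + ζ y
  ζ-suc (+ n) = refl
  ζ-suc -[1+ zero ] = sym (trans (cong (λ z → 1ℚ + (- z)) (+-identityʳ 1ℚ)) (+-inverseʳ 1ℚ))
  ζ-suc -[1+ suc n ] = ring₉ (ι n)

  ζ-pred : ∀ y → ζ (ℤ.pred y) ≡ ζ y - 1ℚ
  ζ-pred y = trans (sym (ring₁₀ (ζ (ℤ.pred y)))) (cong (_- 1ℚ) (trans (sym (ζ-suc (ℤ.pred y))) (cong ζ (ℤ.suc-pred y))))

  bridges : ℕ → ℤ → ℚ
  bridges n y = E n λ w → ⟦ bridge y w ⟧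

  bridges-step : ∀ n y → bridges (suc n) y ≡ ¼ * ((bridges n (ℤ.pred y) + bridges n y) + (bridges n y + bridges n (ℤ.suc y)))
  bridges-step n y = cong (¼ *_) (Σ₄-expand _)

  -- The ratio of neighbouring binomial coefficients: `bridges n y` is C(2n, n + y) / 4ⁿ. In this
  -- form it is proved by induction on n for all integers y, without factorials.
  bridges-ratio : ∀ n y → (1ℚ + ι n + ζ y) * bridges n (ℤ.suc y) ≡ (ι n - ζ y) * bridges n y
  bridges-ratio zero (+ zero) = at-zero _
  bridges-ratio zero (+ suc y) = zero-left _ _
  bridges-ratio zero -[1+ zero ] = minus-one
  bridges-ratio zero -[1+ suc y ] = zero-left _ _
  bridges-ratio (suc n) y = begin
    (1ℚ + ι (suc n) + ζ y) * bridges (suc n) (ℤ.suc y)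
      ≡⟨ cong₂ _*_ (ring₅ (ι n) (ζ y)) (trans (bridges-step n (ℤ.suc y))
           (cong (λ z → ¼ * ((bridges n z + c) + (c + d))) (ℤ.pred-suc y))) ⟩
    (2ℚ + ι n + ζ y) * (¼ * ((b + c) + (c + d)))
      ≡⟨ ring₁ (ι n) (ζ y) b c d ⟩
    ¼ * ((2ℚ + ι n + ζ y) * (b + c + c) + (1ℚ + ι n + (1ℚ + ζ y)) * d)
      ≡⟨ cong (λ z → ¼ * ((2ℚ + ι n + ζ y) * (b + c + c) + z))
           (subst (λ z → (1ℚ + ι n + z) * d ≡ (ι n - z) * c) (ζ-suc y) (bridges-ratio n (ℤ.suc y))) ⟩
    ¼ * ((2ℚ + ι n + ζ y) * (b + c + c) + (ι n - (1ℚ + ζ y)) * c)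
      ≡⟨ ring₂ (ι n) (ζ y) b c ⟩
    ¼ * ((2ℚ + ι n + ζ y) * b + (1ℚ + ι n - ζ y) * c + 2ℚ * ((1ℚ + ι n + ζ y) * c))
      ≡⟨ cong (λ z → ¼ * ((2ℚ + ι n + ζ y) * b + (1ℚ + ι n - ζ y) * c + 2ℚ * z)) (bridges-ratio n y) ⟩
    ¼ * ((2ℚ + ι n + ζ y) * b + (1ℚ + ι n - ζ y) * c + 2ℚ * ((ι n - ζ y) * b))
      ≡⟨ ring₃ (ι n) (ζ y) b c ⟩
    ¼ * ((1ℚ + ι n + (ζ y - 1ℚ)) * b + (1ℚ + ι n - ζ y) * (b + b + c))
      ≡⟨ cong (λ z → ¼ * (z + (1ℚ + ι n - ζ y) * (b + b + c)))
           (subst₂ (λ z u → (1ℚ + ι n + z) * bridges n u ≡ (ι n - z) * a) (ζ-pred y) (ℤ.suc-pred y) (bridges-ratio n (ℤ.pred y))) ⟩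
    ¼ * ((ι n - (ζ y - 1ℚ)) * a + (1ℚ + ι n - ζ y) * (b + b + c))
      ≡⟨ ring₄ (ι n) (ζ y) a b c ⟩
    (1ℚ + ι n - ζ y) * (¼ * ((a + b) + (b + c)))
      ≡⟨ cong ((ι (suc n) - ζ y) *_) (bridges-step n y) ⟨
    (ι (suc n) - ζ y) * bridges (suc n) y ∎
    where
    open ≡-Reasoning
    a b c d : ℚ
    a = bridges n (ℤ.pred y)
    b = bridges n y
    c = bridges n (ℤ.suc y)
    d = bridges n (ℤ.suc (ℤ.suc y))

  bridges-binomial : (λ n → bridges n (+ 0)) ≈ binomial ½
  bridges-binomial = binomial-unique ½ (λ n → bridges n (+ 0)) refl λ n → begin
    ι (suc n) * bridges (suc n) (+ 0)
      ≡⟨ trans (cong (ι (suc n) *_) (bridges-step n (+ 0))) (ring₆ (ι n) _ _ _) ⟩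
    ¼ * ((ι n - ζ -[1+ 0 ]) * bridges n -[1+ 0 ] + ι (suc n) * (bridges n (+ 0) + bridges n (+ 0)) + (1ℚ + ι n + 0ℚ) * bridges n (+ 1))
      ≡⟨ cong₂ (λ x z → ¼ * (x + ι (suc n) * (bridges n (+ 0) + bridges n (+ 0)) + z))
           (sym (bridges-ratio n -[1+ 0 ])) (bridges-ratio n (+ 0)) ⟩
    ¼ * ((1ℚ + ι n + ζ -[1+ 0 ]) * bridges n (+ 0) + ι (suc n) * (bridges n (+ 0) + bridges n (+ 0)) + (ι n - 0ℚ) * bridges n (+ 0))
      ≡⟨ ring₇ (ι n) (bridges n (+ 0)) ⟩
    ι n * bridges n (+ 0) + ½ * bridges n (+ 0) ∎
    where open ≡-Reasoning

  nonneg-true : ∀ y t w → nonneg y t true w ≡ bridge y w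
  nonneg-true (+ zero) -[1+ t ] [] = refl
  nonneg-true (+ zero) -[1+ t ] (l ∷ w) = nonneg-true (step l (+ 0)) (+ 0 ℤ.+ step l (+ 0)) w
  nonneg-true (+ zero) (+ t) [] = refl
  nonneg-true (+ zero) (+ t) (l ∷ w) = nonneg-true (step l (+ 0)) (+ t ℤ.+ step l (+ 0)) w
  nonneg-true (+ suc y) t [] = refl
  nonneg-true (+ suc y) t (l ∷ w) = nonneg-true (step l (+ suc y)) (t ℤ.+ step l (+ suc y)) w
  nonneg-true -[1+ y ] t [] = refl
  nonneg-true -[1+ y ] t (l ∷ w) = nonneg-true (step l -[1+ y ]) (t ℤ.+ step l -[1+ y ]) w

  H-true-binomial : means (H true) ≈ binomial ½
  H-true-binomial n = trans (E-cong n λ w → cong ⟦_⟧ (nonneg-true (+ 0) (+ 0) w)) (bridges-binomial n)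

  endsDescending : Bool → Word → Bool
  endsDescending f [] = f
  endsDescending f (l ∷ w) = endsDescending (descends l) w

  nonnegDesc-∧ : ∀ y t c f w → nonnegDesc y t c f w ≡ nonneg y t c w ∧ endsDescending f w
  nonnegDesc-∧ (+ zero) -[1+ t ] true f [] = refl
  nonnegDesc-∧ (+ zero) -[1+ t ] true f (l ∷ w) = nonnegDesc-∧ (step l (+ 0)) (+ 0 ℤ.+ step l (+ 0)) true (descends l) w
  nonnegDesc-∧ (+ zero) -[1+ t ] false f w = refl
  nonnegDesc-∧ (+ zero) (+ t) c f [] = refl
  nonnegDesc-∧ (+ zero) (+ t) c f (l ∷ w) = nonnegDesc-∧ (step l (+ 0)) (+ t ℤ.+ step l (+ 0)) c (descends l) w
  nonnegDesc-∧ (+ suc y) t c f [] = refl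
  nonnegDesc-∧ (+ suc y) t c f (l ∷ w) = nonnegDesc-∧ (step l (+ suc y)) (t ℤ.+ step l (+ suc y)) c (descends l) w
  nonnegDesc-∧ -[1+ y ] t c f [] = refl
  nonnegDesc-∧ -[1+ y ] t c f (l ∷ w) = nonnegDesc-∧ (step l -[1+ y ]) (t ℤ.+ step l -[1+ y ]) c (descends l) w

  desc asc : ℤ → Bool → Word → ℚ
  desc y f w = ⟦ bridge y w ∧ endsDescending f w ⟧
  asc y f w = ⟦ bridge y w ∧ not (endsDescending f w) ⟧

  opaque
    unfolding Σ₄ _+_

    Σ₄-flip : ∀ f g → f dn ≡ g up → f z₀ ≡ g z₁ → f z₁ ≡ g z₀ → f up ≡ g dn → Σ₄ f ≡ Σ₄ g
    Σ₄-flip f g p q r s = trans (cong₂ _+_ (cong₂ _+_ p q) (cong₂ _+_ r s)) (turn (g up) (g z₁) (g z₀) (g dn))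
      where
      turn : ∀ a b c d → (a + b) + (c + d) ≡ (d + c) + (b + a)
      turn = solve-∀ ℚ-ring

  neg-pred : ∀ y → ℤ.- ℤ.pred y ≡ ℤ.suc (ℤ.- y)
  neg-pred = ℤ.neg-distrib-+ -[1+ 0 ]

  neg-suc : ∀ y → ℤ.- ℤ.suc y ≡ ℤ.pred (ℤ.- y)
  neg-suc = ℤ.neg-distrib-+ (+ 1)

  isZero-neg : ∀ y → isZero (ℤ.- y) ≡ isZero y
  isZero-neg (+ zero) = refl
  isZero-neg (+ suc y) = refl
  isZero-neg -[1+ y ] = refl

  -- Turn every walk upside down.
  desc-flip : ∀ n y f → E n (desc y f) ≡ E n (asc (ℤ.- y) (not f))
  desc-flip zero y f rewrite isZero-neg y with f
  ... | true = refl
  ... | false = refl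
  desc-flip (suc n) y f = cong (¼ *_) (Σ₄-flip _ _
    (trans (desc-flip n (ℤ.pred y) true) (cong (λ z → E n (asc z false)) (neg-pred y)))
    (desc-flip n y false) (desc-flip n y true)
    (trans (desc-flip n (ℤ.suc y) false) (cong (λ z → E n (asc z true)) (neg-suc y))))

  desc+asc : ∀ y f w → desc y f w + asc y f w ≡ ⟦ bridge y w ⟧
  desc+asc y f w with bridge y w | endsDescending f w
  ... | true | true = +-identityʳ 1ℚ
  ... | true | false = +-identityˡ 1ℚ
  ... | false | _ = +-identityʳ 0ℚ

  -- Turning a bridge upside down exchanges `dn` with `up` and `z₀` with `z₁`, hence descending and
  -- other last letters. The empty bridge has no last letter and is excluded.
  HD-half : ∀ n → means (HD true) (suc n) + means (HD true) (suc n) ≡ means (H true) (suc n)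
  HD-half n = trans (cong₂ _+_ descends-half (trans descends-half (desc-flip (suc n) (+ 0) false)))
    (trans (sym (E-+ (suc n) (desc (+ 0) false) (asc (+ 0) false)))
      (E-cong (suc n) λ w → trans (desc+asc (+ 0) false w) (cong ⟦_⟧ (sym (nonneg-true (+ 0) (+ 0) w)))))
    where
    descends-half : means (HD true) (suc n) ≡ E (suc n) (desc (+ 0) false)
    descends-half = E-cong (suc n) λ w → cong ⟦_⟧ (trans (nonnegDesc-∧ (+ 0) (+ 0) true false w)
      (cong (_∧ endsDescending false w) (nonneg-true (+ 0) (+ 0) w)))

-- Bridges counted with the sign of their area

module Signed where

  open Rationals
  open Sequences
  open Words
  open Walks
  open Reversal
  open Weighted
  open Bridges
  open import Data.Nat.Base as ℕ using (ℕ; zero; suc)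
  open import Data.Integer.Base as ℤ using (ℤ; +_; -[1+_])
  import Data.Integer.Properties as ℤ
  import Data.Integer.Tactic.RingSolver as ℤ
  open import Data.Sum using (_⊎_; inj₁; inj₂)
  open import Relation.Binary.PropositionalEquality
  open import Tactic.RingSolver using (solve-∀)

  private
    opaque
      unfolding _+_

      ring₁ : ∀ x y → - (x * y) ≡ (- x) * y
      ring₁ = solve-∀ ℚ-ring

      ring₂ : ∀ a s x → a * (s * x) ≡ s * (a * x)
      ring₂ = solve-∀ ℚ-ring

      ring₃ : ∀ s a b c d e → s * s ≡ 1ℚ →
        ¼ * (((- s) * (¼ * (((- (- s)) * a + (- s) * b) + ((- s) * b + (- (- s)) * c)))
            + s * (¼ * (((- s) * b + s * c) + (s * c + (- s) * d))))
           + (s * (¼ * (((- s) * b + s * c) + (s * c + (- s) * d)))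
            + (- s) * (¼ * (((- (- s)) * c + (- s) * d) + ((- s) * d + (- (- s)) * e)))))
        ≡ ¼ * (¼ * ((- a + c) + (c + - e)))
      ring₃ s a b c d e s² = trans (gather s a b c d e) (trans (cong (λ z → ¼ * (¼ * (z * ((- a + c) + (c + - e))))) s²)
        (cong (λ z → ¼ * (¼ * z)) (*-identityˡ ((- a + c) + (c + - e)))))
        where
        gather : ∀ s a b c d e →
          ¼ * (((- s) * (¼ * (((- (- s)) * a + (- s) * b) + ((- s) * b + (- (- s)) * c)))
              + s * (¼ * (((- s) * b + s * c) + (s * c + (- s) * d))))
             + (s * (¼ * (((- s) * b + s * c) + (s * c + (- s) * d)))
              + (- s) * (¼ * (((- (- s)) * c + (- s) * d) + ((- s) * d + (- (- s)) * e)))))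
          ≡ ¼ * (¼ * ((s * s) * ((- a + c) + (c + - e))))
        gather = solve-∀ ℚ-ring

      ring₄ : ∀ q s a b c → ¼ * (¼ * ((- (q * ((- s) * a)) + q * (s * b)) + (q * (s * b) + - (q * ((- s) * c)))))
                ≡ (¼ * q) * (s * (¼ * ((a + b) + (b + c))))
      ring₄ = solve-∀ ℚ-ring

      ring₅ : ¼ * (¼ * ((- 0ℚ + 0ℚ) + (0ℚ + - 0ℚ))) ≡ 0ℚ
      ring₅ = refl

      ring₆ : ∀ x → ¼ * (((- 1ℚ) * 0ℚ + 1ℚ * x) + (1ℚ * x + (- 1ℚ) * 0ℚ)) ≡ ½ * x
      ring₆ = solve-∀ ℚ-ring

      ring₇ : ∀ q x → q * (1ℚ * x) ≡ q * x
      ring₇ = solve-∀ ℚ-ring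

      ring₈ : ∀ s → (- s) * (- s) ≡ s * s
      ring₈ = solve-∀ ℚ-ring

      sign-0 : 1ℚ * 1ℚ ≡ 1ℚ * (1ℚ * 1ℚ)
      sign-0 = refl

      times-0 : ∀ x y → 0ℚ * x ≡ 1ℚ * (y * 0ℚ)
      times-0 = solve-∀ ℚ-ring

  signℕ : ℕ → ℚ
  signℕ zero = 1ℚ
  signℕ (suc n) = - signℕ n

  sign : ℤ → ℚ
  sign y = signℕ ℤ.∣ y ∣

  sign-suc : ∀ y → sign (ℤ.suc y) ≡ - sign y
  sign-suc (+ n) = refl
  sign-suc -[1+ zero ] = sym (neg-neg 1ℚ)
  sign-suc -[1+ suc n ] = sym (neg-neg _)

  sign-pred : ∀ y → sign (ℤ.pred y) ≡ - sign y
  sign-pred y = trans (sym (neg-neg _)) (cong -_ (trans (sym (sign-suc (ℤ.pred y))) (cong sign (ℤ.suc-pred y))))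

  sign-neg : ∀ y → sign (ℤ.- y) ≡ sign y
  sign-neg y = cong signℕ (ℤ.∣-i∣≡∣i∣ y)

  sign-+ : ∀ x y → sign (x ℤ.+ y) ≡ sign x * sign y
  sign-+ (+ zero) y = trans (cong sign (ℤ.+-identityˡ y)) (sym (*-identityˡ _))
  sign-+ (+ suc n) y = begin
    sign (+ suc n ℤ.+ y)        ≡⟨ cong sign (ℤ.+-assoc (+ 1) (+ n) y) ⟩
    sign (ℤ.suc (+ n ℤ.+ y))    ≡⟨ sign-suc (+ n ℤ.+ y) ⟩
    - sign (+ n ℤ.+ y)          ≡⟨ cong -_ (sign-+ (+ n) y) ⟩
    - (sign (+ n) * sign y)     ≡⟨ ring₁ _ _ ⟩
    sign (+ suc n) * sign y     ∎
    where open ≡-Reasoning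
  sign-+ -[1+ zero ] y = trans (sign-pred y) (trans (cong -_ (sym (*-identityˡ _))) (ring₁ _ _))
  sign-+ -[1+ suc n ] y = begin
    sign (-[1+ suc n ] ℤ.+ y)     ≡⟨ cong sign (ℤ.+-assoc -[1+ 0 ] -[1+ n ] y) ⟩
    sign (ℤ.pred (-[1+ n ] ℤ.+ y)) ≡⟨ sign-pred (-[1+ n ] ℤ.+ y) ⟩
    - sign (-[1+ n ] ℤ.+ y)       ≡⟨ cong -_ (sign-+ -[1+ n ] y) ⟩
    - (sign -[1+ n ] * sign y)    ≡⟨ ring₁ _ _ ⟩
    sign -[1+ suc n ] * sign y    ∎
    where open ≡-Reasoning

  sign-squared : ∀ y → sign y * sign y ≡ 1ℚ
  sign-squared y = go ℤ.∣ y ∣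
    where
    go : ∀ n → signℕ n * signℕ n ≡ 1ℚ
    go zero = *-identityˡ 1ℚ
    go (suc n) = trans (ring₈ _) (go n)

  sign-cases : ∀ y → sign y ≡ 1ℚ ⊎ sign y ≡ - 1ℚ
  sign-cases y = go ℤ.∣ y ∣
    where
    go : ∀ n → signℕ n ≡ 1ℚ ⊎ signℕ n ≡ - 1ℚ
    go zero = inj₁ refl
    go (suc n) with go n
    ... | inj₁ e = inj₂ (cong -_ e)
    ... | inj₂ e = inj₁ (trans (cong -_ e) (neg-neg 1ℚ))

  sign-abs : ∀ y → ∣ sign y ∣ ≤ 1ℚ
  sign-abs y with sign-cases y
  ... | inj₁ e = ≤-reflexive (trans (cong ∣_∣ e) (0≤p⇒∣p∣≡p 0≤1))
  ... | inj₂ e = ≤-reflexive (trans (cong ∣_∣ e) (trans (∣-p∣≡∣p∣ 1ℚ) (0≤p⇒∣p∣≡p 0≤1)))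

  signedBridges : ℕ → ℤ → ℚ
  signedBridges n y = E n λ w → ⟦ bridge y w ⟧ * sign (area y w)

  signedBridges-step : ∀ n y → signedBridges (suc n) y ≡
    ¼ * (((- sign y) * signedBridges n (ℤ.pred y) + sign y * signedBridges n y)
       + (sign y * signedBridges n y + (- sign y) * signedBridges n (ℤ.suc y)))
  signedBridges-step n y = cong (¼ *_) (trans (Σ₄-cong λ l → trans
      (E-cong n λ w → trans (cong (⟦ bridge (step l y) w ⟧ *_) (sign-+ (step l y) _)) (ring₂ _ _ _)) (E-* n (sign (step l y)) _))
    (trans (Σ₄-expand _) (cong₂ (λ p q → (p * signedBridges n (ℤ.pred y) + sign y * signedBridges n y)
       + (sign y * signedBridges n y + q * signedBridges n (ℤ.suc y))) (sign-pred y) (sign-suc y))))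

  -- The terms at odd distance from y cancel. What remains looks like a single letter of a walk with
  -- steps of size 2, an extra factor 1/4, and a minus sign on the steps up and down.
  signedBridges-step² : ∀ n y → signedBridges (suc (suc n)) y ≡
    ¼ * (¼ * ((- signedBridges n (ℤ.pred (ℤ.pred y)) + signedBridges n y)
            + (signedBridges n y + - signedBridges n (ℤ.suc (ℤ.suc y)))))
  signedBridges-step² n y = trans (signedBridges-step (suc n) y) (trans
    (cong₂ (λ u v → ¼ * (((- s) * u + s * signedBridges (suc n) y) + (s * signedBridges (suc n) y + (- s) * v)))
      (trans (signedBridges-step n (ℤ.pred y)) (cong₂ (λ σ z → ¼ * (((- σ) * S (ℤ.pred (ℤ.pred y)) + σ * S (ℤ.pred y)) + (σ * S (ℤ.pred y) + (- σ) * S z)))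
        (sign-pred y) (ℤ.suc-pred y)))
      (trans (signedBridges-step n (ℤ.suc y)) (cong₂ (λ σ z → ¼ * (((- σ) * S z + σ * S (ℤ.suc y)) + (σ * S (ℤ.suc y) + (- σ) * S (ℤ.suc (ℤ.suc y)))))
        (sign-suc y) (ℤ.pred-suc y))))
    (trans (cong (λ m → ¼ * (((- s) * (¼ * (((- (- s)) * S (ℤ.pred (ℤ.pred y)) + (- s) * S (ℤ.pred y)) + ((- s) * S (ℤ.pred y) + (- (- s)) * S y)))
            + s * m) + (s * m + (- s) * (¼ * (((- (- s)) * S y + (- s) * S (ℤ.suc y)) + ((- s) * S (ℤ.suc y) + (- (- s)) * S (ℤ.suc (ℤ.suc y))))))))
        (signedBridges-step n y))
      (ring₃ s _ _ _ _ _ (sign-squared y))))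
    where
    s : ℚ
    s = sign y
    S : ℤ → ℚ
    S = signedBridges n

  double : ℕ → ℕ
  double zero = zero
  double (suc n) = suc (suc (double n))

  ¼^ : ℕ → ℚ
  ¼^ zero = 1ℚ
  ¼^ (suc n) = ¼ * ¼^ n

  pred-double : ∀ y → ℤ.pred (ℤ.pred (y ℤ.+ y)) ≡ ℤ.pred y ℤ.+ ℤ.pred y
  pred-double y = lemma -[1+ 0 ] y
    where
    lemma : ∀ c y → c ℤ.+ (c ℤ.+ (y ℤ.+ y)) ≡ (c ℤ.+ y) ℤ.+ (c ℤ.+ y)
    lemma = ℤ.solve-∀

  suc-double : ∀ y → ℤ.suc (ℤ.suc (y ℤ.+ y)) ≡ ℤ.suc y ℤ.+ ℤ.suc y
  suc-double y = lemma (+ 1) y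
    where
    lemma : ∀ c y → c ℤ.+ (c ℤ.+ (y ℤ.+ y)) ≡ (c ℤ.+ y) ℤ.+ (c ℤ.+ y)
    lemma = ℤ.solve-∀

  -- The factor `sign y` absorbs the minus signs of `signedBridges-step²`, leaving exactly the
  -- recursion of unsigned bridges at half the height.
  signedBridges-even : ∀ m y → signedBridges (double m) (y ℤ.+ y) ≡ ¼^ m * (sign y * bridges m y)
  signedBridges-even zero (+ zero) = sign-0
  signedBridges-even zero (+ suc n) = times-0 1ℚ (sign (+ suc n))
  signedBridges-even zero -[1+ n ] = times-0 1ℚ (sign -[1+ n ])
  signedBridges-even (suc m) y = begin
    signedBridges (double (suc m)) (y ℤ.+ y)
      ≡⟨ signedBridges-step² (double m) (y ℤ.+ y) ⟩
    ¼ * (¼ * ((- S (ℤ.pred (ℤ.pred (y ℤ.+ y))) + S (y ℤ.+ y)) + (S (y ℤ.+ y) + - S (ℤ.suc (ℤ.suc (y ℤ.+ y))))))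
      ≡⟨ cong₂ (λ u v → ¼ * (¼ * ((- u + S (y ℤ.+ y)) + (S (y ℤ.+ y) + - v))))
           (trans (cong S (pred-double y)) (trans (signedBridges-even m (ℤ.pred y)) (cong (λ z → ¼^ m * (z * bridges m (ℤ.pred y))) (sign-pred y))))
           (trans (cong S (suc-double y)) (trans (signedBridges-even m (ℤ.suc y)) (cong (λ z → ¼^ m * (z * bridges m (ℤ.suc y))) (sign-suc y)))) ⟩
    ¼ * (¼ * ((- (¼^ m * ((- s) * bridges m (ℤ.pred y))) + S (y ℤ.+ y)) + (S (y ℤ.+ y) + - (¼^ m * ((- s) * bridges m (ℤ.suc y))))))
      ≡⟨ cong (λ z → ¼ * (¼ * ((- (¼^ m * ((- s) * bridges m (ℤ.pred y))) + z) + (z + - (¼^ m * ((- s) * bridges m (ℤ.suc y))))))) (signedBridges-even m y) ⟩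
    ¼ * (¼ * ((- (¼^ m * ((- s) * bridges m (ℤ.pred y))) + ¼^ m * (s * bridges m y)) + (¼^ m * (s * bridges m y) + - (¼^ m * ((- s) * bridges m (ℤ.suc y))))))
      ≡⟨ ring₄ (¼^ m) s _ _ _ ⟩
    (¼ * ¼^ m) * (s * (¼ * ((bridges m (ℤ.pred y) + bridges m y) + (bridges m y + bridges m (ℤ.suc y)))))
      ≡⟨ cong (λ z → (¼ * ¼^ m) * (s * z)) (bridges-step m y) ⟨
    ¼^ (suc m) * (s * bridges (suc m) y) ∎
    where
    open ≡-Reasoning
    s : ℚ
    s = sign y
    S : ℤ → ℚ
    S = signedBridges (double m)

  signedBridges-odd : ∀ m y → signedBridges (double m) (ℤ.suc (y ℤ.+ y)) ≡ 0ℚ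
  signedBridges-odd zero (+ n) = *-zeroˡ _
  signedBridges-odd zero -[1+ n ] = *-zeroˡ _
  signedBridges-odd (suc m) y = begin
    signedBridges (double (suc m)) (ℤ.suc (y ℤ.+ y)) ≡⟨ signedBridges-step² (double m) (ℤ.suc (y ℤ.+ y)) ⟩
    ¼ * (¼ * ((- S (ℤ.pred (ℤ.pred (ℤ.suc (y ℤ.+ y)))) + S (ℤ.suc (y ℤ.+ y))) + (S (ℤ.suc (y ℤ.+ y)) + - S (ℤ.suc (ℤ.suc (ℤ.suc (y ℤ.+ y)))))))
      ≡⟨ cong₂ (λ u v → ¼ * (¼ * ((- u + S (ℤ.suc (y ℤ.+ y))) + (S (ℤ.suc (y ℤ.+ y)) + - v))))
           (trans (cong S down) (signedBridges-odd m (ℤ.pred y)))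
           (trans (cong S (cong ℤ.suc (suc-double y))) (signedBridges-odd m (ℤ.suc y))) ⟩
    ¼ * (¼ * ((- 0ℚ + S (ℤ.suc (y ℤ.+ y))) + (S (ℤ.suc (y ℤ.+ y)) + - 0ℚ)))
      ≡⟨ cong (λ z → ¼ * (¼ * ((- 0ℚ + z) + (z + - 0ℚ)))) (signedBridges-odd m y) ⟩
    ¼ * (¼ * ((- 0ℚ + 0ℚ) + (0ℚ + - 0ℚ))) ≡⟨ ring₅ ⟩
    0ℚ ∎
    where
    open ≡-Reasoning
    S : ℤ → ℚ
    S = signedBridges (double m)
    down : ℤ.pred (ℤ.pred (ℤ.suc (y ℤ.+ y))) ≡ ℤ.suc (ℤ.pred y ℤ.+ ℤ.pred y)
    down = trans (cong ℤ.pred (trans (ℤ.pred-suc x) (sym (ℤ.suc-pred x)))) (trans (ℤ.pred-suc (ℤ.pred x))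
      (trans (sym (ℤ.suc-pred (ℤ.pred x))) (cong ℤ.suc (pred-double y))))
      where
      x : ℤ
      x = y ℤ.+ y

  signedBridges-double : ∀ m → signedBridges (double m) (+ 0) ≡ ¼^ m * binomial ½ m
  signedBridges-double m = trans (signedBridges-even m (+ 0)) (trans (ring₇ _ _) (cong (¼^ m *_) (bridges-binomial m)))

  -- With `signedBridges-double` this gives the generating function (1 + x/2) (1 - x²/4)^(-1/2),
  -- which is ((1 + x/2) / (1 - x/2))^(1/2).
  signedBridges-suc-double : ∀ m → signedBridges (suc (double m)) (+ 0) ≡ ½ * signedBridges (double m) (+ 0)
  signedBridges-suc-double m = trans (signedBridges-step (double m) (+ 0)) (trans
    (cong₂ (λ u v → ¼ * (((- 1ℚ) * u + 1ℚ * S) + (1ℚ * S + (- 1ℚ) * v)))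
      (signedBridges-odd m -[1+ 0 ]) (signedBridges-odd m (+ 0)))
    (ring₆ S))
    where
    S : ℚ
    S = signedBridges (double m) (+ 0)

-- Few walks return to area 0

module Excursions where

  open Rationals
  open Sequences
  open Words
  open Walks
  open Reversal
  open Weighted
  open Bridges
  open import Data.Nat.Base as ℕ using (ℕ; zero; suc)
  import Data.Nat.Properties as ℕ
  open import Data.Integer.Base as ℤ using (ℤ; +_; -[1+_]; +≤+)
  import Data.Integer.Properties as ℤ
  import Data.Integer.Tactic.RingSolver as ℤ
  open import Data.Bool.Base using (true; false; _∧_)
  open import Data.List.Base using ([]; _∷_; length)
  open import Data.Product using (_×_; _,_)
  open import Data.Sum using (_⊎_; inj₁; inj₂)
  open import Data.Empty using (⊥-elim)
  open import Relation.Binary.PropositionalEquality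
  open import Tactic.RingSolver using (solve-∀)

  -- All ways of lowering one letter by 1. In a word, this changes the area by the number of letters from
  -- that position on, so the area of the result determines the position.
  lower : Letter → (Letter → ℚ) → ℚ
  lower dn g = 0ℚ
  lower z₀ g = g dn
  lower z₁ g = g dn
  lower up g = g z₀ + g z₁

  lowerings : (Word → ℚ) → Word → ℚ
  lowerings f [] = 0ℚ
  lowerings f (l ∷ w) = lower l (λ l′ → f (l′ ∷ w)) + lowerings (λ u → f (l ∷ u)) w

  raisings : Letter → ℚ
  raisings dn = 2ℚ
  raisings z₀ = 1ℚ
  raisings z₁ = 1ℚ
  raisings up = 0ℚ

  raisingCount : Word → ℚ
  raisingCount [] = 0ℚ
  raisingCount (l ∷ w) = raisings l + raisingCount w

  E-lower : ∀ n (f : Word → ℚ) l → E n (λ w → lower l (λ l′ → f (l′ ∷ w))) ≡ lower l (λ l′ → E n λ w → f (l′ ∷ w))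
  E-lower n f dn = E-const n 0ℚ
  E-lower n f z₀ = refl
  E-lower n f z₁ = refl
  E-lower n f up = E-+ n _ _

  opaque
    unfolding Σ₄ _+_

    Σ₄-lower : ∀ g → Σ₄ (λ l → lower l g) ≡ Σ₄ (λ l → raisings l * g l)
    Σ₄-lower g = lemma (g dn) (g z₀) (g z₁) (g up)
      where
      lemma : ∀ a b c d → (0ℚ + a) + (a + (b + c)) ≡ (2ℚ * a + 1ℚ * b) + (1ℚ * c + 0ℚ * d)
      lemma = solve-∀ ℚ-ring

  -- Pairs of a word and one of its lowerings are counted from either side; `raisings l` is the
  -- number of letters that can be lowered to l.
  E-lowerings : ∀ n f → E n (lowerings f) ≡ E n (λ w → raisingCount w * f w)
  E-lowerings zero f = sym (*-zeroˡ _)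
  E-lowerings (suc n) f = cong (¼ *_) (begin
    Σ₄ (λ l → E n λ w → lower l (λ l′ → f (l′ ∷ w)) + lowerings (λ u → f (l ∷ u)) w)
      ≡⟨ Σ₄-cong (λ l → trans (E-+ n _ _) (cong₂ _+_ (E-lower n f l) (E-lowerings n (λ u → f (l ∷ u))))) ⟩
    Σ₄ (λ l → lower l g + E n (λ w → raisingCount w * f (l ∷ w)))
      ≡⟨ trans (Σ₄-+ _ _) (cong (_+ Σ₄ λ l → E n (λ w → raisingCount w * f (l ∷ w))) (Σ₄-lower g)) ⟩
    Σ₄ (λ l → raisings l * g l) + Σ₄ (λ l → E n (λ w → raisingCount w * f (l ∷ w)))
      ≡⟨ Σ₄-+ _ _ ⟨
    Σ₄ (λ l → raisings l * g l + E n (λ w → raisingCount w * f (l ∷ w)))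
      ≡⟨ Σ₄-cong (λ l → trans (cong (_+ E n (λ w → raisingCount w * f (l ∷ w))) (sym (E-* n (raisings l) _)))
           (trans (sym (E-+ n _ _)) (E-cong n λ w → sym (distribʳ (f (l ∷ w)) (raisings l) (raisingCount w))))) ⟩
    Σ₄ (λ l → E n λ w → (raisings l + raisingCount w) * f (l ∷ w)) ∎)
    where
    open ≡-Reasoning
    g : Letter → ℚ
    g l = E n λ w → f (l ∷ w)

  E-congₗ : ∀ n {f g} → (∀ w → length w ≡ n → f w ≡ g w) → E n f ≡ E n g
  E-congₗ zero p = p [] refl
  E-congₗ (suc n) p = cong (¼ *_) (Σ₄-cong λ l → E-congₗ n λ w e → p (l ∷ w) (cong suc e))

  -- A letter with step v can be raised in 1 - v ways. So a bridge of length n has exactly n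
  -- raisings, whatever its shape.
  raisingCount-end : ∀ y w → raisingCount w + ζ (end y w) ≡ ι (length w) + ζ y
  raisingCount-end y [] = refl
  raisingCount-end y (l ∷ w) = trans (+-assoc (raisings l) _ _) (trans (cong (λ z → raisings l + z) (raisingCount-end (step l y) w)) (one l))
    where
    opaque
      unfolding _+_
      shift₀ : ∀ n y → 2ℚ + (n + (y - 1ℚ)) ≡ (1ℚ + n) + y
      shift₀ = solve-∀ ℚ-ring
      shift₁ : ∀ n y → 1ℚ + (n + y) ≡ (1ℚ + n) + y
      shift₁ = solve-∀ ℚ-ring
      shift₂ : ∀ n y → 0ℚ + (n + (1ℚ + y)) ≡ (1ℚ + n) + y
      shift₂ = solve-∀ ℚ-ring
    one : ∀ l → raisings l + (ι (length w) + ζ (step l y)) ≡ (1ℚ + ι (length w)) + ζ y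
    one dn = trans (cong (λ z → 2ℚ + (ι (length w) + z)) (ζ-pred y)) (shift₀ _ _)
    one z₀ = shift₁ _ _
    one z₁ = shift₁ _ _
    one up = trans (cong (λ z → 0ℚ + (ι (length w) + z)) (ζ-suc y)) (shift₂ _ _)

  -- Only the end is tested: height 0 and area 0. Dropping the conditions at intermediate zeros
  -- keeps the following bound a matter of total area alone.
  balanced : ℤ → ℤ → Word → ℚ
  balanced y t [] = ⟦ isZero y ∧ isZero t ⟧
  balanced y t (l ∷ w) = balanced (step l y) (t ℤ.+ step l y) w

  balanced-sound : ∀ y t w → balanced y t w ≡ 0ℚ ⊎ (balanced y t w ≡ 1ℚ × end y w ≡ + 0 × t ℤ.+ area y w ≡ + 0)
  balanced-sound y t [] with isZero y in p | isZero t in q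
  ... | true | true = inj₂ (refl , isZero-sound p , trans (ℤ.+-identityʳ t) (isZero-sound q))
  ... | true | false = inj₁ refl
  ... | false | _ = inj₁ refl
  balanced-sound y t (l ∷ w) with balanced-sound (step l y) (t ℤ.+ step l y) w
  ... | inj₁ z = inj₁ z
  ... | inj₂ (one , e , a) = inj₂ (one , e , trans (sym (ℤ.+-assoc t (step l y) _)) a)

  tied≤balanced : ∀ y t w → ⟦ tied y t false w ⟧ ≤ balanced y t w
  tied≤balanced (+ zero) -[1+ t ] [] = ≤-refl
  tied≤balanced (+ zero) -[1+ t ] (l ∷ w) with balanced-sound (step l (+ 0)) (-[1+ t ] ℤ.+ step l (+ 0)) w
  ... | inj₁ z = ≤-reflexive (sym z)
  ... | inj₂ (one , _) = subst (0ℚ ≤_) (sym one) 0≤1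
  tied≤balanced (+ zero) (+ t) [] = ≤-refl
  tied≤balanced (+ zero) (+ t) (l ∷ w) = tied≤balanced (step l (+ 0)) (+ t ℤ.+ step l (+ 0)) w
  tied≤balanced (+ suc y) t [] = ≤-refl
  tied≤balanced (+ suc y) t (l ∷ w) = tied≤balanced (step l (+ suc y)) (t ℤ.+ step l (+ suc y)) w
  tied≤balanced -[1+ y ] t [] = ≤-refl
  tied≤balanced -[1+ y ] t (l ∷ w) = tied≤balanced (step l -[1+ y ]) (t ℤ.+ step l -[1+ y ]) w

  Raised : ℚ → ℤ → ℤ → Word → ℤ → Set
  Raised x y t w bound = x ≡ 0ℚ ⊎ (x ≤ 2ℚ × end y w ≡ + 1 × t ℤ.+ area y w ℤ.≤ bound)

  -- Raising the letter that leads to height y lifts that height and all later ones,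
  -- `suc (length w)` of them, by one.
  raise-balanced : ∀ y t w → balanced y (t ℤ.+ y) w ≡ 0ℚ ⊎
    (balanced y (t ℤ.+ y) w ≡ 1ℚ × end (ℤ.suc y) w ≡ + 1 × t ℤ.+ (ℤ.suc y ℤ.+ area (ℤ.suc y) w) ≡ + suc (length w))
  raise-balanced y t w with balanced-sound y (t ℤ.+ y) w
  ... | inj₁ z = inj₁ z
  ... | inj₂ (one , e , a) = inj₂ (one , end′ , (begin
      t ℤ.+ (ℤ.suc y ℤ.+ area (ℤ.suc y) w)
        ≡⟨ cong (λ z → t ℤ.+ (ℤ.suc y ℤ.+ z)) (area-shift (ℤ.suc y) w) ⟩
      t ℤ.+ (ℤ.suc y ℤ.+ (area (+ 0) w ℤ.+ + length w ℤ.* ℤ.suc y))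
        ≡⟨ regroup (+ 1) t y (area (+ 0) w) (+ length w) ⟩
      ((t ℤ.+ y) ℤ.+ (area (+ 0) w ℤ.+ + length w ℤ.* y)) ℤ.+ (+ 1 ℤ.+ + length w ℤ.* + 1)
        ≡⟨ cong₂ (λ x z → x ℤ.+ (+ 1 ℤ.+ z)) (trans (cong (λ z → (t ℤ.+ y) ℤ.+ z) (sym (area-shift y w))) a) (ℤ.*-identityʳ (+ length w)) ⟩
      + suc (length w) ∎))
    where
    open ≡-Reasoning
    regroup : ∀ c t y a n → t ℤ.+ ((c ℤ.+ y) ℤ.+ (a ℤ.+ n ℤ.* (c ℤ.+ y))) ≡ ((t ℤ.+ y) ℤ.+ (a ℤ.+ n ℤ.* y)) ℤ.+ (c ℤ.+ n ℤ.* c)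
    regroup = ℤ.solve-∀
    end′ : end (ℤ.suc y) w ≡ + 1
    end′ = trans (end-shift (ℤ.suc y) w) (trans (assoc′ (+ 1) (end (+ 0) w) y) (cong (λ z → + 1 ℤ.+ z) (trans (sym (end-shift y w)) e)))
      where
      assoc′ : ∀ c e y → e ℤ.+ (c ℤ.+ y) ≡ c ℤ.+ (e ℤ.+ y)
      assoc′ = ℤ.solve-∀

  LowerBound : Letter → ℤ → ℤ → Word → Set
  LowerBound l y t w = lower l (λ l′ → balanced y t (l′ ∷ w)) ≡ 0ℚ ⊎
    (lower l (λ l′ → balanced y t (l′ ∷ w)) ≤ 2ℚ × end y (l ∷ w) ≡ + 1 × t ℤ.+ area y (l ∷ w) ≡ + suc (length w))

  1≤2 : 1ℚ ≤ 2ℚ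
  1≤2 = ≤-by 0≤1 refl

  lower-bound : ∀ l y t w → LowerBound l y t w
  lower-bound dn y t w = inj₁ refl
  lower-bound z₀ y t w with raise-balanced (ℤ.pred y) t w
  ... | inj₁ z = inj₁ z
  ... | inj₂ (one , e , a) rewrite ℤ.suc-pred y = inj₂ (subst (_≤ 2ℚ) (sym one) 1≤2 , e , a)
  lower-bound z₁ y t w with raise-balanced (ℤ.pred y) t w
  ... | inj₁ z = inj₁ z
  ... | inj₂ (one , e , a) rewrite ℤ.suc-pred y = inj₂ (subst (_≤ 2ℚ) (sym one) 1≤2 , e , a)
  lower-bound up y t w with raise-balanced y t w
  ... | inj₁ z = inj₁ (trans (cong₂ _+_ z z) (+-identityʳ 0ℚ))
  ... | inj₂ (one , e , a) = inj₂ (≤-reflexive (cong₂ _+_ one one) , e , a)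

  lowerings-bound : ∀ y t w → Raised (lowerings (balanced y t) w) y t w (+ length w)
  lowerings-bound y t [] = inj₁ refl
  lowerings-bound y t (l ∷ w) with lowerings-bound (step l y) (t ℤ.+ step l y) w | lower-bound l y t w
  ... | inj₁ z | inj₁ z′ = inj₁ (trans (cong₂ _+_ z′ z) (+-identityʳ 0ℚ))
  ... | inj₁ z | inj₂ (b , e , a) = inj₂ (subst (_≤ 2ℚ) (sym (trans (cong (λ x → lower l _ + x) z) (+-identityʳ _))) b , e , ℤ.≤-reflexive a)
  ... | inj₂ (b , e , a) | inj₁ z′ = inj₂ (subst (_≤ 2ℚ) (sym (trans (cong (_+ lowerings _ w) z′) (+-identityˡ _))) b , e ,
          ℤ.≤-trans (subst (ℤ._≤ + length w) (ℤ.+-assoc t (step l y) _) a) (+≤+ (ℕ.n≤1+n _)))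
  -- Lowering here requires area `suc (length w)`, lowering further on requires at most `length w`;
  -- one word cannot have both.
  ... | inj₂ (_ , _ , a) | inj₂ (_ , _ , a′) = ⊥-elim (ℕ.1+n≰n (ℤ.drop‿+≤+
          (subst (ℤ._≤ + length w) (trans (ℤ.+-assoc t (step l y) _) a′) a)))

  bridge-isZero : ∀ y w → bridge y w ≡ isZero (end y w)
  bridge-isZero y [] = refl
  bridge-isZero y (l ∷ w) = bridge-isZero (step l y) w

  ⟦⟧-nonneg : ∀ b → 0ℚ ≤ ⟦ b ⟧
  ⟦⟧-nonneg true = 0≤1
  ⟦⟧-nonneg false = ≤-refl

  lowerings≤bridge : ∀ w → lowerings (balanced (+ 0) (+ 0)) w ≤ 2ℚ * ⟦ bridge -[1+ 0 ] w ⟧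
  lowerings≤bridge w with lowerings-bound (+ 0) (+ 0) w
  ... | inj₁ z = subst (_≤ 2ℚ * ⟦ bridge -[1+ 0 ] w ⟧) (sym z) (0≤* 0≤2 (⟦⟧-nonneg (bridge -[1+ 0 ] w)))
  ... | inj₂ (b , e , _) = ≤-trans b (≤-reflexive (trans (sym (*-identityʳ 2ℚ)) (cong (λ z → 2ℚ * ⟦ z ⟧) (sym
      (trans (bridge-isZero -[1+ 0 ] w) (cong isZero (trans (end-shift -[1+ 0 ] w) (cong (λ z → z ℤ.+ -[1+ 0 ]) e))))))))

  balanced-bound : ∀ n → ι n * E n (balanced (+ 0) (+ 0)) ≤ 2ℚ * bridges n -[1+ 0 ]
  balanced-bound n = subst (_≤ 2ℚ * bridges n -[1+ 0 ]) count (subst (E n (lowerings B) ≤_) (E-* n 2ℚ _) (E-mono n lowerings≤bridge))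
    where
    B : Word → ℚ
    B = balanced (+ 0) (+ 0)
    pointwise : ∀ w → length w ≡ n → raisingCount w * B w ≡ ι n * B w
    pointwise w refl with balanced-sound (+ 0) (+ 0) w
    ... | inj₁ z = trans (trans (cong (raisingCount w *_) z) (*-zeroʳ _)) (sym (trans (cong (ι (length w) *_) z) (*-zeroʳ _)))
    ... | inj₂ (_ , e , _) = cong (_* B w) (trans (sym (+-identityʳ _))
            (trans (cong (λ z → raisingCount w + ζ z) (sym e)) (trans (raisingCount-end (+ 0) w) (+-identityʳ _))))
    count : E n (lowerings B) ≡ ι n * E n B
    count = trans (E-lowerings n B) (trans (E-congₗ n pointwise) (E-* n (ι n) B))

  bridges-nonneg : ∀ n y → 0ℚ ≤ bridges n y
  bridges-nonneg n y = E-nonneg n λ w → ⟦⟧-nonneg (bridge y w)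

  -- The 2 comes from `up`, which can be lowered to either level letter. The 4 comes from
  -- `bridges-step` for length n + 1, where the bridges from height -1 are one term of a mean of
  -- four.
  excursion-bound : ∀ n → ι n * means (Eₛ false) n ≤ (2ℚ * 4ℚ) * binomial ½ (suc n)
  excursion-bound n = ≤-trans (*-monoʳ (0≤ι n) (E-mono n (tied≤balanced (+ 0) (+ 0))))
    (≤-trans (balanced-bound n) (≤-by (0≤* 0≤2 (0≤+ (bridges-nonneg n (+ 0)) (0≤+ (bridges-nonneg n (+ 0)) (bridges-nonneg n (+ 1)))))
      (trans (cong ((2ℚ * 4ℚ) *_) (trans (sym (bridges-binomial (suc n))) (bridges-step n (+ 0)))) (expand _ _ _))))
    where
    opaque
      unfolding _+_
      expand : ∀ a b c → (2ℚ * 4ℚ) * (¼ * ((a + b) + (b + c))) ≡ 2ℚ * a + 2ℚ * (b + (b + c))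
      expand = solve-∀ ℚ-ring

-- The comparison sequences and their inequalities

module Constants where

  open Rationals
  open Sequences
  open import Data.Nat.Base as ℕ using (ℕ; zero; suc; z≤n)
  import Data.Nat.Properties as ℕ
  open import Relation.Binary.PropositionalEquality
  open import Tactic.RingSolver using (solve-∀)

  -- `ψ` is the yardstick for summability: a positive sequence of order n^(-3/2), the order obtained
  -- for E, whose series 2 - (1 - x)^(1/2) multiplies exactly with other powers of 1 - x.
  -- Convolution with `1s` forms partial sums.
  a β ψ 1s : Seq
  a = binomial ¼
  β = binomial ½
  ψ = 2ℚ · δ ⊕ (⊖ binomial (- ½))
  1s _ = 1ℚ

  private
    opaque
      unfolding _+_

      ring₁ : ∀ n i x → - ((n - ½) * i * x) ≡ (n - ½) * (i * (- x))
      ring₁ = solve-∀ ℚ-ring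

      ring₂ : ∀ n → (1ℚ + n) - ½ ≡ ½ + n
      ring₂ = solve-∀ ℚ-ring

      ring₃ : ∀ i → 2ℚ * 0ℚ + - ((0ℚ + (- ½)) * i * 1ℚ) ≡ ½ * i
      ring₃ = solve-∀ ℚ-ring

      ring₅ : ∀ x → 2ℚ * 0ℚ + - x ≡ - x
      ring₅ = solve-∀ ℚ-ring

      ring₆ : ∀ n → (1ℚ + n) * 1ℚ ≡ n * 1ℚ + 1ℚ * 1ℚ
      ring₆ = solve-∀ ℚ-ring

      ring₁₁ : ∀ n m c → m ≡ (1ℚ + n) * c → m * (1ℚ - 2ℚ * (1ℚ + n)) ≡ (1ℚ + n) * ((1ℚ - 2ℚ * (1ℚ + n)) * c)
      ring₁₁ n _ c refl = lemma n c
        where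
        lemma : ∀ n c → ((1ℚ + n) * c) * (1ℚ - 2ℚ * (1ℚ + n)) ≡ (1ℚ + n) * ((1ℚ - 2ℚ * (1ℚ + n)) * c)
        lemma = solve-∀ ℚ-ring

      ring₁₂ : ∀ n c → (n * c + (- ½) * c) * (1ℚ - 2ℚ * (1ℚ + n)) ≡ n * ((1ℚ - 2ℚ * n) * c) + ½ * ((1ℚ - 2ℚ * n) * c)
      ring₁₂ = solve-∀ ℚ-ring

      ring₁₃ : (1ℚ - 2ℚ * 0ℚ) * 1ℚ ≡ 1ℚ
      ring₁₃ = refl

      ring₁₄ : ∀ n c → (1ℚ - 2ℚ * (1ℚ + n)) * c ≡ (1ℚ + 2ℚ * n) * (- c)
      ring₁₄ = solve-∀ ℚ-ring

      ring₁₅ : ∀ n i b j c → (n + ½) * i * b * ((n + ¼) * j * c) ≡ ((n + ½) * (n + ¼)) * (i * j) * (b * c)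
      ring₁₅ = solve-∀ ℚ-ring

      ring₁₆ : ∀ n i x → ((n + ½) * i * x) * ((n + ½) * i * x) * (2ℚ + n) ≡ ((n + ½) * (n + ½) * (2ℚ + n)) * (i * i) * (x * x)
      ring₁₆ = solve-∀ ℚ-ring

      ring₁₇ : ∀ n i x → (1ℚ + n) * ((1ℚ + n) * (1ℚ + n)) * (i * i) * (x * x)
                ≡ ((1ℚ + n) * i) * ((1ℚ + n) * i) * (x * x * (1ℚ + n))
      ring₁₇ = solve-∀ ℚ-ring

      ring₁₈ : ∀ n → (1ℚ + n) * ((1ℚ + n) * (1ℚ + n)) ≡ (n + ½) * (n + ½) * (2ℚ + n) + (½ + (½ + ¼) * n)
      ring₁₈ = solve-∀ ℚ-ring

      ring₁₉ : ∀ n → 1ℚ + (1ℚ + n) ≡ 2ℚ + n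
      ring₁₉ = solve-∀ ℚ-ring

      -½+¼ : ¼ + - ½ ≡ - ¼
      -½+¼ = refl

      ½-½ : ½ + - ½ ≡ 0ℚ
      ½-½ = refl

      1-½ : 1ℚ + - ½ ≡ ½
      1-½ = refl

      ¼-¼ : ¼ + - ¼ ≡ 0ℚ
      ¼-¼ = refl

      -½-½ : - ½ + - ½ ≡ - 1ℚ
      -½-½ = refl

      -¼-¼ : - ¼ + - ¼ ≡ - ½
      -¼-¼ = refl

      ψ₀ : 2ℚ * 1ℚ + - 1ℚ ≡ 1ℚ
      ψ₀ = refl

  0<¼ : 0ℚ < ¼
  0<¼ = 0<* 0<½ 0<½

  0<binomial : ∀ {α} → 0ℚ < α → ∀ n → 0ℚ < binomial α n
  0<binomial 0<α zero = 0<1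
  0<binomial 0<α (suc n) = 0<* (0<* (<-≤-trans 0<α (≤-by (0≤ι n) (+-comm _ _))) (0<inv n)) (0<binomial 0<α n)

  0<a : ∀ n → 0ℚ < a n
  0<a = 0<binomial 0<¼

  0<β : ∀ n → 0ℚ < β n
  0<β = 0<binomial 0<½

  0≤a : ∀ n → 0ℚ ≤ a n
  0≤a n = <⇒≤ (0<a n)

  0≤β : ∀ n → 0ℚ ≤ β n
  0≤β n = <⇒≤ (0<β n)

  binomial-decreasing : ∀ {α} → 0ℚ < α → α ≤ 1ℚ → ∀ n → binomial α (suc n) ≤ binomial α n
  binomial-decreasing {α} 0<α α≤1 n = ≤-trans
    (*-monoˡ (<⇒≤ (0<binomial 0<α n)) (*-monoˡ (0≤inv n) (≤-trans (+-monoʳ-≤ (ι n) α≤1) (≤-reflexive (+-comm _ _)))))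
    (≤-reflexive (trans (cong (_* binomial α n) (ι*inv n)) (*-identityˡ _)))

  antitone : ∀ {s : Seq} → (∀ n → s (suc n) ≤ s n) → ∀ {m n} → m ℕ.≤ n → s n ≤ s m
  antitone {s} p {m} m≤n = go (ℕ.≤⇒≤′ m≤n)
    where
    go : ∀ {n} → m ℕ.≤′ n → s n ≤ s m
    go ℕ.≤′-refl = ≤-refl
    go (ℕ.≤′-step h) = ≤-trans (p _) (go h)

  a-antitone : ∀ {m n} → m ℕ.≤ n → a n ≤ a m
  a-antitone = antitone {a} (binomial-decreasing 0<¼ ¼≤1)

  β-antitone : ∀ {m n} → m ℕ.≤ n → β n ≤ β m
  β-antitone = antitone {β} (binomial-decreasing 0<½ ½≤1)

  β≤1 : ∀ n → β n ≤ 1ℚ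
  β≤1 n = β-antitone {0} {n} z≤n

  ψ-0 : ψ 0 ≡ 1ℚ
  ψ-0 = ψ₀

  ψ-suc : ∀ n → ψ (suc n) ≡ - binomial (- ½) (suc n)
  ψ-suc n = ring₅ _

  ψ-1 : ψ 1 ≡ ½ * inv 0
  ψ-1 = ring₃ (inv 0)

  ψ-step : ∀ n → ψ (suc (suc n)) ≡ ((½ + ι n) * inv (suc n)) * ψ (suc n)
  ψ-step n = trans (ψ-suc (suc n)) (trans (ring₁ (ι (suc n)) (inv (suc n)) _)
    (trans (cong₂ (λ x y → x * (inv (suc n) * y)) (ring₂ (ι n)) (sym (ψ-suc n))) (sym (*-assoc _ _ _))))

  ψ-recurrence : ∀ n → ι (suc (suc n)) * ψ (suc (suc n)) ≡ (½ + ι n) * ψ (suc n)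
  ψ-recurrence n = trans (cong (ι (suc (suc n)) *_) (ψ-step n)) (trans (lemma _ _ _ _)
    (trans (cong (λ z → z * ((½ + ι n) * ψ (suc n))) (ι*inv (suc n))) (*-identityˡ _)))
    where
    opaque
      unfolding _+_
      lemma : ∀ m x i y → m * ((x * i) * y) ≡ (m * i) * (x * y)
      lemma = solve-∀ ℚ-ring

  0≤ψ : ∀ n → 0ℚ ≤ ψ n
  0≤ψ zero = subst (0ℚ ≤_) (sym ψ-0) 0≤1
  0≤ψ (suc zero) = subst (0ℚ ≤_) (sym ψ-1) (0≤* 0≤½ (0≤inv 0))
  0≤ψ (suc (suc n)) = subst (0ℚ ≤_) (sym (ψ-step n)) (0≤* (0≤* (0≤+ 0≤½ (0≤ι n)) (0≤inv (suc n))) (0≤ψ (suc n)))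

  binomial-1 : binomial 1ℚ ≈ 1s
  binomial-1 = ≈-sym (binomial-unique 1ℚ 1s refl λ n → ring₆ (ι n))

  binomial-0 : binomial 0ℚ ≈ δ
  binomial-0 = ≈-sym (binomial-unique 0ℚ δ refl λ { zero → z₁ ; (suc n) → z₂ (ι (suc n)) })
    where
    opaque
      unfolding _+_
      z₁ : (1ℚ + 0ℚ) * 0ℚ ≡ 0ℚ * 1ℚ + 0ℚ * 1ℚ
      z₁ = refl
      z₂ : ∀ n → (1ℚ + n) * 0ℚ ≡ n * 0ℚ + 0ℚ * 0ℚ
      z₂ = solve-∀ ℚ-ring

  -- Since ψ = 2 - (1 - x)^(1/2), products with ψ are evaluated by adding exponents.
  ⋆-ψ : ∀ {α γ} → α + - ½ ≡ γ → binomial α ⋆ ψ ≈ 2ℚ · binomial α ⊕ (⊖ binomial γ)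
  ⋆-ψ {α} refl n = begin
    (binomial α ⋆ ψ) n ≡⟨ ⋆-comm (binomial α) ψ n ⟩
    (ψ ⋆ binomial α) n ≡⟨ ⋆-distribʳ (binomial α) (2ℚ · δ) (⊖ c) n ⟩
    ((2ℚ · δ) ⋆ binomial α) n + ((⊖ c) ⋆ binomial α) n
      ≡⟨ cong₂ _+_ (trans (·-⋆ 2ℚ δ (binomial α) n) (cong (2ℚ *_) (⋆-identityˡ (binomial α) n)))
           (trans (sym (-‿distribˡ-* c (binomial α) n)) (cong -_ (trans (⋆-comm c (binomial α) n) (binomial-⋆ α (- ½) n)))) ⟩
    2ℚ * binomial α n + - binomial (α + - ½) n ∎
    where
    open ≡-Reasoning
    c : Seq
    c = binomial (- ½)

  1s⋆ψ : 1s ⋆ ψ ≈ 2ℚ · 1s ⊕ (⊖ β)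
  1s⋆ψ n = trans (⋆-cong (≈-sym binomial-1) (λ _ → refl) n) (trans (⋆-ψ 1-½ n) (cong (λ z → 2ℚ * z + - β n) (binomial-1 n)))

  -- The partial sums of `ψ` are 2 - β, so its tails are the values of `β`; this makes `β` the rate
  -- of convergence everywhere below.
  ψ-telescopes : ∀ n → ψ (suc n) ≡ β n - β (suc n)
  ψ-telescopes n = begin
    ψ (suc n) ≡⟨ lemma (ψ (suc n)) ((1s ⋆ ψ) n) ⟩
    (1s ⋆ ψ) (suc n) - (1s ⋆ ψ) n ≡⟨ cong₂ _-_ (1s⋆ψ (suc n)) (1s⋆ψ n) ⟩
    (2ℚ * 1ℚ + - β (suc n)) - (2ℚ * 1ℚ + - β n) ≡⟨ lemma₂ _ _ ⟩
    β n - β (suc n) ∎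
    where
    open ≡-Reasoning
    opaque
      unfolding _+_
      lemma : ∀ x y → x ≡ (1ℚ * x + y) - y
      lemma = solve-∀ ℚ-ring
      lemma₂ : ∀ x y → (2ℚ * 1ℚ + - y) - (2ℚ * 1ℚ + - x) ≡ x - y
      lemma₂ = solve-∀ ℚ-ring

  a⋆ψ : a ⋆ ψ ≈ 2ℚ · a ⊕ (⊖ binomial (- ¼))
  a⋆ψ = ⋆-ψ -½+¼

  a-inverse : a ⋆ binomial (- ¼) ≈ δ
  a-inverse n = trans (binomial-⋆ ¼ (- ¼) n) (trans (cong (λ z → binomial z n) ¼-¼) (binomial-0 n))

  β-inverse : β ⋆ binomial (- ½) ≈ δ
  β-inverse n = trans (binomial-⋆ ½ (- ½) n) (trans (cong (λ z → binomial z n) ½-½) (binomial-0 n))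

  binomial-¼-squared : binomial (- ¼) ⋆ binomial (- ¼) ≈ binomial (- ½)
  binomial-¼-squared n = trans (binomial-⋆ (- ¼) (- ¼) n) (cong (λ z → binomial z n) -¼-¼)

  -- Applying 1 - 2 x d/dx to (1 - x)^(1/2) gives (1 - x)^(-1/2). The factor of order n is what
  -- turns a bound on n eₙ by β into one on eₙ by ψ.
  β-from-ψ : ∀ n → β (suc n) ≡ (1ℚ + 2ℚ * ι n) * ψ (suc n)
  β-from-ψ n = trans (sym (x≈β (suc n))) (trans (ring₁₄ (ι n) _) (cong ((1ℚ + 2ℚ * ι n) *_) (sym (ψ-suc n))))
    where
    c : Seq
    c = binomial (- ½)
    x≈β : (λ n → (1ℚ - 2ℚ * ι n) * c n) ≈ β
    x≈β = binomial-unique ½ _ ring₁₃ λ n → trans (sym (ring₁₁ (ι n) (ι (suc n) * c (suc n)) (c (suc n)) refl))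
      (trans (cong (_* (1ℚ - 2ℚ * ι (suc n))) (binomial-step (- ½) n)) (ring₁₂ (ι n) (c n)))

  -- Comparison by ratios, with the products (β a) in the role of the larger sequence.
  βa-step : ∀ n → β (suc n) * a (suc n) ≡ ((ι n + ½) * (ι n + ¼)) * (inv n * inv n) * (β n * a n)
  βa-step n = ring₁₅ (ι n) (inv n) (β n) (inv n) (a n)

  compare-βa : ∀ (u : Seq) c (x : ℕ → ℚ) → 0ℚ ≤ c → (∀ n → 0ℚ ≤ x n) → u 1 ≤ c * (β 1 * a 1) →
    (∀ n → u (suc (suc n)) ≡ (x n * inv (suc n)) * u (suc n)) →
    (∀ n → x n * ι (suc (suc n)) ≤ (ι (suc n) + ½) * (ι (suc n) + ¼)) → ∀ n → u (suc n) ≤ c * (β (suc n) * a (suc n))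
  compare-βa u c x 0≤c 0≤x base step ratio zero = base
  compare-βa u c x 0≤c 0≤x base step ratio (suc n) = subst₂ _≤_ (sym (step n)) (sym (trans (cong (c *_) (βa-step (suc n))) (lemma₂ c _ _)))
    (≤-trans (*-monoʳ (0≤* (0≤x n) (0≤inv (suc n))) (compare-βa u c x 0≤c 0≤x base step ratio n))
      (*-monoˡ (0≤* 0≤c (0≤* (0≤β (suc n)) (0≤a (suc n)))) (subst (_≤ (ι (suc n) + ½) * (ι (suc n) + ¼) * (inv (suc n) * inv (suc n)))
        (trans (lemma (x n) (ι (suc (suc n))) (inv (suc n))) (trans (cong (_* (x n * inv (suc n))) (ι*inv (suc n))) (*-identityˡ _)))
        (*-monoˡ (0≤* (0≤inv (suc n)) (0≤inv (suc n))) (ratio n)))))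
    where
    opaque
      unfolding _+_
      lemma : ∀ x m i → (x * m) * (i * i) ≡ (m * i) * (x * i)
      lemma = solve-∀ ℚ-ring
      lemma₂ : ∀ c k y → c * (k * y) ≡ k * (c * y)
      lemma₂ = solve-∀ ℚ-ring

  opaque
    unfolding _+_

    inv-0 : inv 0 ≡ 1ℚ
    inv-0 = trans (lemma (inv 0)) (ι*inv 0)
      where
      lemma : ∀ x → x ≡ (1ℚ + 0ℚ) * x
      lemma = solve-∀ ℚ-ring

  -- The coefficients of -(1 - x)^(1/4), the error term of a ⋆ ψ = 2a + χ. Like the product of β and
  -- a they are of order n^(-5/4).
  χ : Seq
  χ = ⊖ binomial (- ¼)

  private
    opaque
      unfolding _+_

      χ-ring : ∀ n i x → - (((1ℚ + n) + - ¼) * i * x) ≡ (((½ + ¼) + n) * i) * (- x)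
      χ-ring = solve-∀ ℚ-ring

      χ-base : - ((0ℚ + - ¼) * 1ℚ * 1ℚ) ≡ 2ℚ * (((0ℚ + ½) * 1ℚ * 1ℚ) * ((0ℚ + ¼) * 1ℚ * 1ℚ))
      χ-base = refl

      ψ-base : 4ℚ * (((0ℚ + ½) * 1ℚ * 1ℚ) * ((0ℚ + ¼) * 1ℚ * 1ℚ)) ≡ ½ * 1ℚ
      ψ-base = refl

      χ-ratio : ∀ n → ((1ℚ + n) + ½) * ((1ℚ + n) + ¼) ≡ ((½ + ¼) + n) * (1ℚ + (1ℚ + n)) + ½ * (½ + ¼)
      χ-ratio = solve-∀ ℚ-ring

      ψ-ratio : ∀ n → ((1ℚ + n) + ½) * ((1ℚ + n) + ¼) ≡ (½ + n) * (1ℚ + (1ℚ + n)) + (¼ * n + (½ + (¼ + ½ * ¼)))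
      ψ-ratio = solve-∀ ℚ-ring

      a²-expand : ∀ n i x → (1ℚ + (1ℚ + n)) * (((n + ¼) * i * x) * ((n + ¼) * i * x)) ≡ ((2ℚ + n) * ((n + ¼) * (n + ¼))) * ((i * i) * (x * x))
      a²-expand = solve-∀ ℚ-ring

      a²-collect : ∀ n i x → ((n + ½) * ((1ℚ + n) * (1ℚ + n))) * ((i * i) * (x * x)) ≡ ((1ℚ + n) * i) * ((n + ½) * i * ((1ℚ + n) * (x * x)))
      a²-collect = solve-∀ ℚ-ring

      a²-ratio : ∀ n → (n + ½) * ((1ℚ + n) * (1ℚ + n)) ≡ (2ℚ + n) * ((n + ¼) * (n + ¼)) + ((½ + ¼ + ½ * (¼ + ½ * ¼)) * n + ½ * (½ + ¼))
      a²-ratio = solve-∀ ℚ-ring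

      a²-base : 1ℚ ≡ (1ℚ + 0ℚ) * (1ℚ * 1ℚ)
      a²-base = refl

      β²-base : 1ℚ * 1ℚ * (1ℚ + 0ℚ) ≡ 1ℚ
      β²-base = refl

      ψ²-ring : ∀ x y c → 2ℚ * x + - (2ℚ * c + - y) ≡ (2ℚ * x + 2ℚ * (- c)) + y
      ψ²-ring = solve-∀ ℚ-ring

      ψ²-ring′ : ∀ x y → 4ℚ * x ≡ ((2ℚ * x + 2ℚ * x) + y) + - y
      ψ²-ring′ = solve-∀ ℚ-ring

      binomial-neg : ∀ i → - ((0ℚ + - 1ℚ) * i * 1ℚ) ≡ i
      binomial-neg = solve-∀ ℚ-ring

      binomial-neg′ : ∀ n i x → - (((1ℚ + n) + - 1ℚ) * i * x) ≡ (n * i) * (- x)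
      binomial-neg′ = solve-∀ ℚ-ring

      ψ²-0 : 4ℚ * 1ℚ ≡ 1ℚ * 1ℚ + (2ℚ + 1ℚ)
      ψ²-0 = refl

  -- The constants 4 here and 2 in `χ≤βa` give equality at the first term; from there the ratios
  -- decide.
  ψ≤βa : ∀ n → ψ (suc n) ≤ 4ℚ * (β (suc n) * a (suc n))
  ψ≤βa = compare-βa ψ 4ℚ (λ n → ½ + ι n) 0≤4 (λ n → 0≤+ 0≤½ (0≤ι n))
    (≤-reflexive (trans ψ-1 (trans (cong (½ *_) inv-0) (sym (trans
      (cong (λ z → 4ℚ * (((0ℚ + ½) * z * 1ℚ) * ((0ℚ + ¼) * z * 1ℚ))) inv-0) ψ-base)))))
    ψ-step (λ n → ≤-by (0≤+ (0≤* 0≤¼ (0≤ι n)) (0≤+ 0≤½ (0≤+ 0≤¼ (0≤* 0≤½ 0≤¼)))) (ψ-ratio (ι n)))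

  χ≤βa : ∀ n → χ (suc n) ≤ 2ℚ * (β (suc n) * a (suc n))
  χ≤βa = compare-βa χ 2ℚ (λ n → (½ + ¼) + ι n) 0≤2 (λ n → 0≤+ (0≤+ 0≤½ 0≤¼) (0≤ι n))
    (≤-reflexive (trans (cong (λ z → - ((0ℚ + - ¼) * z * 1ℚ)) inv-0) (sym (trans
      (cong (λ z → 2ℚ * (((0ℚ + ½) * z * 1ℚ) * ((0ℚ + ¼) * z * 1ℚ))) inv-0) (sym χ-base)))))
    (λ n → χ-ring (ι n) (inv (suc n)) _) (λ n → ≤-by (0≤* 0≤½ (0≤+ 0≤½ 0≤¼)) (χ-ratio (ι n)))

  -- The left side decreases from 1, since (n + 1)³ exceeds (n + 1/2)² (n + 2).
  β²-bound : ∀ n → β n * β n * ι (suc n) ≤ 1ℚ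
  β²-bound zero = ≤-reflexive β²-base
  β²-bound (suc n) = subst (_≤ 1ℚ) (sym (trans (cong (β (suc n) * β (suc n) *_) (ring₁₉ (ι n))) (ring₁₆ (ι n) (inv n) (β n))))
    (≤-trans (*-monoˡ (0≤* (0≤β n) (0≤β n)) (*-monoˡ (0≤* (0≤inv n) (0≤inv n))
        (≤-by (0≤+ 0≤½ (0≤* (0≤+ 0≤½ 0≤¼) (0≤ι n))) (ring₁₈ (ι n)))))
      (subst (_≤ 1ℚ) (sym (trans (ring₁₇ (ι n) (inv n) (β n))
        (trans (cong (λ z → z * z * (β n * β n * ι (suc n))) (ι*inv n)) (trans (cong (_* (β n * β n * ι (suc n))) (*-identityˡ 1ℚ)) (*-identityˡ _)))))
        (β²-bound n)))

  a²≤β : ∀ n → ι (suc n) * (a n * a n) ≤ β n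
  a²≤β zero = ≤-reflexive (sym a²-base)
  a²≤β (suc n) = ≤-trans (≤-reflexive (a²-expand (ι n) (inv n) (a n)))
    (≤-trans (*-monoˡ (0≤* (0≤* (0≤inv n) (0≤inv n)) (0≤* (0≤a n) (0≤a n)))
        (≤-by (0≤+ (0≤* (0≤+ (0≤+ 0≤½ 0≤¼) (0≤* 0≤½ (0≤+ 0≤¼ (0≤* 0≤½ 0≤¼)))) (0≤ι n)) (0≤* 0≤½ (0≤+ 0≤½ 0≤¼))) (a²-ratio (ι n))))
      (≤-trans (≤-reflexive (trans (a²-collect (ι n) (inv n) (a n)) (trans (cong (_* ((ι n + ½) * inv n * (ι (suc n) * (a n * a n)))) (ι*inv n)) (*-identityˡ _))))
        (*-monoʳ (0≤* (0≤+ (0≤ι n) 0≤½) (0≤inv n)) (a²≤β n))))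

  0≤-binomial-1 : ∀ n → 0ℚ ≤ - binomial (- 1ℚ) (suc n)
  0≤-binomial-1 zero = subst (0ℚ ≤_) (sym (binomial-neg (inv 0))) (0≤inv 0)
  0≤-binomial-1 (suc n) = subst (0ℚ ≤_) (sym (binomial-neg′ (ι n) (inv (suc n)) _)) (0≤* (0≤* (0≤ι n) (0≤inv (suc n))) (0≤-binomial-1 n))

  -- Exactly, ψ² = 4ψ - 3 - x. The correction has the right sign, and so domination by ψ is stable
  -- under products.
  ψ⋆ψ≤4ψ : ∀ n → (ψ ⋆ ψ) n ≤ 4ℚ * ψ n
  ψ⋆ψ≤4ψ zero = subst (λ z → z * z ≤ 4ℚ * z) (sym ψ-0) (≤-by (0≤+ 0≤2 0≤1) ψ²-0)
  ψ⋆ψ≤4ψ (suc n) = ≤-by (0≤-binomial-1 n) (trans (ψ²-ring′ (ψ (suc n)) (binomial (- 1ℚ) (suc n))) (cong (_+ - binomial (- 1ℚ) (suc n)) (sym (begin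
    (ψ ⋆ ψ) (suc n) ≡⟨ ⋆-distribʳ ψ (2ℚ · δ) (⊖ c) (suc n) ⟩
    ((2ℚ · δ) ⋆ ψ) (suc n) + ((⊖ c) ⋆ ψ) (suc n)
      ≡⟨ cong₂ _+_ (trans (·-⋆ 2ℚ δ ψ (suc n)) (cong (2ℚ *_) (⋆-identityˡ ψ (suc n))))
           (trans (sym (-‿distribˡ-* c ψ (suc n))) (cong -_ (⋆-ψ -½-½ (suc n)))) ⟩
    2ℚ * ψ (suc n) + - (2ℚ * c (suc n) + - binomial (- 1ℚ) (suc n)) ≡⟨ ψ²-ring _ _ _ ⟩
    (2ℚ * ψ (suc n) + 2ℚ * (- c (suc n))) + binomial (- 1ℚ) (suc n)
      ≡⟨ cong (λ z → (2ℚ * ψ (suc n) + 2ℚ * z) + binomial (- 1ℚ) (suc n)) (sym (ψ-suc n)) ⟩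
    (2ℚ * ψ (suc n) + 2ℚ * ψ (suc n)) + binomial (- 1ℚ) (suc n) ∎))))
    where
    open ≡-Reasoning
    c : Seq
    c = binomial (- ½)

-- Convolution with summable sequences, and rates of convergence

module Limit where

  open Rationals
  open Sequences
  open Constants
  open import Data.Nat.Base as ℕ using (ℕ; suc; s≤s)
  import Data.Nat.Properties as ℕ
  open import Data.Integer.Base using (+_)
  open import Relation.Binary.PropositionalEquality
  open import Tactic.RingSolver using (solve-∀)

  private
    opaque
      unfolding _+_

      ring₁ : ∀ c d p → (c * p) + (d * p) ≡ (c + d) * p
      ring₁ = solve-∀ ℚ-ring

      ring₂ : ∀ c d p → c * (d * p) ≡ (c * d) * p
      ring₂ = solve-∀ ℚ-ring

      ring₃ : ∀ c d p → (c * d) * (4ℚ * p) ≡ ((1ℚ + (1ℚ + (1ℚ + (1ℚ + 0ℚ)))) * (c * d)) * p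
      ring₃ = solve-∀ ℚ-ring

      ring₅ : ∀ c b b′ b″ → c * (b′ - b″) + c * (b - b′) ≡ c * (b - b″)
      ring₅ = solve-∀ ℚ-ring

      ring₆ : ∀ s t u → (1ℚ * s + t) - u ≡ s + (t - u)
      ring₆ = solve-∀ ℚ-ring

      ring₈ : ∀ x → x - x ≡ 0ℚ
      ring₈ = solve-∀ ℚ-ring

      ring₉ : ∀ c x → c * (x - x) ≡ 0ℚ
      ring₉ = solve-∀ ℚ-ring

      ring₁₀ : ∀ c b b′ → c * b ≡ c * (b - b′) + c * b′
      ring₁₀ = solve-∀ ℚ-ring

      ring₁₁ : ∀ a x b → (2ℚ * a + x) + (- a) * (2ℚ * 1ℚ + - b) ≡ x + b * a
      ring₁₁ = solve-∀ ℚ-ring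

      ring₁₂ : ∀ x y a → x + (- a) * y ≡ x - a * y
      ring₁₂ = solve-∀ ℚ-ring

      ring₁₃ : ∀ x → 2ℚ * x + x ≡ (1ℚ + (1ℚ + (1ℚ + 0ℚ))) * x
      ring₁₃ = solve-∀ ℚ-ring

      ring₁₄ : ∀ x y u v → x * y - u * v ≡ x * (y - v) + v * (x - u)
      ring₁₄ = solve-∀ ℚ-ring

      ring₁₅ : ∀ B C B′ C′ b → B * (C′ * b) + B′ * (C * b) ≡ (B * C′ + B′ * C) * b
      ring₁₅ = solve-∀ ℚ-ring

      ring₁₆ : ∀ p q u v → p - q ≡ (p - u) + ((u - v) + (v - q))
      ring₁₆ = solve-∀ ℚ-ring

      ring₁₇ : ∀ k c b → k * b + (c * b + k * b) ≡ (k + (c + k)) * b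
      ring₁₇ = solve-∀ ℚ-ring

      ring₁₈ : ∀ r s i σ a → i * a ≡ 1ℚ → (r + s) * i - σ ≡ i * ((r - a * σ) + s)
      ring₁₈ r s i σ a e = trans (cong (λ z → (r + s) * i - z) (sym (*-identityˡ σ)))
        (trans (cong (λ z → (r + s) * i - z * σ) (sym e)) (collect r s i σ a))
        where
        collect : ∀ r s i σ a → (r + s) * i - (i * a) * σ ≡ i * ((r - a * σ) + s)
        collect = solve-∀ ℚ-ring

      ring₁₉ : ∀ c d b a i → i * a ≡ 1ℚ → i * (c * (b * a) + d * (4ℚ * (b * a))) ≡ (c + d * (1ℚ + (1ℚ + (1ℚ + (1ℚ + 0ℚ))))) * b
      ring₁₉ c d b a i e = trans (collect c d b a i) (trans (cong (λ z → z * ((c + d * (1ℚ + (1ℚ + (1ℚ + (1ℚ + 0ℚ))))) * b)) e) (*-identityˡ _))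
        where
        collect : ∀ c d b a i → i * (c * (b * a) + d * (4ℚ * (b * a))) ≡ (i * a) * ((c + d * (1ℚ + (1ℚ + (1ℚ + (1ℚ + 0ℚ))))) * b)
        collect = solve-∀ ℚ-ring

      ring₂₀ : ∀ c b → c * ((1ℚ + (1ℚ + 0ℚ)) * 1ℚ) ≡ c * (2ℚ * 1ℚ + - b) + c * b
      ring₂₀ = solve-∀ ℚ-ring

      ring₂₁ : ∀ g σ → g ≡ (g - σ) + σ
      ring₂₁ = solve-∀ ℚ-ring

      ring₂₂ : ∀ x → x ≡ ½ * x + ½ * x
      ring₂₂ = solve-∀ ℚ-ring

  ∣½p∣≤∣p∣ : ∀ p → ∣ ½ * p ∣ ≤ ∣ p ∣
  ∣½p∣≤∣p∣ p = subst (_≤ ∣ p ∣) (sym (trans (∣p*q∣≡∣p∣*∣q∣ ½ p) (cong (_* ∣ p ∣) (0≤p⇒∣p∣≡p 0≤½))))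
    (≤-by (0≤* 0≤½ (0≤∣p∣ p)) (ring₂₂ ∣ p ∣))

  ∣p-q∣-sym : ∀ p q → ∣ p - q ∣ ≡ ∣ q - p ∣
  ∣p-q∣-sym p q = trans (sym (∣-p∣≡∣p∣ (p - q))) (cong ∣_∣ (neg-sub p q))

  -- A quantitative form of absolute summability with tails O(β).
  Dominated : ℕ → Seq → Set
  Dominated C s = ∀ n → ∣ s n ∣ ≤ ι C * ψ n

  dominated-cong : ∀ {C s t} → s ≈ t → Dominated C s → Dominated C t
  dominated-cong {C} p d n = subst (λ z → ∣ z ∣ ≤ ι C * ψ n) (p n) (d n)

  dominated-⊕ : ∀ {C D s t} → Dominated C s → Dominated D t → Dominated (C ℕ.+ D) (s ⊕ t)
  dominated-⊕ {C} {D} {s} {t} p q n = ≤-trans (∣p+q∣≤∣p∣+∣q∣ (s n) (t n)) (≤-trans (+-mono-≤ (p n) (q n))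
    (≤-reflexive (trans (ring₁ (ι C) (ι D) (ψ n)) (cong (_* ψ n) (sym (ι-+ C D))))))

  dominated-⊖ : ∀ {C s} → Dominated C s → Dominated C (⊖ s)
  dominated-⊖ {C} {s} p n = subst (_≤ ι C * ψ n) (sym (∣-p∣≡∣p∣ (s n))) (p n)

  dominated-⋆ : ∀ {C D s t} → Dominated C s → Dominated D t → Dominated (4 ℕ.* (C ℕ.* D)) (s ⋆ t)
  dominated-⋆ {C} {D} {s} {t} p q n = ≤-trans (⋆-dominated n (λ k _ → p k) (λ k _ → q k)) (≤-trans
    (≤-reflexive (trans (·-⋆ (ι C) ψ (ι D · ψ) n) (trans (cong (ι C *_) (trans (⋆-comm ψ (ι D · ψ) n) (·-⋆ (ι D) ψ ψ n))) (ring₂ _ _ _))))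
    (≤-trans (*-monoʳ (0≤* (0≤ι C) (0≤ι D)) (ψ⋆ψ≤4ψ n))
      (≤-reflexive (trans (ring₃ (ι C) (ι D) (ψ n)) (cong (_* ψ n) (sym (trans (ι-* 4 (C ℕ.* D)) (cong (ι 4 *_) (ι-* C D)))))))))

  -- Convolving a with a summable sequence s multiplies a by the sum of s, up to a relative error O(β).
  ⋆-asymptotic : ∀ {C s} → Dominated C s → ∀ n →
    ∣ (a ⋆ s) (suc n) - a (suc n) * (1s ⋆ s) (suc n) ∣ ≤ ι C * (ι 3 * (β (suc n) * a (suc n)))
  ⋆-asymptotic {C} {s} d n = subst₂ _≤_ (cong ∣_∣ (trans (gap s) (ring₁₂ _ _ _))) refl
    (≤-trans (⋆-dominated {u} {s} {u} {ι C · ψ} m (λ k k≤m → ≤-reflexive (0≤p⇒∣p∣≡p (0≤-difference (a-antitone k≤m)))) (λ k _ → d k))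
      (≤-trans (≤-reflexive (trans (⋆-comm u (ι C · ψ) m) (trans (·-⋆ (ι C) ψ u m) (cong (ι C *_) (trans (⋆-comm ψ u m) gap-ψ)))))
        (*-monoʳ (0≤ι C) (≤-trans (+-monoˡ-≤ (β m * a m) (χ≤βa n)) (≤-reflexive (ring₁₃ _))))))
    where
    m : ℕ
    m = suc n
    -- Up to index m this is nonnegative because a decreases, so s may be replaced by C ψ in the
    -- error; for ψ the error is known exactly, namely χ + β a. The 3 is 2 + 1.
    u : Seq
    u k = a k - a m
    u-split : u ≈ a ⊕ (- a m) · 1s
    u-split k = cong (λ z → a k + z) (sym (*-identityʳ (- a m)))
    gap : ∀ t → (u ⋆ t) m ≡ (a ⋆ t) m + (- a m) * (1s ⋆ t) m
    gap t = trans (⋆-cong u-split (λ _ → refl) m) (trans (⋆-distribʳ t a ((- a m) · 1s) m) (cong (λ z → (a ⋆ t) m + z) (·-⋆ (- a m) 1s t m)))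
    gap-ψ : (u ⋆ ψ) m ≡ χ m + β m * a m
    gap-ψ = trans (gap ψ) (trans (cong₂ (λ x y → x + (- a m) * y) (a⋆ψ m) (1s⋆ψ m)) (ring₁₁ (a m) (χ m) (β m)))

  -- A Cauchy condition with the explicit modulus β. Indices start at 1, where the comparisons with
  -- the product of β and a begin.
  Rate : ℕ → Seq → Set
  Rate C x = ∀ n m → n ℕ.≤ m → ∣ x (suc m) - x (suc n) ∣ ≤ ι C * β (suc n)

  Bounded : ℕ → Seq → Set
  Bounded B x = ∀ n → ∣ x (suc n) ∣ ≤ ι B

  _∙_ : Seq → Seq → Seq
  (x ∙ y) n = x n * y n

  bounded-∙ : ∀ {B B′ x y} → Bounded B x → Bounded B′ y → Bounded (B ℕ.* B′) (x ∙ y)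
  bounded-∙ {B} {B′} {x} {y} p q n = subst₂ _≤_ (sym (∣p*q∣≡∣p∣*∣q∣ (x (suc n)) (y (suc n)))) (sym (ι-* B B′))
    (*-mono (0≤∣p∣ _) (p n) (0≤∣p∣ _) (q n))

  rate-∙ : ∀ {B C B′ C′ x y} → Bounded B x → Rate C x → Bounded B′ y → Rate C′ y → Rate (B ℕ.* C′ ℕ.+ B′ ℕ.* C) (x ∙ y)
  rate-∙ {B} {C} {B′} {C′} {x} {y} bx rx by ry n m n≤m = subst (λ z → ∣ z ∣ ≤ bound) (sym (ring₁₄ _ _ _ _))
    (≤-trans (∣p+q∣≤∣p∣+∣q∣ _ _) (≤-trans (+-mono-≤ (times (x (suc m)) (y (suc m) - y (suc n)) (bx m) (ry n m n≤m))
                                            (times (y (suc n)) (x (suc m) - x (suc n)) (by n) (rx n m n≤m)))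
      (≤-reflexive (trans (ring₁₅ (ι B) (ι C) (ι B′) (ι C′) (β (suc n)))
        (cong (_* β (suc n)) (sym (trans (ι-+ (B ℕ.* C′) (B′ ℕ.* C)) (cong₂ _+_ (ι-* B C′) (ι-* B′ C)))))))))
    where
    bound : ℚ
    bound = ι (B ℕ.* C′ ℕ.+ B′ ℕ.* C) * β (suc n)
    times : ∀ u v {c d} → ∣ u ∣ ≤ c → ∣ v ∣ ≤ d → ∣ u * v ∣ ≤ c * d
    times u v p q = subst (_≤ _) (sym (∣p*q∣≡∣p∣*∣q∣ u v)) (*-mono (0≤∣p∣ u) p (0≤∣p∣ v) q)

  bounded-½ : ∀ {B x} → Bounded B x → Bounded B (½ · x)
  bounded-½ {B} {x} p n = ≤-trans (∣½p∣≤∣p∣ (x (suc n))) (p n)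

  rate-½ : ∀ {C x} → Rate C x → Rate C (½ · x)
  rate-½ {C} {x} p n m h = subst (λ z → ∣ z ∣ ≤ ι C * β (suc n)) (factor (x (suc m)) (x (suc n))) (≤-trans (∣½p∣≤∣p∣ (x (suc m) - x (suc n))) (p n m h))
    where
    opaque
      unfolding _+_
      factor : ∀ p q → ½ * (p - q) ≡ ½ * p - ½ * q
      factor = solve-∀ ℚ-ring

  -- An increment is at most C ψ, and these bounds telescope to C times a difference of values of β.
  partial-sums-rate : ∀ {C s} → Dominated C s → Rate C (1s ⋆ s)
  partial-sums-rate {C} {s} d n m n≤m = ≤-trans (go (ℕ.≤⇒≤′ n≤m)) (≤-by (0≤* (0≤ι C) (0≤β (suc m))) (ring₁₀ _ _ _))
    where
    σ : Seq
    σ = 1s ⋆ s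
    go : ∀ {m} → n ℕ.≤′ m → ∣ σ (suc m) - σ (suc n) ∣ ≤ ι C * (β (suc n) - β (suc m))
    go ℕ.≤′-refl = ≤-reflexive (trans (cong ∣_∣ (ring₈ _)) (trans (0≤p⇒∣p∣≡p ≤-refl) (sym (ring₉ (ι C) _))))
    go (ℕ.≤′-step {m} h) = subst (λ z → ∣ z ∣ ≤ ι C * (β (suc n) - β (suc (suc m)))) (sym (ring₆ (s (suc (suc m))) (σ (suc m)) (σ (suc n))))
      (≤-trans (∣p+q∣≤∣p∣+∣q∣ _ _) (≤-trans (+-mono-≤ (subst (λ z → ∣ s (suc (suc m)) ∣ ≤ ι C * z) (ψ-telescopes (suc m)) (d (suc (suc m)))) (go h))
        (≤-reflexive (ring₅ _ _ _ _))))

  partial-sums-bounded : ∀ {C s} → Dominated C s → Bounded (C ℕ.* 2) (1s ⋆ s)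
  partial-sums-bounded {C} {s} d n = ≤-trans (⋆-dominated {1s} {s} {1s} {ι C · ψ} (suc n) (λ _ _ → ≤-reflexive (0≤p⇒∣p∣≡p 0≤1)) (λ k _ → d k))
    (≤-trans (≤-reflexive (trans (⋆-comm 1s (ι C · ψ) (suc n)) (trans (·-⋆ (ι C) ψ 1s (suc n)) (cong (ι C *_) (trans (⋆-comm ψ 1s (suc n)) (1s⋆ψ (suc n)))))))
      (≤-trans (≤-by (0≤* (0≤ι C) (0≤β (suc n))) (ring₂₀ (ι C) (β (suc n)))) (≤-reflexive (trans (cong (ι C *_) (*-identityʳ _)) (sym (ι-* C 2))))))

  -- The shape of the final count relative to 4ⁿ: a main term `a ⋆ s` and a remainder `r′`, here the
  -- signed count. Divided by a, both errors become O(β).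
  module Quotient {C D : ℕ} {s r′ : Seq} (ds : Dominated C s) (dr : Dominated D r′) where

    σ g : Seq
    σ = 1s ⋆ s
    g n = ((a ⋆ s) n + r′ n) * reciprocal (a n) (0<a n)

    K : ℕ
    -- The 3 is the constant of `⋆-asymptotic`, the 4 that of `ψ≤βa`.
    K = C ℕ.* 3 ℕ.+ D ℕ.* 4

    private
      inverse : ∀ n → reciprocal (a n) (0<a n) * a n ≡ 1ℚ
      inverse n = trans (*-comm _ _) (*-reciprocal (a n) (0<a n))

    g*a : ∀ n → g n * a n ≡ (a ⋆ s) n + r′ n
    g*a n = trans (*-assoc _ _ _) (trans (cong (((a ⋆ s) n + r′ n) *_) (inverse n)) (*-identityʳ _))

    g-near-σ : ∀ n → ∣ g (suc n) - σ (suc n) ∣ ≤ ι K * β (suc n)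
    g-near-σ n = subst (λ z → ∣ z ∣ ≤ ι K * β m) (sym (ring₁₈ _ (r′ m) i (σ m) (a m) (inverse m)))
      (subst (_≤ ι K * β m) (sym (trans (∣p*q∣≡∣p∣*∣q∣ i _) (cong (λ z → z * ∣ ((a ⋆ s) m - a m * σ m) + r′ m ∣) (0≤p⇒∣p∣≡p (<⇒≤ 0<i)))))
        (≤-trans (*-monoʳ (<⇒≤ 0<i) (≤-trans (∣p+q∣≤∣p∣+∣q∣ _ _)
            (+-mono-≤ (≤-trans (⋆-asymptotic {C} ds n) (≤-reflexive (ring₂ _ _ _))) (≤-trans (dr m) (*-monoʳ (0≤ι D) (ψ≤βa n))))))
          (≤-reflexive (trans (ring₁₉ (ι C * ι 3) (ι D) (β m) (a m) i (inverse m))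
            (cong (_* β m) (sym (trans (ι-+ (C ℕ.* 3) (D ℕ.* 4)) (cong₂ _+_ (ι-* C 3) (ι-* D 4)))))))))
      where
      m : ℕ
      m = suc n
      i : ℚ
      i = reciprocal (a m) (0<a m)
      0<i : 0ℚ < i
      0<i = 0<reciprocal (a m) (0<a m)

    g-rate : Rate (K ℕ.+ (C ℕ.+ K)) g
    g-rate n m n≤m = subst (λ z → ∣ z ∣ ≤ ι (K ℕ.+ (C ℕ.+ K)) * β (suc n)) (sym (ring₁₆ (g (suc m)) (g (suc n)) (σ (suc m)) (σ (suc n))))
      (≤-trans (∣p+q∣≤∣p∣+∣q∣ _ _) (≤-trans (+-mono-≤ (≤-trans (g-near-σ m) (*-monoʳ (0≤ι K) (β-antitone (s≤s n≤m))))
          (≤-trans (∣p+q∣≤∣p∣+∣q∣ _ _) (+-mono-≤ (partial-sums-rate {C} ds n m n≤m)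
            (subst (_≤ ι K * β (suc n)) (∣p-q∣-sym (g (suc n)) (σ (suc n))) (g-near-σ n)))))
        (≤-reflexive (trans (ring₁₇ (ι K) (ι C) (β (suc n))) (cong (_* β (suc n)) (sym (trans (ι-+ K (C ℕ.+ K)) (cong (λ z → ι K + z) (ι-+ C K)))))))))

    g-bounded : Bounded (K ℕ.+ C ℕ.* 2) g
    g-bounded n = subst₂ _≤_ (cong ∣_∣ (sym (ring₂₁ (g (suc n)) (σ (suc n))))) (sym (ι-+ K (C ℕ.* 2)))
      (≤-trans (∣p+q∣≤∣p∣+∣q∣ _ _) (+-mono-≤
        (≤-trans (g-near-σ n) (≤-trans (*-monoʳ (0≤ι K) (β≤1 (suc n))) (≤-reflexive (*-identityʳ _)))) (partial-sums-bounded {C} ds n)))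

-- The sequence n³ aₙ⁴, and the passage to natural numbers

module Moment where

  open Rationals
  open Sequences
  open Constants
  open Limit
  open import Defs using (num; den; AsymptoticToC4nOverN34)
  open import Data.Nat.Base as ℕ using (ℕ; suc; z≤n; s≤s)
  import Data.Nat.Properties as ℕ
  import Data.Rational.Base as Raw
  import Data.Rational.Properties as Raw
  open import Data.Integer.Base using (+_)
  open import Data.Product using (_,_; ∃-syntax)
  open import Data.Sum using (inj₁; inj₂)
  open import Relation.Binary.PropositionalEquality
  open import Tactic.RingSolver using (solve-∀)

  -- Replacing one factor n of `α` by n + 1 makes the sequence decrease instead of increase. The two
  -- thus enclose a limit, and their distance is at most β.
  α γ : Seq
  α n = ι n * (ι n * ι n) * ((a n * a n) * (a n * a n))
  γ n = ι n * ι n * ι (suc n) * ((a n * a n) * (a n * a n))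

  -- The coefficients of (n + 1)² (n + 2)³ - (n + 3) (n + 5/4)⁴ as a polynomial in n, where degrees
  -- 4 and 5 cancel. Their signs prove that `γ` decreases.
  c₀ c₁ c₂ c₃ : ℚ
  c₀ = (+ 173) Raw./ 256
  c₁ = (+ 543) Raw./ 256
  c₂ = (+ 33) Raw./ 16
  c₃ = (+ 5) Raw./ 8

  0≤c₀ : 0ℚ ≤ c₀
  0≤c₀ = Raw.nonNegative⁻¹ c₀

  0≤c₁ : 0ℚ ≤ c₁
  0≤c₁ = Raw.nonNegative⁻¹ c₁

  0≤c₂ : 0ℚ ≤ c₂
  0≤c₂ = Raw.nonNegative⁻¹ c₂

  0≤c₃ : 0ℚ ≤ c₃
  0≤c₃ = Raw.nonNegative⁻¹ c₃

  private
    fourth : ℚ → ℚ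
    fourth x = (x * x) * (x * x)

    opaque
      unfolding _+_

      α-expand : ∀ T t i A → T * (T * T) * ((((t + ¼) * i * A) * ((t + ¼) * i * A)) * (((t + ¼) * i * A) * ((t + ¼) * i * A)))
               ≡ (T * i) * ((T * i) * (T * i)) * ((((t + ¼) * (t + ¼)) * ((t + ¼) * (t + ¼))) * (i * ((A * A) * (A * A))))
      α-expand = solve-∀ ℚ-ring

      α-poly : ∀ t → ((t + ¼) * (t + ¼)) * ((t + ¼) * (t + ¼)) ≡ (t * (t * t)) * (1ℚ + t) + (½ * (½ + ¼) * (t * t) + (¼ * ¼ * t + (¼ * ¼) * (¼ * ¼)))
      α-poly = solve-∀ ℚ-ring

      α-collect : ∀ T t i A → ((t * (t * t)) * T) * (i * A) ≡ (T * i) * ((t * (t * t)) * A)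
      α-collect = solve-∀ ℚ-ring

      γ-expand : ∀ T t i A → T * T * (1ℚ + T) * ((((t + ¼) * i * A) * ((t + ¼) * i * A)) * (((t + ¼) * i * A) * ((t + ¼) * i * A)))
               ≡ (T * i) * (T * i) * (((1ℚ + T) * (((t + ¼) * (t + ¼)) * ((t + ¼) * (t + ¼)))) * ((i * i) * ((A * A) * (A * A))))
      γ-expand = solve-∀ ℚ-ring

      γ-poly : ∀ n → ((1ℚ + n) * (1ℚ + n)) * ((1ℚ + (1ℚ + n)) * ((1ℚ + (1ℚ + n)) * (1ℚ + (1ℚ + n))))
               ≡ (1ℚ + (1ℚ + (1ℚ + n))) * ((((1ℚ + n) + ¼) * ((1ℚ + n) + ¼)) * (((1ℚ + n) + ¼) * ((1ℚ + n) + ¼)))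
                 + (c₀ + (c₁ * n + (c₂ * (n * n) + c₃ * (n * (n * n)))))
      γ-poly = solve-∀ ℚ-ring

      γ-collect : ∀ T t i A → ((t * t) * (T * (T * T))) * ((i * i) * A) ≡ (T * i) * (T * i) * (t * t * T * A)
      γ-collect = solve-∀ ℚ-ring

      γ-split : ∀ n A → n * n * (1ℚ + n) * (A * A) ≡ n * (n * n) * (A * A) + (n * A) * (n * A)
      γ-split = solve-∀ ℚ-ring

      α-split : ∀ n A → n * (n * n) * (A * A) ≡ n * ((n * A) * (n * A))
      α-split = solve-∀ ℚ-ring

      unit₃ : ∀ x → 1ℚ * (1ℚ * 1ℚ) * x ≡ x
      unit₃ = solve-∀ ℚ-ring

      unit₂ : ∀ x → 1ℚ * 1ℚ * x ≡ x
      unit₂ = solve-∀ ℚ-ring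

      bound-ring : ∀ p q b → p ≤ q + b → p - q ≤ b
      bound-ring p q b h = subst₂ _≤_ refl (cancel q b) (+-monoˡ-≤ (- q) h)
        where
        cancel : ∀ q b → (q + b) - q ≡ b
        cancel = solve-∀ ℚ-ring

      below-ring : (p q : ℚ) → p ≤ q → p - q ≤ 0ℚ
      below-ring p q h = subst (p - q ≤_) (+-inverseʳ q) (+-monoˡ-≤ (- q) h)

      one-times : ∀ x → x ≡ (1ℚ + 0ℚ) * x
      one-times = solve-∀ ℚ-ring

      α-base : 1ℚ * (1ℚ * 1ℚ) * fourth ((0ℚ + ¼) * 1ℚ * 1ℚ) ≡ fourth ¼
      α-base = refl

      plus-zero : 1ℚ + 0ℚ ≡ 1ℚ
      plus-zero = refl

  0≤fourth : ∀ x → 0ℚ ≤ fourth x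
  0≤fourth x = 0≤* (square-nonneg x) (square-nonneg x)

  α-increasing : ∀ n → α (suc n) ≤ α (suc (suc n))
  α-increasing n = subst₂ _≤_ left right (*-monoˡ {i * fourth A} (0≤* (0≤inv (suc n)) (0≤fourth A))
    (≤-by (0≤+ (0≤* (0≤* 0≤½ (0≤+ 0≤½ 0≤¼)) (square-nonneg t)) (0≤+ (0≤* (0≤* 0≤¼ 0≤¼) (0≤ι (suc n))) (0≤* (0≤* 0≤¼ 0≤¼) (0≤* 0≤¼ 0≤¼)))) (α-poly t)))
    where
    t i A : ℚ
    t = ι (suc n)
    i = inv (suc n)
    A = a (suc n)
    left : ((t * (t * t)) * (1ℚ + t)) * (i * fourth A) ≡ α (suc n)
    left = trans (α-collect (1ℚ + t) t i (fourth A)) (trans (cong (_* ((t * (t * t)) * fourth A)) (ι*inv (suc n))) (*-identityˡ _))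
    right : (((t + ¼) * (t + ¼)) * ((t + ¼) * (t + ¼))) * (i * fourth A) ≡ α (suc (suc n))
    right = sym (trans (α-expand (1ℚ + t) t i A) (trans (cong (λ z → z * (z * z) * (fourth (t + ¼) * (i * fourth A))) (ι*inv (suc n))) (unit₃ _)))

  γ-decreasing : ∀ n → γ (suc (suc n)) ≤ γ (suc n)
  γ-decreasing n = subst₂ _≤_ left right (*-monoˡ {(i * i) * fourth A} (0≤* (square-nonneg i) (0≤fourth A))
    (≤-by (0≤+ 0≤c₀ (0≤+ (0≤* 0≤c₁ (0≤ι n)) (0≤+ (0≤* 0≤c₂ (square-nonneg (ι n))) (0≤* 0≤c₃ (0≤* (0≤ι n) (square-nonneg (ι n))))))) (γ-poly (ι n))))
    where
    t i A : ℚ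
    t = ι (suc n)
    i = inv (suc n)
    A = a (suc n)
    left : ((1ℚ + (1ℚ + t)) * fourth (t + ¼)) * ((i * i) * fourth A) ≡ γ (suc (suc n))
    left = sym (trans (γ-expand (1ℚ + t) t i A) (trans (cong (λ z → z * z * (((1ℚ + (1ℚ + t)) * fourth (t + ¼)) * ((i * i) * fourth A))) (ι*inv (suc n))) (unit₂ _)))
    right : ((t * t) * ((1ℚ + t) * ((1ℚ + t) * (1ℚ + t)))) * ((i * i) * fourth A) ≡ γ (suc n)
    right = trans (γ-collect (1ℚ + t) t i (fourth A)) (trans (cong (λ z → z * z * (t * t * (1ℚ + t) * fourth A)) (ι*inv (suc n))) (unit₂ _))

  na²≤β : ∀ n → ι n * (a n * a n) ≤ β n
  na²≤β n = ≤-trans (*-monoˡ (square-nonneg (a n)) (ι-mono (ℕ.n≤1+n n))) (a²≤β n)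

  0≤na² : ∀ n → 0ℚ ≤ ι n * (a n * a n)
  0≤na² n = 0≤* (0≤ι n) (square-nonneg (a n))

  -- The difference is the square of n aₙ², which is at most β² and so at most β.
  γ-excess : ∀ n → γ n ≤ α n + β n
  γ-excess n = ≤-trans (≤-reflexive (γ-split (ι n) (a n * a n))) (+-monoʳ-≤ (α n)
    (≤-trans (*-mono (0≤na² n) (na²≤β n) (0≤na² n) (≤-trans (na²≤β n) (β≤1 n))) (≤-reflexive (*-identityʳ _))))

  α≤γ : ∀ n → α n ≤ γ n
  α≤γ n = ≤-by (square-nonneg _) (γ-split (ι n) (a n * a n))

  monotone : ∀ {s : Seq} → (∀ n → s n ≤ s (suc n)) → ∀ {m n} → m ℕ.≤ n → s m ≤ s n
  monotone {s} p {m} m≤n = go (ℕ.≤⇒≤′ m≤n)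
    where
    go : ∀ {n} → m ℕ.≤′ n → s m ≤ s n
    go ℕ.≤′-refl = ≤-refl
    go (ℕ.≤′-step h) = ≤-trans (go h) (p _)

  α-rate : Rate 1 α
  α-rate n m n≤m = ≤-trans (abs-≤
      (bound-ring (α (suc m)) (α (suc n)) (β (suc n)) (≤-trans (α≤γ (suc m)) (≤-trans (antitone {λ k → γ (suc k)} γ-decreasing n≤m) (γ-excess (suc n)))))
      (≤-trans (≤-reflexive (neg-sub (α (suc m)) (α (suc n)))) (≤-trans (below-ring _ _ (monotone {λ k → α (suc k)} α-increasing n≤m)) (0≤β (suc n)))))
    (≤-reflexive (one-times (β (suc n))))

  α-bounded : Bounded 1 α
  α-bounded n = ≤-trans (≤-reflexive (0≤p⇒∣p∣≡p (0≤* (0≤* (0≤ι m) (square-nonneg (ι m))) (0≤fourth (a m)))))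
    (≤-trans (≤-reflexive (α-split (ι m) (a m * a m)))
      (≤-trans (*-mono (0≤ι m) (ι-mono (ℕ.n≤1+n m)) (square-nonneg (ι m * (a m * a m))) (*-mono (0≤na² m) (na²≤β m) (0≤na² m) (na²≤β m)))
        (≤-trans (≤-reflexive (*-comm (ι (suc m)) (β m * β m))) (≤-trans (β²-bound m) (≤-reflexive (sym plus-zero))))))
    where
    m : ℕ
    m = suc n

  α-lower : ∀ n → fourth ¼ ≤ α (suc n)
  α-lower n = ≤-trans (≤-reflexive (sym (trans (cong₂ (λ y z → y * (y * y) * fourth ((0ℚ + ¼) * z * 1ℚ)) plus-zero inv-0) α-base)))
    (monotone {λ k → α (suc k)} α-increasing {0} {n} z≤n)

  ι-∸ : ∀ {m n} → m ℕ.≤ n → ι (n ℕ.∸ m) ≡ ι n - ι m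
  ι-∸ {m} {n} m≤n = trans (lemma (ι (n ℕ.∸ m)) (ι m)) (cong (_- ι m) (trans (sym (ι-+ (n ℕ.∸ m) m)) (cong ι (ℕ.m∸n+n≡m m≤n))))
    where
    opaque
      unfolding _+_
      lemma : ∀ x y → x ≡ (x + y) - y
      lemma = solve-∀ ℚ-ring

  ι-distance : ∀ m n → ι ℕ.∣ m - n ∣ ≡ ∣ ι m - ι n ∣
  ι-distance m n with ℕ.≤-total m n
  ... | inj₁ m≤n = trans (cong ι (ℕ.m≤n⇒∣m-n∣≡n∸m m≤n)) (trans (ι-∸ m≤n)
          (trans (sym (0≤p⇒∣p∣≡p (0≤-difference (ι-mono m≤n)))) (∣p-q∣-sym (ι n) (ι m))))
  ... | inj₂ n≤m = trans (cong ι (ℕ.m≤n⇒∣n-m∣≡n∸m n≤m)) (trans (ι-∸ n≤m) (sym (0≤p⇒∣p∣≡p (0≤-difference (ι-mono n≤m)))))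

  -- `β²-bound` says that β is below n^(-1/2), so an index beyond (L + 1)² suffices; with L = (k +
  -- 1) C this is the `M k` below.
  β-small : ∀ L n → suc L ℕ.* suc L ℕ.≤ n → ι L * β (suc n) < 1ℚ
  β-small L n h = <-≤-trans (subst₂ _<_ (+-identityˡ _) (sym (suc-*′ (ι L) b)) (+-monoˡ-< (ι L * b) (0<β (suc n))))
    (≤-of-squares 0≤1 (≤-trans (≤-trans (≤-reflexive (trans (regroup (ι (suc L)) b) (cong (b * b *_) (sym (ι-* (suc L) (suc L))))))
        (*-monoʳ (square-nonneg b) (ι-mono (ℕ.≤-trans h (ℕ.≤-trans (ℕ.n≤1+n n) (ℕ.n≤1+n (suc n)))))))
      (≤-trans (β²-bound (suc n)) (≤-reflexive (sym (*-identityˡ 1ℚ))))))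
    where
    b : ℚ
    b = β (suc n)
    opaque
      unfolding _+_
      suc-*′ : ∀ l b → (1ℚ + l) * b ≡ b + l * b
      suc-*′ = solve-∀ ℚ-ring
      regroup : ∀ l b → (l * b) * (l * b) ≡ b * b * (l * l)
      regroup = solve-∀ ℚ-ring

  0<den : ∀ n → 0ℚ < ι (den n)
  0<den n = ι-mono-< (ℕ.m^n>0 4 (4 ℕ.* n))

  conclude : ∀ {G x C} → Rate C x → (∀ n → ι (num G (suc n)) ≡ ι (den (suc n)) * x (suc n)) →
    (K N₀ : ℕ) → (∀ n → N₀ ℕ.≤ n → 1ℚ ≤ ι (suc K) * x (suc n)) → AsymptoticToC4nOverN34 G
  conclude {G} {x} {C} rate value K N₀ lower = cauchy , K , suc N₀ , λ
    { (suc n) (s≤s h) → ι-cancel-≤ (subst₂ _≤_ (*-identityʳ _)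
        (trans (regroup₁ (ι (den (suc n))) (ι (suc K)) (x (suc n))) (trans (cong (ι (suc K) *_) (sym (value n))) (sym (ι-* (suc K) (num G (suc n))))))
        (*-monoʳ (<⇒≤ (0<den (suc n))) (lower n h))) }
    where
    opaque
      unfolding _+_
      regroup₁ : ∀ d k x → d * (k * x) ≡ k * (d * x)
      regroup₁ = solve-∀ ℚ-ring
      regroup₂ : ∀ d e x y → (d * x) * e - (e * y) * d ≡ (d * e) * (x - y)
      regroup₂ = solve-∀ ℚ-ring
    M : ℕ → ℕ
    M k = suc (suc k ℕ.* C) ℕ.* suc (suc k ℕ.* C)
    small : ∀ k n m → M k ℕ.≤ n → n ℕ.≤ m → ι (suc k) * ∣ x (suc m) - x (suc n) ∣ < 1ℚ
    small k n m h n≤m = ≤-<-trans (*-monoʳ (0≤ι (suc k)) (rate n m n≤m))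
      (subst (_< 1ℚ) (trans (cong (_* β (suc n)) (ι-* (suc k) C)) (*-assoc _ _ _)) (β-small (suc k ℕ.* C) n h))
    small′ : ∀ k m n → M k ℕ.≤ m → M k ℕ.≤ n → ι (suc k) * ∣ x (suc m) - x (suc n) ∣ < 1ℚ
    small′ k m n hm hn with ℕ.≤-total n m
    ... | inj₁ n≤m = small k n m hn n≤m
    ... | inj₂ m≤n = subst (λ z → ι (suc k) * z < 1ℚ) (∣p-q∣-sym (x (suc n)) (x (suc m))) (small k m n hm m≤n)
    cauchy : ∀ k → ∃[ N ] ∀ m n → N ℕ.≤ m → N ℕ.≤ n → suc k ℕ.* ℕ.∣ num G m ℕ.* den n - num G n ℕ.* den m ∣ ℕ.< den m ℕ.* den n
    cauchy k = suc (M k) , λ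
      { (suc m) (suc n) (s≤s hm) (s≤s hn) → ι-cancel-< (subst₂ _<_ (left m n) (right m n)
        (*-monoʳ-< (0<* (0<den (suc m)) (0<den (suc n))) (small′ k m n hm hn))) }
      where
      right : ∀ m n → (ι (den (suc m)) * ι (den (suc n))) * 1ℚ ≡ ι (den (suc m) ℕ.* den (suc n))
      right m n = trans (*-identityʳ _) (sym (ι-* (den (suc m)) (den (suc n))))
      left : ∀ m n → (ι (den (suc m)) * ι (den (suc n))) * (ι (suc k) * ∣ x (suc m) - x (suc n) ∣)
           ≡ ι (suc k ℕ.* ℕ.∣ num G (suc m) ℕ.* den (suc n) - num G (suc n) ℕ.* den (suc m) ∣)
      left m n = sym (begin
        ι (suc k ℕ.* ℕ.∣ num G (suc m) ℕ.* den (suc n) - num G (suc n) ℕ.* den (suc m) ∣)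
          ≡⟨ trans (ι-* (suc k) ℕ.∣ A - B ∣) (cong (ι (suc k) *_) (ι-distance A B)) ⟩
        ι (suc k) * ∣ ι (num G (suc m) ℕ.* den (suc n)) - ι (num G (suc n) ℕ.* den (suc m)) ∣
          ≡⟨ cong₂ (λ u v → ι (suc k) * ∣ u - v ∣)
               (trans (ι-* (num G (suc m)) (den (suc n))) (cong (_* ι (den (suc n))) (value m)))
               (trans (ι-* (num G (suc n)) (den (suc m))) (cong (_* ι (den (suc m))) (value n))) ⟩
        ι (suc k) * ∣ (d * x (suc m)) * e - (e * x (suc n)) * d ∣
          ≡⟨ cong (λ z → ι (suc k) * ∣ z ∣) (regroup₂ d e (x (suc m)) (x (suc n))) ⟩
        ι (suc k) * ∣ (d * e) * (x (suc m) - x (suc n)) ∣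
          ≡⟨ cong (ι (suc k) *_) (trans (∣p*q∣≡∣p∣*∣q∣ _ _) (cong (_* ∣ x (suc m) - x (suc n) ∣) (0≤p⇒∣p∣≡p (<⇒≤ (0<* (0<den (suc m)) (0<den (suc n))))))) ⟩
        ι (suc k) * ((d * e) * ∣ x (suc m) - x (suc n) ∣)
          ≡⟨ regroup₁ (ι (suc k)) (d * e) _ ⟩
        (d * e) * (ι (suc k) * ∣ x (suc m) - x (suc n) ∣) ∎)
        where
        open ≡-Reasoning
        d e : ℚ
        d = ι (den (suc m))
        e = ι (den (suc n))
        A B : ℕ
        A = num G (suc m) ℕ.* den (suc n)
        B = num G (suc n) ℕ.* den (suc m)

-- Square roots of the series E and of the signed bridges

module SquareRoot where

  open Rationals
  open Sequences
  open Constants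
  open Signed using (double; ¼^; signedBridges; signedBridges-double; signedBridges-suc-double)
  open import Data.Nat.Base as ℕ using (ℕ; zero; suc; z≤n; s≤s)
  import Data.Nat.Properties as ℕ
  import Data.Integer.Base as ℤ
  open import Data.Product using (_×_; _,_; proj₁; proj₂; ∃-syntax)
  open import Data.Sum using (_⊎_; inj₁; inj₂)
  open import Relation.Binary.PropositionalEquality
  open import Tactic.RingSolver using (solve-∀)

  private
    opaque
      unfolding _+_

      ring₁ : ∀ u v n → (u + v) ≡ n → (u + (v + v)) + u ≡ 2ℚ * n
      ring₁ u v _ refl = lemma u v
        where
        lemma : ∀ u v → (u + (v + v)) + u ≡ 2ℚ * (u + v)
        lemma = solve-∀ ℚ-ring

      ring₂ : ∀ x → x + x ≡ 2ℚ * x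
      ring₂ = solve-∀ ℚ-ring

      ring₄ : ∀ n q → 2ℚ * (n * q) ≡ (2ℚ * n) * q
      ring₄ = solve-∀ ℚ-ring

      ring₅ : ∀ x y → 0ℚ * x + y ≡ y
      ring₅ = solve-∀ ℚ-ring

      ring₆ : ∀ m i x → m * (i * x) ≡ (m * i) * x
      ring₆ = solve-∀ ℚ-ring

      ring₇ : ∀ f d → (¼ * (f + d)) + (¼ * (f + d)) ≡ ½ * f + ¼ * (d + d)
      ring₇ = solve-∀ ℚ-ring

      ring₈ : ∀ m q b → (1ℚ + (1ℚ + (m + m))) * ((¼ * q) * b) ≡ ½ * q * ((1ℚ + m) * b)
      ring₈ = solve-∀ ℚ-ring

      ring₉ : ∀ m q b → ½ * q * (m * b + ½ * b) ≡ ½ * (½ * (q * b)) + ¼ * ((m + m) * (q * b))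
      ring₉ = solve-∀ ℚ-ring

      ring₁₀ : ∀ m q b → (1ℚ + (1ℚ + (1ℚ + (m + m)))) * (½ * ((¼ * q) * b)) ≡ ½ * ((¼ * q) * b) + ¼ * q * ((1ℚ + m) * b)
      ring₁₀ = solve-∀ ℚ-ring

      ring₁₁ : ∀ m q b c → ½ * c + ¼ * q * (m * b + ½ * b) ≡ ½ * c + ¼ * ((1ℚ + (m + m)) * (½ * (q * b)))
      ring₁₁ = solve-∀ ℚ-ring

      ring₁₂ : ∀ m → 1ℚ + (1ℚ + (m + m)) ≡ (1ℚ + m) + (1ℚ + m)
      ring₁₂ = solve-∀ ℚ-ring

      ring₁₃ : ∀ x → (1ℚ + 0ℚ) * x ≡ x
      ring₁₃ = solve-∀ ℚ-ring

      ring₁₄ : ∀ x → (½ + 0ℚ) * x ≡ ¼ * x + (¼ * (0ℚ * 1ℚ) + ¼ * x)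
      ring₁₄ = solve-∀ ℚ-ring

      ring₁₅ : ∀ n x → ¼ * x + (¼ + n) * x ≡ (½ + n) * x
      ring₁₅ = solve-∀ ℚ-ring

      ring₁₆ : ∀ t c x → t * (c * x) ≡ c * (t * x)
      ring₁₆ = solve-∀ ℚ-ring

      gap : ∀ m x → (¼ + (1ℚ + m)) * ((½ + m) * x) ≡ (1ℚ + (1ℚ + m)) * (¼ * ((1ℚ + m) * x)) + ((½ + ¼) * (m * m) + (m + ½ * ¼)) * x
      gap = solve-∀ ℚ-ring

      η-first : (1ℚ + 0ℚ) * ¼ ≡ ¼ * (1ℚ + 0ℚ)
      η-first = refl

      ψ-first : ½ * 1ℚ ≡ ¼ + ¼
      ψ-first = refl

      η-zero : 0ℚ * 1ℚ ≡ ¼ * (0ℚ + 0ℚ)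
      η-zero = refl

  -- If e = 1 / (1 - i) with i ≥ 0, then 2 q′ (1 - i) = i′ q for q = √e, which is a recurrence for q with nonnegative terms.
  module NonnegativeRoot {e i q : Seq} (i₀ : i 0 ≡ 0ℚ) (0≤i : ∀ n → 0ℚ ≤ i n) (renewal : e ≈ δ ⊕ i ⋆ e)
    (q₀ : q 0 ≡ 1ℚ) (q² : q ⋆ q ≈ e) where

    D-e : D e ≈ D i ⋆ e ⊕ i ⋆ D e
    D-e zero = trans (*-zeroˡ _) (sym (trans (cong₂ (λ x y → (0ℚ * x) * e 0 + y * (0ℚ * e 0)) i₀ i₀) zeros))
      where
      opaque
        unfolding _+_
        zeros : (0ℚ * 0ℚ) * e 0 + 0ℚ * (0ℚ * e 0) ≡ 0ℚ
        zeros = lemma (e 0)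
          where
          lemma : ∀ x → (0ℚ * 0ℚ) * x + 0ℚ * (0ℚ * x) ≡ 0ℚ
          lemma = solve-∀ ℚ-ring
    D-e (suc n) = trans (cong (ι (suc n) *_) (trans (renewal (suc n)) (+-identityˡ _))) (D-⋆ i e (suc n))

    -- 2 q q′ = e′ = i′ q² + 2 i q q′, and one factor q cancels.
    D-q : D q ⊕ D q ≈ D i ⋆ q ⊕ (i ⋆ D q ⊕ i ⋆ D q)
    D-q = ⋆-cancelˡ q (subst (0ℚ <_) (sym q₀) 0<1) λ n → begin
      (q ⋆ (D q ⊕ D q)) n ≡⟨ solve 2 (λ q d → q :* (d :+ d) := d :* q :+ q :* d) (λ _ → refl) q (D q) n ⟩
      (D q ⋆ q ⊕ q ⋆ D q) n ≡⟨ D-⋆ q q n ⟨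
      D (q ⋆ q) n ≡⟨ trans (cong (ι n *_) (q² n)) (D-e n) ⟩
      (D i ⋆ e ⊕ i ⋆ D e) n
        ≡⟨ cong₂ _+_ (⋆-cong {D i} (λ _ → refl) (≈-sym q²) n)
             (⋆-cong {i} (λ _ → refl) (λ k → trans (cong (ι k *_) (sym (q² k))) (D-⋆ q q k)) n) ⟩
      (D i ⋆ (q ⋆ q) ⊕ i ⋆ (D q ⋆ q ⊕ q ⋆ D q)) n
        ≡⟨ solve 4 (λ Di q i d → Di :* (q :* q) :+ i :* (d :* q :+ q :* d) := q :* (Di :* q :+ (i :* d :+ i :* d))) (λ _ → refl) (D i) q i (D q) n ⟩
      (q ⋆ (D i ⋆ q ⊕ (i ⋆ D q ⊕ i ⋆ D q))) n ∎
      where open ≡-Reasoning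

    private
      twice : ∀ n → (2ℚ * ι (suc n)) * q (suc n) ≡ (D i ⋆ q) (suc n) + ((i ⋆ D q) (suc n) + (i ⋆ D q) (suc n))
      twice n = trans (sym (ring₄ (ι (suc n)) (q (suc n)))) (trans (sym (ring₂ _)) (D-q (suc n)))

      upper : ∀ n → (2ℚ * ι (suc n)) * q (suc n) + (D i ⋆ q) (suc n) ≡ (2ℚ * ι (suc n)) * (i ⋆ q) (suc n)
      upper n = trans (cong (λ z → z + (D i ⋆ q) (suc n)) (twice n))
        (trans (ring₁ _ _ _ (sym (D-⋆ i q (suc n)))) (ring₄ (ι (suc n)) _))

      skip : ∀ f n → (i ⋆ f) (suc n) ≡ (tail i ⋆ f) n
      skip f n = trans (cong (λ z → z * f (suc n) + (tail i ⋆ f) n) i₀) (ring₅ _ _)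

      -- As i starts with 0, the recurrence involves earlier values of q, and 0 ≤ q follows
      -- inductively. Adding i′ q to it gives 2 x (i q)′, so each qₙ is at most (i q)ₙ, which the
      -- second induction hypothesis bounds by (i e)ₙ = eₙ.
      below : ∀ n k → k ℕ.≤ n → 0ℚ ≤ q k × q k ≤ e k
      below zero zero z≤n = subst (0ℚ ≤_) (sym q₀) 0≤1 , ≤-reflexive (trans q₀ (sym (trans (sym (q² 0)) (trans (cong₂ _*_ q₀ q₀) (*-identityˡ 1ℚ)))))
      below (suc n) k k≤ with ℕ.m≤n⇒m<n∨m≡n k≤
      ... | inj₁ (s≤s k≤n) = below n k k≤n
      ... | inj₂ refl = *-cancel-≤ 0<2n (subst₂ _≤_ (sym (*-zeroʳ _)) (sym (twice n)) (0≤+ 0≤Diq (0≤+ 0≤iDq 0≤iDq)))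
                      , ≤-trans (*-cancel-≤ 0<2n (≤-by 0≤Diq (sym (upper n)))) i⋆q≤e
        where
        0<2n : 0ℚ < 2ℚ * ι (suc n)
        0<2n = 0<* (<-≤-trans 0<1 (≤-by 0≤1 refl)) (0<ι n)
        0≤q : ∀ k → k ℕ.≤ n → 0ℚ ≤ q k
        0≤q k h = proj₁ (below n k h)
        0≤Diq : 0ℚ ≤ (D i ⋆ q) (suc n)
        0≤Diq = subst (0ℚ ≤_) (sym (trans (cong (λ z → z * q (suc n) + (tail (D i) ⋆ q) n) (*-zeroˡ (i 0))) (ring₅ _ _)))
          (⋆-nonneg n (λ k _ → 0≤* (0≤ι (suc k)) (0≤i (suc k))) 0≤q)
        0≤iDq : 0ℚ ≤ (i ⋆ D q) (suc n)
        0≤iDq = subst (0ℚ ≤_) (sym (skip (D q) n)) (⋆-nonneg n (λ k _ → 0≤i (suc k)) (λ k h → 0≤* (0≤ι k) (0≤q k h)))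
        i⋆q≤e : (i ⋆ q) (suc n) ≤ e (suc n)
        i⋆q≤e = subst₂ _≤_ (sym (skip q n)) (sym (trans (renewal (suc n)) (trans (+-identityˡ _) (skip e n))))
          (⋆-monoʳ n (λ k _ → 0≤i (suc k)) (λ k h → proj₂ (below n k h)))

    0≤q : ∀ n → 0ℚ ≤ q n
    0≤q n = proj₁ (below n n ℕ.≤-refl)

    q≤e : ∀ n → q n ≤ e n
    q≤e n = proj₂ (below n n ℕ.≤-refl)

  signed : Seq
  signed n = signedBridges n (ℤ.+ 0)

  -- The generating function (1 + x/2)^(1/4) (1 - x/2)^(-1/4), a square root of that of `signed`.
  η : Seq
  η zero = 1ℚ
  η (suc zero) = ¼
  η (suc (suc n)) = inv (suc n) * (¼ * η (suc n) + ¼ * (ι n * η n))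

  η-recurrence : ∀ n → ι (suc (suc n)) * η (suc (suc n)) ≡ ¼ * η (suc n) + ¼ * (ι n * η n)
  η-recurrence n = trans (ring₆ _ _ _) (trans (cong (_* (¼ * η (suc n) + ¼ * (ι n * η n))) (ι*inv (suc n))) (*-identityˡ _))

  -- This is (1 - x²/4) η′ = η/4, obtained from the logarithmic derivative of ((1 + x/2) / (1 -
  -- x/2))^(1/4).
  D-η : D η ≈ ¼ · (X η ⊕ X (X (D η)))
  D-η zero = η-zero
  D-η (suc zero) = η-first
  D-η (suc (suc n)) = trans (η-recurrence n) (sym (distribˡ ¼ _ _))

  D-η⋆η : ∀ n → (D η ⋆ η) n ≡ ¼ * (X (η ⋆ η) n + X (X (D η ⋆ η)) n)
  D-η⋆η n = trans (⋆-cong D-η (λ _ → refl) n) (trans (·-⋆ ¼ (X η ⊕ X (X (D η))) η n) (cong (¼ *_)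
    (trans (⋆-distribʳ η (X η) (X (X (D η))) n) (cong₂ _+_ (X-⋆ η η n) (trans (X-⋆ (X (D η)) η n) (X-cong (X-⋆ (D η) η) n))))))
    where
    X-cong : ∀ {f g} → f ≈ g → X f ≈ X g
    X-cong p zero = refl
    X-cong p (suc n) = p n

  D-square : ∀ n → ι n * (η ⋆ η) n ≡ (D η ⋆ η) n + (D η ⋆ η) n
  D-square n = trans (D-⋆ η η n) (cong (λ z → (D η ⋆ η) n + z) (⋆-comm η (D η) n))

  square-recurrence : ∀ n → ι (suc (suc n)) * (η ⋆ η) (suc (suc n)) ≡ ½ * (η ⋆ η) (suc n) + ¼ * (ι n * (η ⋆ η) n)
  square-recurrence n = trans (D-square (suc (suc n))) (trans (cong (λ z → z + z) (D-η⋆η (suc (suc n))))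
    (trans (ring₇ _ _) (cong (λ z → ½ * (η ⋆ η) (suc n) + ¼ * z) (sym (D-square n)))))

  ι-double : ∀ m → ι (double m) ≡ ι m + ι m
  ι-double zero = sym (+-identityʳ 0ℚ)
  ι-double (suc m) = trans (cong (λ z → 1ℚ + (1ℚ + z)) (ι-double m)) (ring₁₂ (ι m))

  parity : ∀ n → (∃[ m ] n ≡ double m) ⊎ (∃[ m ] n ≡ suc (double m))
  parity zero = inj₁ (0 , refl)
  parity (suc n) with parity n
  ... | inj₁ (m , refl) = inj₂ (m , refl)
  ... | inj₂ (m , refl) = inj₁ (suc m , refl)

  signed-recurrence : ∀ n → ι (suc (suc n)) * signed (suc (suc n)) ≡ ½ * signed (suc n) + ¼ * (ι n * signed n)
  signed-recurrence n with parity n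
  ... | inj₁ (m , refl) rewrite signedBridges-suc-double m | signedBridges-double (suc m) | signedBridges-double m | ι-double m =
    trans (ring₈ (ι m) (¼^ m) (β (suc m))) (trans (cong (½ * ¼^ m *_) (binomial-step ½ m)) (ring₉ (ι m) (¼^ m) (β m)))
  ... | inj₂ (m , refl) rewrite signedBridges-suc-double (suc m) | signedBridges-suc-double m | signedBridges-double (suc m) | signedBridges-double m | ι-double m =
    trans (ring₁₀ (ι m) (¼^ m) (β (suc m))) (trans (cong (λ z → ½ * ((¼ * ¼^ m) * β (suc m)) + ¼ * ¼^ m * z) (binomial-step ½ m))
      (ring₁₁ (ι m) (¼^ m) (β m) _))

  -- Both sequences satisfy the same second-order recurrence and agree at 0 and 1. The explicit
  -- values of `signed` alternate by parity, hence the case split behind `signed-recurrence`.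
  η² : η ⋆ η ≈ signed
  η² n = proj₁ (both n)
    where
    both : ∀ n → (η ⋆ η) n ≡ signed n × (η ⋆ η) (suc n) ≡ signed (suc n)
    both zero = refl , trans (sym (ring₁₃ _)) (trans (D-square 1) (trans (cong (λ z → z + z) (D-η⋆η 1))
      (trans first (sym (signedBridges-suc-double 0)))))
      where
      opaque
        unfolding _+_
        first : ¼ * (1ℚ * 1ℚ + 0ℚ) + ¼ * (1ℚ * 1ℚ + 0ℚ) ≡ ½ * (1ℚ * 1ℚ)
        first = refl
    both (suc n) with both n
    ... | p , r = r , *-cancel (0<ι (suc n)) (trans (square-recurrence n)
      (trans (cong₂ (λ x y → ½ * x + ¼ * (ι n * y)) r p) (sym (signed-recurrence n))))

  0≤η : ∀ n → 0ℚ ≤ η n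
  0≤η zero = 0≤1
  0≤η (suc zero) = 0≤¼
  0≤η (suc (suc n)) = 0≤* (0≤inv (suc n)) (0≤+ (0≤* 0≤¼ (0≤η (suc n))) (0≤* 0≤¼ (0≤* (0≤ι n) (0≤η n))))

  -- The series η has radius of convergence 2, so this is far from sharp, but it makes η a summable
  -- factor with constant 1.
  η≤ψ : ∀ n → η n ≤ ψ n
  η≤ψ zero = ≤-reflexive (sym ψ-0)
  η≤ψ (suc zero) = subst (¼ ≤_) (sym (trans ψ-1 (cong (½ *_) inv-0))) (≤-by 0≤¼ ψ-first)
  η≤ψ (suc (suc n)) = subst (η (suc (suc n)) ≤_) (sym (trans (ψ-step n) (regroup (½ + ι n) (inv (suc n)) (ψ (suc n)))))
    (*-monoʳ (0≤inv (suc n)) (bound n (η≤ψ (suc n)) (η≤ψ n)))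
    where
    opaque
      unfolding _+_
      regroup : ∀ x i y → (x * i) * y ≡ i * (x * y)
      regroup = solve-∀ ℚ-ring
    bound : ∀ n → η (suc n) ≤ ψ (suc n) → η n ≤ ψ n → ¼ * η (suc n) + ¼ * (ι n * η n) ≤ (½ + ι n) * ψ (suc n)
    bound zero h _ = ≤-trans (+-monoˡ-≤ (¼ * (0ℚ * 1ℚ)) (*-monoʳ 0≤¼ h)) (≤-by (0≤* 0≤¼ (0≤ψ 1)) (trans (ring₁₄ (ψ 1)) (sym (+-assoc _ _ _))))
    bound (suc m) h h′ = ≤-trans (+-mono-≤ (*-monoʳ 0≤¼ h) (≤-trans (*-monoʳ 0≤¼ (*-monoʳ (0≤ι (suc m)) h′))
        (*-cancel-≤ (0<ι (suc m)) (≤-trans (≤-by (0≤* (0≤+ (0≤* (0≤+ 0≤½ 0≤¼) (square-nonneg (ι m))) (0≤+ (0≤ι m) (0≤* 0≤½ 0≤¼))) (0≤ψ (suc m))) (gap (ι m) (ψ (suc m))))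
          (≤-reflexive (trans (cong ((¼ + ι (suc m)) *_) (sym (ψ-recurrence m))) (ring₁₆ _ _ _)))))))
      (≤-reflexive (ring₁₅ (ι (suc m)) (ψ (suc (suc m)))))

-- The asymptotics of the even-area walks

module Assemble where

  open Rationals
  open Sequences
  open Words
  open Walks
  open Reversal
  open Weighted
  open Bridges
  open Signed
  open Excursions
  open Constants
  open Limit
  open Moment
  open SquareRoot
  open import Defs using (num; den; AsymptoticToC4nOverN34)
  open import Data.Nat.Base as ℕ using (ℕ; zero; suc; z≤n; s≤s)
  import Data.Nat.Properties as ℕ
  open import Data.Integer.Base as ℤ using (+_)
  open import Data.Bool.Base using (Bool; true; false; _∧_; not)
  open import Data.List.Base using ([]; _∷_)
  open import Relation.Binary.PropositionalEquality
  open import Tactic.RingSolver using (solve-∀)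

  private
    module S = Weight sign refl sign-+ sign-neg
    module T = Weight (λ _ → 1ℚ) refl (λ _ _ → sym (*-identityˡ 1ℚ)) (λ _ → refl)

  private
    opaque
      unfolding _+_

      ring₂ : ∀ n p → (2ℚ * 4ℚ) * ((1ℚ + 2ℚ * n) * p) + (2ℚ * 4ℚ) * p ≡ (1ℚ + n) * (ι 16 * p)
      ring₂ = solve-∀ ℚ-ring

      ring₄ : ∀ c p d → d ≡ c + p → - c + d ≡ p
      ring₄ c p _ refl = lemma c p
        where
        lemma : ∀ c p → - c + (c + p) ≡ p
        lemma = solve-∀ ℚ-ring

      ring₆ : ι 16 * 1ℚ ≡ 1ℚ + (ι 16 - 1ℚ)
      ring₆ = refl

      one-one : 1ℚ ≡ 0ℚ + (1ℚ + 0ℚ) * 1ℚ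
      one-one = refl

      0≤15 : 0ℚ ≤ ι 16 - 1ℚ
      0≤15 = 0≤-difference {1ℚ} {ι 16} (ι-mono {1} {16} (s≤s z≤n))

  -- `q` is √E, introduced as h (1 - x)^(1/4) and shown to have square e. `r` belongs to the walks
  -- whose last letter does not descend, so r = h (1 - p) = a q (1 - p). A superscript minus marks
  -- the signed version.
  h e i p q c s r p⁻ h⁻ r⁻ : Seq
  h = means (H false)
  e = means (Eₛ false)
  i = means (I false)
  p = means (P false)
  c = binomial (- ½)
  q = h ⋆ binomial (- ¼)
  s = q ⋆ (δ ⊕ (⊖ p))
  r = a ⋆ s
  h⁻ = S.weighted (H false)
  p⁻ = S.weighted (P false)
  r⁻ = h⁻ ⊕ (⊖ (h⁻ ⋆ p⁻))

  unweighted : ∀ f → T.weighted f ≈ means f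
  unweighted f n = E-cong n λ w → *-identityʳ (f w)

  h² : h ⋆ h ≈ β ⋆ e
  h² n = trans (⋆-cong (λ k → sym (unweighted (H false) k)) (λ k → sym (unweighted (H false) k)) n)
    (trans (T.H-squared n) (⋆-cong {b = e} (λ k → trans (unweighted (H true) k) (H-true-binomial k)) (λ _ → refl) n))

  means-empty : means (λ w → ⟦ isEmpty w ⟧) ≈ δ
  means-empty zero = refl
  means-empty (suc n) = E-const (suc n) 0ℚ

  e-renewal : e ≈ δ ⊕ i ⋆ e
  e-renewal n = trans (E-cong n E-renewal) (trans (E-+ n _ _) (cong₂ _+_ (means-empty n) (E-⊛ (I false) (Eₛ false) n)))

  0≤i : ∀ n → 0ℚ ≤ i n
  0≤i n = E-nonneg n λ w → ⟦⟧-nonneg (firstTie′ (+ 0) (+ 0) w)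

  -- For n ≥ 1: n eₙ ≤ 8 βₙ₊₁ ≤ 8 βₙ = 8 (2n - 1) ψₙ ≤ 16 n ψₙ.
  e≤ψ : ∀ n → e n ≤ ι 16 * ψ n
  e≤ψ zero = subst (λ z → 1ℚ ≤ ι 16 * z) (sym ψ-0) (≤-by 0≤15 ring₆)
  e≤ψ (suc n) = *-cancel-≤ (0<ι n) (≤-trans (excursion-bound (suc n))
    (≤-trans (*-monoʳ (0≤* 0≤2 0≤4) (≤-trans (β-antitone (ℕ.n≤1+n (suc n))) (≤-reflexive (β-from-ψ n))))
      (≤-by (0≤* (0≤* 0≤2 0≤4) (0≤ψ (suc n))) (sym (ring₂ (ι n) (ψ (suc n)))))))

  q² : q ⋆ q ≈ e
  q² n = begin
    ((h ⋆ b) ⋆ (h ⋆ b)) n ≡⟨ ⋆-swap-middle h b h b n ⟩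
    ((h ⋆ h) ⋆ (b ⋆ b)) n ≡⟨ ⋆-cong h² binomial-¼-squared n ⟩
    ((β ⋆ e) ⋆ c) n       ≡⟨ solve 3 (λ β e c → (β :* e) :* c := (β :* c) :* e) (λ _ → refl) β e c n ⟩
    ((β ⋆ c) ⋆ e) n       ≡⟨ ⋆-cong {b = e} β-inverse (λ _ → refl) n ⟩
    (δ ⋆ e) n             ≡⟨ ⋆-identityˡ e n ⟩
    e n                   ∎
    where
    open ≡-Reasoning
    b : Seq
    b = binomial (- ¼)

  q₀ : q 0 ≡ 1ℚ
  q₀ = *-identityˡ 1ℚ

  open NonnegativeRoot {e} {i} {q} refl 0≤i e-renewal q₀ q²

  nonneg-dominated : ∀ {C s} → (∀ n → 0ℚ ≤ s n) → (∀ n → s n ≤ ι C * ψ n) → Dominated C s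
  nonneg-dominated {C} {s} 0≤s s≤ n = subst (_≤ ι C * ψ n) (sym (0≤p⇒∣p∣≡p (0≤s n))) (s≤ n)

  q-dominated : Dominated 16 q
  q-dominated = nonneg-dominated {16} {q} 0≤q λ n → ≤-trans (q≤e n) (e≤ψ n)

  h-factors : h ≈ a ⋆ q
  h-factors n = sym (trans (solve 3 (λ a h b → a :* (h :* b) := (a :* b) :* h) (λ _ → refl) a h (binomial (- ¼)) n)
    (trans (⋆-cong {b = h} a-inverse (λ _ → refl) n) (⋆-identityˡ h n)))

  P-constant : ∀ w → P true w ≡ P false w
  P-constant [] = refl
  P-constant (l ∷ w) = refl

  HD-true : means (HD true) ≈ β ⋆ p
  HD-true n = trans (sym (unweighted (HD true) n)) (trans (T.weighted-HD true n)
    (⋆-cong (λ k → trans (unweighted (H true) k) (H-true-binomial k))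
            (λ k → trans (unweighted (P true) k) (E-cong k P-constant)) n))

  β-last-block : β ≈ δ ⊕ (β ⋆ p ⊕ β ⋆ p)
  β-last-block zero = sym (trans (cong (λ z → 1ℚ + (z + z)) (*-zeroʳ 1ℚ)) (trans (cong (λ z → 1ℚ + z) (+-identityʳ 0ℚ)) (+-identityʳ 1ℚ)))
  β-last-block (suc n) = trans (sym (H-true-binomial (suc n))) (trans (sym (HD-half n))
    (trans (cong₂ _+_ (HD-true (suc n)) (HD-true (suc n))) (sym (+-identityˡ _))))

  -- Half of the nonempty bridges end by descending, and these are a bridge followed by a block: β =
  -- 1 + 2 β p. Hence p = (1 - (1 - x)^(1/2)) / 2, known without counting the blocks.
  p-doubled : δ ≈ c ⊕ (p ⊕ p)
  p-doubled n = begin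
    δ n ≡⟨ trans (⋆-comm c β n) (β-inverse n) ⟨
    (c ⋆ β) n ≡⟨ ⋆-cong {c} (λ _ → refl) β-last-block n ⟩
    (c ⋆ (δ ⊕ (β ⋆ p ⊕ β ⋆ p))) n
      ≡⟨ solve 4 (λ c d β p → c :* (d :+ (β :* p :+ β :* p)) := d :* c :+ ((β :* c) :* p :+ (β :* c) :* p)) (λ _ → refl) c δ β p n ⟩
    (δ ⋆ c) n + (((β ⋆ c) ⋆ p) n + ((β ⋆ c) ⋆ p) n)
      ≡⟨ cong₂ (λ x y → x + (y + y)) (⋆-identityˡ c n) (trans (⋆-cong {b = p} β-inverse (λ _ → refl) n) (⋆-identityˡ p n)) ⟩
    c n + (p n + p n) ∎
    where open ≡-Reasoning

  P-nonneg : ∀ w → 0ℚ ≤ P false w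
  P-nonneg [] = ≤-refl
  P-nonneg (l ∷ w) = ⟦⟧-nonneg (primitive′ (step l (+ 0)) (descends l) w)

  0≤p : ∀ n → 0ℚ ≤ p n
  0≤p n = E-nonneg n P-nonneg

  p≤ψ : ∀ n → p n ≤ ι 1 * ψ n
  p≤ψ zero = 0≤* (0≤ι 1) (0≤ψ 0)
  p≤ψ (suc n) = ≤-trans (≤-by (0≤p (suc n)) (trans (ψ-suc n)
    (trans (sym (+-identityʳ _)) (ring₄ (c (suc n)) _ 0ℚ (p-doubled (suc n)))))) (≤-reflexive (one-times (ψ (suc n))))
    where
    opaque
      unfolding _+_
      one-times : ∀ x → x ≡ (1ℚ + 0ℚ) * x
      one-times = solve-∀ ℚ-ring

  δ-dominated : Dominated 1 δ
  δ-dominated zero = ≤-reflexive (trans (0≤p⇒∣p∣≡p 0≤1) (trans (trans one-one (+-identityˡ _)) (cong (ι 1 *_) (sym ψ-0))))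
  δ-dominated (suc n) = ≤-trans (≤-reflexive (0≤p⇒∣p∣≡p ≤-refl)) (0≤* (0≤ι 1) (0≤ψ (suc n)))

  d-dominated : Dominated 2 (δ ⊕ (⊖ p))
  d-dominated = dominated-⊕ {1} {1} {δ} {⊖ p} δ-dominated (dominated-⊖ {1} {p} (nonneg-dominated {1} {p} 0≤p p≤ψ))

  s-dominated : Dominated 128 s
  s-dominated = dominated-⋆ {16} {2} {q} {δ ⊕ (⊖ p)} q-dominated d-dominated

  r-value : r ≈ h ⊕ (⊖ means (HD false))
  r-value n = begin
    (a ⋆ (q ⋆ (δ ⊕ (⊖ p)))) n ≡⟨ ⋆-assoc a q (δ ⊕ (⊖ p)) n ⟨
    ((a ⋆ q) ⋆ (δ ⊕ (⊖ p))) n ≡⟨ ⋆-cong {b = δ ⊕ (⊖ p)} (≈-sym h-factors) (λ _ → refl) n ⟩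
    (h ⋆ (δ ⊕ (⊖ p))) n       ≡⟨ times-difference h p n ⟩
    h n + - (h ⋆ p) n         ≡⟨ cong (λ z → h n + - z) (sym hd) ⟩
    h n + - means (HD false) n ∎
    where
    open ≡-Reasoning
    times-difference : ∀ h p → h ⋆ (δ ⊕ (⊖ p)) ≈ h ⊕ (⊖ (h ⋆ p))
    times-difference h p k = trans (⋆-comm h (δ ⊕ (⊖ p)) k) (trans (⋆-distribʳ h δ (⊖ p) k)
      (cong₂ _+_ (⋆-identityˡ h k) (trans (sym (-‿distribˡ-* p h k)) (cong -_ (⋆-comm p h k)))))
    hd : means (HD false) n ≡ (h ⋆ p) n
    hd = trans (sym (unweighted (HD false) n)) (trans (T.weighted-HD false n) (⋆-cong (unweighted (H false)) (unweighted (P false)) n))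

  signed-H-true : S.weighted (H true) ≈ signed
  signed-H-true n = E-cong n λ w → cong (λ z → ⟦ z ⟧ * sign (area (+ 0) w)) (nonneg-true (+ 0) (+ 0) w)

  -- The signed form of H² = B E reads (h⁻)² = η² q², and roots with constant term 1 are unique.
  -- Both factors are summable, so the signed count is negligible against a.
  h⁻-factors : h⁻ ≈ η ⋆ q
  h⁻-factors = ⋆-sqrt-unique (*-identityˡ 1ℚ) (trans (cong (1ℚ *_) q₀) (*-identityˡ 1ℚ)) λ n → begin
    (h⁻ ⋆ h⁻) n                ≡⟨ S.H-squared n ⟩
    (S.weighted (H true) ⋆ e) n ≡⟨ ⋆-cong (λ k → trans (signed-H-true k) (sym (η² k))) (≈-sym q²) n ⟩
    ((η ⋆ η) ⋆ (q ⋆ q)) n      ≡⟨ ⋆-swap-middle η η q q n ⟩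
    ((η ⋆ q) ⋆ (η ⋆ q)) n      ∎
    where open ≡-Reasoning

  h⁻-dominated : Dominated 64 h⁻
  h⁻-dominated = dominated-cong {64} {η ⋆ q} (≈-sym h⁻-factors) (dominated-⋆ {1} {16} {η} {q}
    (nonneg-dominated {1} {η} 0≤η λ n → ≤-trans (η≤ψ n) (≤-reflexive (one-times (ψ n)))) q-dominated)
    where
    opaque
      unfolding _+_
      one-times : ∀ x → x ≡ (1ℚ + 0ℚ) * x
      one-times = solve-∀ ℚ-ring

  p⁻-dominated : Dominated 1 p⁻
  p⁻-dominated n = ≤-trans (E-abs n λ w → ≤-trans (≤-reflexive (∣p*q∣≡∣p∣*∣q∣ (P false w) _))
    (≤-trans (*-mono (0≤∣p∣ _) (≤-reflexive (0≤p⇒∣p∣≡p (P-nonneg w))) (0≤∣p∣ _) (sign-abs (area (+ 0) w))) (≤-reflexive (*-identityʳ _)))) (p≤ψ n)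

  r⁻-dominated : Dominated (64 ℕ.+ 256) r⁻
  r⁻-dominated = dominated-⊕ {64} {256} {h⁻} {⊖ (h⁻ ⋆ p⁻)} h⁻-dominated
    (dominated-⊖ {256} {h⁻ ⋆ p⁻} (dominated-⋆ {64} {1} {h⁻} {p⁻} h⁻-dominated p⁻-dominated))

  r⁻-value : r⁻ ≈ h⁻ ⊕ (⊖ S.weighted (HD false))
  r⁻-value n = cong (λ z → h⁻ n + - z) (sym (S.weighted-HD false n))

  ends : Word → Bool
  ends w = nonneg (+ 0) (+ 0) false w ∧ not (endsDescending false w)

  -- (1 + sign) / 2 is the indicator of even area; its mean is half the sum of the plain and the
  -- signed count.
  evenly : Word → ℚ
  evenly w = ½ * (⟦ ends w ⟧ + ⟦ ends w ⟧ * sign (area (+ 0) w))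

  ends-value : ∀ w → ⟦ ends w ⟧ ≡ H false w + - HD false w
  ends-value w rewrite nonnegDesc-∧ (+ 0) (+ 0) false false w with nonneg (+ 0) (+ 0) false w | endsDescending false w
  ... | true | true = sym (+-inverseʳ 1ℚ)
  ... | true | false = one-minus
    where
    opaque
      unfolding _+_
      one-minus : 1ℚ ≡ 1ℚ + - 0ℚ
      one-minus = refl
  ... | false | _ = zero-minus
    where
    opaque
      unfolding _+_
      zero-minus : 0ℚ ≡ 0ℚ + - 0ℚ
      zero-minus = refl

  means-evenly : ∀ n → means evenly n ≡ ½ * (r n + r⁻ n)
  means-evenly n = trans (E-* n ½ _) (cong (½ *_) (trans (E-+ n _ _) (cong₂ _+_
    (trans (E-cong n ends-value) (trans (trans (E-+ n _ _) (cong (λ z → h n + z) (E-neg n _))) (sym (r-value n))))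
    (trans (E-cong n λ w → trans (cong (_* sign (area (+ 0) w)) (ends-value w)) (expand (H false w) (HD false w) (sign (area (+ 0) w))))
      (trans (trans (E-+ n _ _) (cong (λ z → h⁻ n + z) (E-neg n _))) (sym (r⁻-value n)))))))
    where
    opaque
      unfolding _+_
      expand : ∀ x y z → (x + - y) * z ≡ x * z + - (y * z)
      expand = solve-∀ ℚ-ring

  open Quotient {128} {64 ℕ.+ 256} {s} {r⁻} s-dominated r⁻-dominated

  1s⋆c : 1s ⋆ c ≈ β
  1s⋆c n = trans (⋆-cong {b = c} (≈-sym binomial-1) (λ _ → refl) n) (trans (binomial-⋆ 1ℚ (- ½) n) (cong (λ z → binomial z n) 1-½′))
    where
    opaque
      unfolding _+_
      1-½′ : 1ℚ + - ½ ≡ ½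
      1-½′ = refl

  tail-mass : Seq
  tail-mass = 1s ⋆ (δ ⊕ (⊖ p))

  -- Partial sums of the identity δ = c + 2p read 1 = β + 2 (sum of p), so p has mass at most 1/2.
  tail-mass≥½ : ∀ n → ½ ≤ tail-mass n
  tail-mass≥½ n = ≤-by (0≤* 0≤½ (0≤β n)) (solve-half _ (1s ⋆ p) mass-value balance)
    where
    mass-value : tail-mass n ≡ 1ℚ + - (1s ⋆ p) n
    mass-value = trans (⋆-comm 1s (δ ⊕ (⊖ p)) n) (trans (⋆-distribʳ 1s δ (⊖ p) n)
      (cong₂ _+_ (⋆-identityˡ 1s n) (trans (sym (-‿distribˡ-* p 1s n)) (cong -_ (⋆-comm p 1s n)))))
    balance : 1ℚ ≡ β n + ((1s ⋆ p) n + (1s ⋆ p) n)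
    balance = begin
      1ℚ ≡⟨ ⋆-identityˡ 1s n ⟨
      (δ ⋆ 1s) n ≡⟨ ⋆-cong {b = 1s} p-doubled (λ _ → refl) n ⟩
      ((c ⊕ (p ⊕ p)) ⋆ 1s) n ≡⟨ solve 3 (λ c p o → (c :+ (p :+ p)) :* o := o :* c :+ (o :* p :+ o :* p)) (λ _ → refl) c p 1s n ⟩
      (1s ⋆ c) n + ((1s ⋆ p) n + (1s ⋆ p) n) ≡⟨ cong (_+ ((1s ⋆ p) n + (1s ⋆ p) n)) (1s⋆c n) ⟩
      β n + ((1s ⋆ p) n + (1s ⋆ p) n) ∎
      where open ≡-Reasoning
    opaque
      unfolding _+_
      solve-half : ∀ t (u : Seq) → t ≡ 1ℚ + - u n → 1ℚ ≡ β n + (u n + u n) → t ≡ ½ + ½ * β n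
      solve-half _ u refl b = trans (lemma₁ (u n)) (trans (cong (λ z → ½ + (½ * z + - u n)) b) (lemma₂ (u n) (β n)))
        where
        lemma₁ : ∀ u → 1ℚ + - u ≡ ½ + (½ * 1ℚ + - u)
        lemma₁ = solve-∀ ℚ-ring
        lemma₂ : ∀ u b → ½ + (½ * (b + (u + u)) + - u) ≡ ½ + ½ * b
        lemma₂ = solve-∀ ℚ-ring

  -- The term with `q 0` = 1 alone contributes at least 1/2, and the others are nonnegative. This is
  -- where c > 0 comes from.
  σ≥½ : ∀ n → ½ ≤ σ (suc n)
  σ≥½ n = ≤-trans (tail-mass≥½ (suc n)) (≤-trans
    (≤-by (⋆-nonneg n (λ k _ → 0≤q (suc k)) (λ k _ → ≤-trans 0≤½ (tail-mass≥½ k)))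
      (cong (_+ (tail q ⋆ tail-mass) n) (trans (cong (_* tail-mass (suc n)) q₀) (*-identityˡ _))))
    (≤-reflexive (sym (trans (solve 3 (λ o q d → o :* (q :* d) := q :* (o :* d)) (λ _ → refl) 1s q (δ ⊕ (⊖ p)) (suc n)) refl))))

  -- u is the count divided by 4ⁿ aₙ, so x is exactly the ratio G⁴ n³ / 4^(4n) of the statement.
  u x : Seq
  u = ½ · g
  x = ((u ∙ u) ∙ (u ∙ u)) ∙ α

  B R : ℕ
  B = K ℕ.+ 128 ℕ.* 2
  R = K ℕ.+ (128 ℕ.+ K)

  u-bounded : Bounded B u
  u-bounded = bounded-½ {B} {g} g-bounded

  u-rate : Rate R u
  u-rate = rate-½ {R} {g} g-rate

  R² B² R⁴ : ℕ
  R² = B ℕ.* R ℕ.+ B ℕ.* R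
  B² = B ℕ.* B
  R⁴ = B² ℕ.* R² ℕ.+ B² ℕ.* R²

  u²-rate : Rate R² (u ∙ u)
  u²-rate = rate-∙ {B} {R} {B} {R} {u} {u} u-bounded u-rate u-bounded u-rate

  u²-bounded : Bounded B² (u ∙ u)
  u²-bounded = bounded-∙ {B} {B} {u} {u} u-bounded u-bounded

  x-rate : Rate (B² ℕ.* B² ℕ.* 1 ℕ.+ 1 ℕ.* R⁴) x
  x-rate = rate-∙ {B² ℕ.* B²} {R⁴} {1} {1} {(u ∙ u) ∙ (u ∙ u)} {α}
    (bounded-∙ {B²} {B²} {u ∙ u} {u ∙ u} u²-bounded u²-bounded)
    (rate-∙ {B²} {R²} {B²} {R²} {u ∙ u} {u ∙ u} u²-bounded u²-rate u²-bounded u²-rate) α-bounded α-rate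

  u*a : ∀ n → u n * a n ≡ means evenly n
  u*a n = trans (*-assoc ½ (g n) (a n)) (trans (cong (½ *_) (g*a n)) (sym (means-evenly n)))

  x-value : ∀ {G} n → ι (G n) ≡ ι (4 ℕ.^ n) * means evenly n → ι (num G n) ≡ ι (den n) * x n
  x-value {G} n count = begin
    ι (G n ℕ.^ 4 ℕ.* n ℕ.^ 3) ≡⟨ trans (ι-* (G n ℕ.^ 4) (n ℕ.^ 3)) (cong₂ _*_ (ι-^4 (G n)) (ι-^3 n)) ⟩
    fourth (ι (G n)) * (ι n * (ι n * ι n)) ≡⟨ cong (λ z → fourth z * (ι n * (ι n * ι n))) (trans count (cong (F *_) (sym (u*a n)))) ⟩
    fourth (F * (u n * a n)) * (ι n * (ι n * ι n)) ≡⟨ rearrange F (u n) (a n) (ι n) ⟩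
    fourth F * x n ≡⟨ cong (_* x n) (sym (trans (cong ι den-power) (ι-^4 (4 ℕ.^ n)))) ⟩
    ι (den n) * x n ∎
    where
    open ≡-Reasoning
    fourth : ℚ → ℚ
    fourth z = (z * z) * (z * z)
    F : ℚ
    F = ι (4 ℕ.^ n)
    den-power : den n ≡ (4 ℕ.^ n) ℕ.^ 4
    den-power = trans (cong (4 ℕ.^_) (ℕ.*-comm 4 n)) (sym (ℕ.^-*-assoc 4 n 4))
    opaque
      unfolding _+_
      rearrange : ∀ F u a m → ((F * (u * a)) * (F * (u * a))) * ((F * (u * a)) * (F * (u * a))) * (m * (m * m))
        ≡ ((F * F) * (F * F)) * (((u * u) * (u * u)) * (m * (m * m) * ((a * a) * (a * a))))
      rearrange = solve-∀ ℚ-ring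
      power₄ : ∀ z → z * (z * (z * (z * (1ℚ + 0ℚ)))) ≡ (z * z) * (z * z)
      power₄ = solve-∀ ℚ-ring
      power₃ : ∀ z → z * (z * (z * (1ℚ + 0ℚ))) ≡ z * (z * z)
      power₃ = solve-∀ ℚ-ring
    ι-^-suc : ∀ m k → ι (m ℕ.^ suc k) ≡ ι m * ι (m ℕ.^ k)
    ι-^-suc m k = ι-* m (m ℕ.^ k)
    ι-^3 : ∀ m → ι (m ℕ.^ 3) ≡ ι m * (ι m * ι m)
    ι-^3 m = trans (trans (ι-^-suc m 2) (cong (ι m *_) (trans (ι-^-suc m 1) (cong (ι m *_) (ι-^-suc m 0))))) (power₃ (ι m))
    ι-^4 : ∀ m → ι (m ℕ.^ 4) ≡ fourth (ι m)
    ι-^4 m = trans (trans (ι-^-suc m 3) (cong (ι m *_) (trans (ι-^-suc m 2) (cong (ι m *_) (trans (ι-^-suc m 1) (cong (ι m *_) (ι-^-suc m 0))))))) (power₄ (ι m))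

  ⅛ : ℚ
  ⅛ = ½ * ¼

  0≤⅛ : 0ℚ ≤ ⅛
  0≤⅛ = 0≤* 0≤½ 0≤¼

  threshold : ℕ
  threshold = suc (4 ℕ.* K) ℕ.* suc (4 ℕ.* K)

  -- Beyond `threshold` the error K β is below 1/4, so g ≥ 1/2 - 1/4, and u is half of g.
  u≥⅛ : ∀ n → threshold ℕ.≤ n → ⅛ ≤ u (suc n)
  u≥⅛ n h = *-monoʳ 0≤½ (combine (g (suc n)) (σ (suc n)) (ι K * β (suc n)) (g-near-σ n)
    (σ≥½ n) (subst (_< 1ℚ) (trans (cong (_* β (suc n)) (ι-* 4 K)) (*-assoc (ι 4) (ι K) (β (suc n)))) (β-small (4 ℕ.* K) n h)))
    where
    opaque
      unfolding _+_
      combine : ∀ g s k → ∣ g - s ∣ ≤ k → ½ ≤ s → ι 4 * k < 1ℚ → ¼ ≤ g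
      combine g s k near s≥½ k<¼ = ≤-trans (≤-reflexive quarter) (≤-trans
        (+-mono-≤ s≥½ (≤-trans (neg-antimono-≤ k≤¼) (≤-trans (neg-antimono-≤ near) (-abs≤ (g - s))))) (≤-reflexive (back g s)))
        where
        quarter : ¼ ≡ ½ + - ¼
        quarter = refl
        back : ∀ g s → s + (g - s) ≡ g
        back = solve-∀ ℚ-ring
        k≤¼ : k ≤ ¼
        k≤¼ = *-cancel-≤ (0<ι 3) (<⇒≤ k<¼)

  opaque
    -- 32 = 8 · 4, from u ≥ 1/8 and α ≥ (1/4)⁴. It is kept opaque so that `ι` never counts it out in
    -- unary.
    margin : ℕ
    margin = 32 ℕ.* 32 ℕ.* (32 ℕ.* 32)

    margin-value : ι margin ≡ (ι 32 * ι 32) * (ι 32 * ι 32)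
    margin-value = power 32
      where
      power : ∀ k → ι (k ℕ.* k ℕ.* (k ℕ.* k)) ≡ (ι k * ι k) * (ι k * ι k)
      power k = trans (ι-* (k ℕ.* k) (k ℕ.* k)) (cong₂ _*_ (ι-* k k) (ι-* k k))

  opaque
    unfolding _+_

    margin-unit : ((ι 32 * ι 32) * (ι 32 * ι 32)) * (((⅛ * ⅛) * (⅛ * ⅛)) * ((¼ * ¼) * (¼ * ¼))) ≡ 1ℚ
    margin-unit = refl

  x-lower : ∀ n → threshold ℕ.≤ n → 1ℚ ≤ ι (suc margin) * x (suc n)
  x-lower n h = ≤-trans (≤-reflexive (sym (trans (cong (_* bound) margin-value) margin-unit)))
    (*-mono (0≤ι margin) (ι-mono (ℕ.n≤1+n margin)) (0≤* (0≤* 0≤⅛² 0≤⅛²) (0≤* (0≤* 0≤¼ 0≤¼) (0≤* 0≤¼ 0≤¼)))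
      (*-mono (0≤* 0≤⅛² 0≤⅛²) (*-mono 0≤⅛² u² 0≤⅛² u²) (0≤* (0≤* 0≤¼ 0≤¼) (0≤* 0≤¼ 0≤¼)) (α-lower n)))
    where
    bound : ℚ
    bound = ((⅛ * ⅛) * (⅛ * ⅛)) * ((¼ * ¼) * (¼ * ¼))
    0≤⅛² : 0ℚ ≤ ⅛ * ⅛
    0≤⅛² = 0≤* 0≤⅛ 0≤⅛
    u² : ⅛ * ⅛ ≤ u (suc n) * u (suc n)
    u² = *-mono 0≤⅛ (u≥⅛ n h) 0≤⅛ (u≥⅛ n h)

  asymptotic : ∀ G → (∀ n → ι (G (suc n)) ≡ ι (4 ℕ.^ suc n) * means evenly (suc n)) → AsymptoticToC4nOverN34 G
  asymptotic G count = conclude {G} {x} {B² ℕ.* B² ℕ.* 1 ℕ.+ 1 ℕ.* R⁴} x-rate (λ n → x-value {G} (suc n) (count n)) margin threshold x-lower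

-- Graphs, degree sums and changes of edges

module Graphs where

  open import Data.Nat.Base
  open import Data.Nat.Properties
  open import Data.Nat.Tactic.RingSolver using (solve-∀)
  open import Data.Bool.Base using (Bool; true; false; _∧_; _∨_; if_then_else_)
  open import Data.Bool.Properties using (∨-comm; ∧-comm)
  open import Data.Product using (∃-syntax; _×_; _,_)
  open import Data.Sum using (_⊎_; inj₁; inj₂)
  open import Data.Empty using (⊥-elim)
  open import Relation.Binary.PropositionalEquality
  open import Relation.Nullary using (yes; no)

  ∑ : ℕ → (ℕ → ℕ) → ℕ
  ∑ zero f = 0
  ∑ (suc n) f = f 0 + ∑ n (λ i → f (suc i))

  ∑-cong : ∀ n {f g} → (∀ i → i < n → f i ≡ g i) → ∑ n f ≡ ∑ n g
  ∑-cong zero p = refl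
  ∑-cong (suc n) p = cong₂ _+_ (p 0 z<s) (∑-cong n λ i i<n → p (suc i) (s<s i<n))

  ∑-mono : ∀ n {f g} → (∀ i → i < n → f i ≤ g i) → ∑ n f ≤ ∑ n g
  ∑-mono zero p = z≤n
  ∑-mono (suc n) p = +-mono-≤ (p 0 z<s) (∑-mono n λ i i<n → p (suc i) (s<s i<n))

  ∑-zero : ∀ n → ∑ n (λ _ → 0) ≡ 0
  ∑-zero zero = refl
  ∑-zero (suc n) = ∑-zero n

  ∑-const : ∀ n c → ∑ n (λ _ → c) ≡ n * c
  ∑-const zero c = refl
  ∑-const (suc n) c = cong (c +_) (∑-const n c)

  ∑-+ : ∀ n f g → ∑ n (λ i → f i + g i) ≡ ∑ n f + ∑ n g
  ∑-+ zero f g = refl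
  ∑-+ (suc n) f g = trans (cong (f 0 + g 0 +_) (∑-+ n _ _)) (lemma (f 0) (g 0) _ _)
    where
    lemma : ∀ a b c d → a + b + (c + d) ≡ a + c + (b + d)
    lemma = solve-∀

  ∑-split : ∀ m n f → ∑ (m + n) f ≡ ∑ m f + ∑ n (λ i → f (m + i))
  ∑-split zero n f = refl
  ∑-split (suc m) n f = trans (cong (f 0 +_) (∑-split m n _)) (sym (+-assoc (f 0) _ _))

  ∑-swap : ∀ m n (f : ℕ → ℕ → ℕ) → ∑ m (λ i → ∑ n (f i)) ≡ ∑ n (λ j → ∑ m (λ i → f i j))
  ∑-swap zero n f = sym (∑-zero n)
  ∑-swap (suc m) n f = trans (cong (∑ n (f 0) +_) (∑-swap m n _)) (sym (∑-+ n (f 0) _))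

  ∑-last : ∀ n f → ∑ (suc n) f ≡ ∑ n f + f n
  ∑-last zero f = +-identityʳ _
  ∑-last (suc n) f = trans (cong (f 0 +_) (∑-last n _)) (sym (+-assoc (f 0) _ _))

  ∑-change : ∀ n {f g} k → k < n → (∀ i → i ≢ k → f i ≡ g i) → ∑ n f + g k ≡ ∑ n g + f k
  ∑-change (suc n) {f} {g} zero _ p = trans (cong (λ z → f 0 + z + g 0) (∑-cong n λ i _ → p (suc i) λ ())) (lemma (f 0) (g 0) _)
    where
    lemma : ∀ a b c → a + c + b ≡ b + c + a
    lemma = solve-∀
  ∑-change (suc n) {f} {g} (suc k) (s<s k<n) p = trans (+-assoc (f 0) _ _) (trans
    (cong₂ _+_ (p 0 λ ()) (∑-change n k k<n λ i i≢k → p (suc i) λ e → i≢k (suc-injective e))) (sym (+-assoc (g 0) _ _)))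

  bit : Bool → ℕ
  bit true = 1
  bit false = 0

  bit≤1 : ∀ b → bit b ≤ 1
  bit≤1 true = ≤-refl
  bit≤1 false = z≤n

  ∑-witness : ∀ n (f g : ℕ → Bool) → ∑ n (λ i → bit (g i)) < ∑ n (λ i → bit (f i)) → ∃[ k ] k < n × f k ≡ true × g k ≡ false
  ∑-witness (suc n) f g lt with f 0 in f0 | g 0 in g0
  ... | true | false = 0 , z<s , f0 , g0
  ... | true | true with ∑-witness n _ _ (s<s⁻¹ lt)
  ...   | k , k<n , p , q = suc k , s<s k<n , p , q
  ∑-witness (suc n) f g lt | false | false with ∑-witness n _ _ lt
  ...   | k , k<n , p , q = suc k , s<s k<n , p , q
  ∑-witness (suc n) f g lt | false | true with ∑-witness n (λ i → f (suc i)) (λ i → g (suc i)) (<-trans (n<1+n _) lt)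
  ...   | k , k<n , p , q = suc k , s<s k<n , p , q

  ∑-bits : ∀ n (f : ℕ → Bool) i → i < n → f i ≡ false → ∑ n (λ j → bit (f j)) ≤ n ∸ 1
  ∑-bits (suc n) f zero _ p = subst (λ b → bit b + ∑ n (λ j → bit (f (suc j))) ≤ n) (sym p)
    (≤-trans (∑-mono n λ j _ → bit≤1 (f (suc j))) (≤-reflexive (trans (∑-const n 1) (*-identityʳ n))))
  ∑-bits (suc (suc n)) f (suc i) (s<s i<n) p = +-mono-≤ (bit≤1 (f 0)) (∑-bits (suc n) (λ j → f (suc j)) i i<n p)

  -- Vertices are all natural numbers, and a degree counts neighbours below n. Vertices can then be
  -- appended or shifted without changing types.
  record Graph : Set where
    constructor graph
    field
      edge : ℕ → ℕ → Bool
      symmetric : ∀ i j → edge i j ≡ edge j i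
      loopless : ∀ i → edge i i ≡ false
  open Graph public

  deg : ℕ → Graph → ℕ → ℕ
  deg n g i = ∑ n λ j → bit (edge g i j)

  Realizes : ℕ → Graph → (ℕ → ℕ) → Set
  Realizes n g d = ∀ i → i < n → deg n g i ≡ d i

  Realizable : ℕ → (ℕ → ℕ) → Set
  Realizable n d = ∃[ g ] Realizes n g d

  -- Remove vertex 0: its edges are counted once in its own row and once in its column.
  handshake : ∀ n g → ∃[ k ] ∑ n (deg n g) ≡ k + k
  handshake zero g = 0 , refl
  handshake (suc n) g with handshake n (graph (λ i j → edge g (suc i) (suc j)) (λ i j → symmetric g (suc i) (suc j)) (λ i → loopless g (suc i)))
  ... | k , e = r + k , (begin
      (bit (edge g 0 0) + r) + ∑ n (λ i → bit (edge g (suc i) 0) + inner i)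
        ≡⟨ cong₂ (λ b s → (bit b + r) + s) (loopless g 0) (∑-+ n (λ i → bit (edge g (suc i) 0)) inner) ⟩
      r + (∑ n (λ i → bit (edge g (suc i) 0)) + ∑ n inner)
        ≡⟨ cong₂ (λ a b → r + (a + b)) (∑-cong n λ i _ → cong bit (symmetric g (suc i) 0)) e ⟩
      r + (r + (k + k)) ≡⟨ lemma r k ⟩
      (r + k) + (r + k) ∎)
    where
    open ≡-Reasoning
    r : ℕ
    r = ∑ n λ j → bit (edge g 0 (suc j))
    inner : ℕ → ℕ
    inner i = ∑ n λ j → bit (edge g (suc i) (suc j))
    lemma : ∀ r k → r + (r + (k + k)) ≡ (r + k) + (r + k)
    lemma = solve-∀

  -- The necessary condition of Erdős and Gallai, for k vertices of high degree and ℓ vertices of low degree.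
  degree-sum-bound : ∀ k μ ℓ d → Realizable (k + μ + ℓ) d → ∑ k d ≤ k * (k + μ ∸ 1) + ∑ ℓ (λ j → d (k + μ + j))
  degree-sum-bound k μ ℓ d (g , real) = begin
    ∑ k d ≡⟨ ∑-cong k (λ i i<k → trans (sym (real i (<-≤-trans i<k k≤n))) (∑-split (k + μ) ℓ _)) ⟩
    ∑ k (λ i → near i + ∑ ℓ (λ j → bit (edge g i (k + μ + j)))) ≡⟨ ∑-+ k near _ ⟩
    ∑ k near + ∑ k (λ i → ∑ ℓ (λ j → bit (edge g i (k + μ + j))))
      ≤⟨ +-mono-≤ (≤-trans (∑-mono k λ i i<k → ∑-bits (k + μ) (edge g i) i (<-≤-trans i<k (m≤m+n k μ)) (loopless g i)) (≤-reflexive (∑-const k _)))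
           (≤-reflexive (∑-swap k ℓ _)) ⟩
    k * (k + μ ∸ 1) + ∑ ℓ (λ j → ∑ k (λ i → bit (edge g i (k + μ + j))))
      ≤⟨ +-monoʳ-≤ (k * (k + μ ∸ 1)) (∑-mono ℓ far) ⟩
    k * (k + μ ∸ 1) + ∑ ℓ (λ j → d (k + μ + j)) ∎
    where
    open ≤-Reasoning
    near : ℕ → ℕ
    near i = ∑ (k + μ) λ j → bit (edge g i j)
    k≤n : k ≤ k + μ + ℓ
    k≤n = ≤-trans (m≤m+n k μ) (m≤m+n (k + μ) ℓ)
    far : ∀ j → j < ℓ → ∑ k (λ i → bit (edge g i (k + μ + j))) ≤ d (k + μ + j)
    far j j<ℓ = ≤-trans (≤-reflexive (∑-cong k λ i _ → cong bit (symmetric g i (k + μ + j))))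
      (≤-trans (≤-trans (m≤m+n _ _) (≤-reflexive (sym (trans (cong (λ m → ∑ m λ i → bit (edge g (k + μ + j) i)) (+-assoc k μ ℓ)) (∑-split k (μ + ℓ) _)))))
        (≤-reflexive (real (k + μ + j) (+-monoʳ-< (k + μ) j<ℓ))))

  -- The given graph may have edges at n or beyond, invisible to degrees counted below n; `in-range`
  -- deletes them before n becomes a vertex.
  isolated : ∀ {n d d′} → Realizable n d → (∀ i → i < n → d′ i ≡ d i) → d′ n ≡ 0 → Realizable (suc n) d′
  isolated {n} {d} {d′} (g , real) same zero-at-n = g′ , λ i i≤n → trans (∑-last n _) (row i (m≤n⇒m<n∨m≡n (s≤s⁻¹ i≤n)))
    where
    in-range : ℕ → ℕ → Bool
    in-range i j = (i <ᵇ n) ∧ (j <ᵇ n)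
    g′ : Graph
    g′ = graph (λ i j → in-range i j ∧ edge g i j)
      (λ i j → cong₂ _∧_ (∧-comm (i <ᵇ n) (j <ᵇ n)) (symmetric g i j))
      (λ i → trans (cong (in-range i i ∧_) (loopless g i)) (∧-comm (in-range i i) false))
    <ᵇ-true : ∀ {i n} → i < n → (i <ᵇ n) ≡ true
    <ᵇ-true {zero} {suc n} _ = refl
    <ᵇ-true {suc i} {suc n} (s<s h) = <ᵇ-true h
    <ᵇ-refl : ∀ n → (n <ᵇ n) ≡ false
    <ᵇ-refl zero = refl
    <ᵇ-refl (suc n) = <ᵇ-refl n
    last : ∀ i → edge g′ i n ≡ false
    last i = trans (cong (λ b → ((i <ᵇ n) ∧ b) ∧ edge g i n) (<ᵇ-refl n)) (cong (_∧ edge g i n) (∧-comm (i <ᵇ n) false))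
    row : ∀ i → i < n ⊎ i ≡ n → ∑ n (λ j → bit (edge g′ i j)) + bit (edge g′ i n) ≡ d′ i
    row i (inj₁ i<n) = trans (cong₂ _+_ (trans (∑-cong n λ j j<n → cong₂ (λ a b → bit ((a ∧ b) ∧ edge g i j)) (<ᵇ-true i<n) (<ᵇ-true j<n)) (real i i<n))
      (cong bit (last i))) (trans (+-identityʳ _) (sym (same i i<n)))
    row i (inj₂ refl) = trans (cong₂ _+_ (trans (∑-cong n λ j _ → cong (λ a → bit ((a ∧ (j <ᵇ n)) ∧ edge g n j)) (<ᵇ-refl n)) (∑-zero n))
      (cong bit (last n))) (sym zero-at-n)

  dominating : ∀ {n d d′} → Realizable n d → d′ 0 ≡ n → (∀ i → i < n → d′ (suc i) ≡ suc (d i)) → Realizable (suc n) d′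
  dominating {n} {d} {d′} (g , real) full shifted = graph e e-sym e-irr , λ where
      zero _ → trans (∑-const n 1) (trans (*-identityʳ n) (sym full))
      (suc i) (s<s i<n) → trans (cong suc (real i i<n)) (sym (shifted i i<n))
    where
    e : ℕ → ℕ → Bool
    e zero zero = false
    e zero (suc j) = true
    e (suc i) zero = true
    e (suc i) (suc j) = edge g i j
    e-sym : ∀ i j → e i j ≡ e j i
    e-sym zero zero = refl
    e-sym zero (suc j) = refl
    e-sym (suc i) zero = refl
    e-sym (suc i) (suc j) = symmetric g i j
    e-irr : ∀ i → e i i ≡ false
    e-irr zero = refl
    e-irr (suc i) = loopless g i

  joins : ℕ → ℕ → ℕ → ℕ → Bool
  joins i k a b = ((a ≡ᵇ i) ∧ (b ≡ᵇ k)) ∨ ((a ≡ᵇ k) ∧ (b ≡ᵇ i))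

  ≡ᵇ-refl : ∀ i → (i ≡ᵇ i) ≡ true
  ≡ᵇ-refl zero = refl
  ≡ᵇ-refl (suc i) = ≡ᵇ-refl i

  ≡ᵇ-≢ : ∀ {i j} → i ≢ j → (i ≡ᵇ j) ≡ false
  ≡ᵇ-≢ {zero} {zero} h = ⊥-elim (h refl)
  ≡ᵇ-≢ {zero} {suc j} h = refl
  ≡ᵇ-≢ {suc i} {zero} h = refl
  ≡ᵇ-≢ {suc i} {suc j} h = ≡ᵇ-≢ λ e → h (cong suc e)

  joins-self : ∀ i k → joins i k i k ≡ true
  joins-self i k = cong (_∨ ((i ≡ᵇ k) ∧ (k ≡ᵇ i))) (cong₂ _∧_ (≡ᵇ-refl i) (≡ᵇ-refl k))

  joins-comm : ∀ i k a b → joins i k a b ≡ joins i k b a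
  joins-comm i k a b = trans (∨-comm ((a ≡ᵇ i) ∧ (b ≡ᵇ k)) _) (cong₂ _∨_ (∧-comm (a ≡ᵇ k) _) (∧-comm (a ≡ᵇ i) _))

  joins-other : ∀ i k a b → a ≢ i → a ≢ k → joins i k a b ≡ false
  joins-other i k a b p q rewrite ≡ᵇ-≢ p | ≡ᵇ-≢ q = refl

  joins-other′ : ∀ i k b → i ≢ k → b ≢ k → joins i k i b ≡ false
  joins-other′ i k b p q rewrite ≡ᵇ-≢ p | ≡ᵇ-≢ q | ≡ᵇ-refl i = refl

  put : (i k : ℕ) → i ≢ k → Bool → Graph → Graph
  put i k i≢k v g = graph (λ a b → if joins i k a b then v else edge g a b)
    (λ a b → cong₂ (λ c e → if c then v else e) (joins-comm i k a b) (symmetric g a b))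
    (λ a → trans (cong (λ c → if c then v else edge g a a) (diagonal a)) (loopless g a))
    where
    diagonal : ∀ a → joins i k a a ≡ false
    diagonal a with a ≟ i
    ... | no a≢i rewrite ≡ᵇ-≢ a≢i = ∧-comm (a ≡ᵇ k) false
    ... | yes refl rewrite ≡ᵇ-≢ i≢k | ≡ᵇ-refl i = refl

  put-same : ∀ {i k} (i≢k : i ≢ k) v g → edge (put i k i≢k v g) i k ≡ v
  put-same {i} {k} i≢k v g rewrite joins-self i k = refl

  put-other-row : ∀ {i k} (i≢k : i ≢ k) v g a → a ≢ i → a ≢ k → ∀ b → edge (put i k i≢k v g) a b ≡ edge g a b
  put-other-row {i} {k} i≢k v g a p q b rewrite joins-other i k a b p q = refl

  put-row : ∀ n {i k} (i≢k : i ≢ k) v g → k < n → deg n (put i k i≢k v g) i + bit (edge g i k) ≡ deg n g i + bit v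
  put-row n {i} {k} i≢k v g k<n = trans (∑-change n k k<n λ b b≢k → cong (λ c → bit (if c then v else edge g i b)) (joins-other′ i k b i≢k b≢k))
    (cong (λ b → deg n g i + bit b) (put-same i≢k v g))

  put-row′ : ∀ n {i k} (i≢k : i ≢ k) v g → i < n → deg n (put i k i≢k v g) k + bit (edge g k i) ≡ deg n g k + bit v
  put-row′ n {i} {k} i≢k v g i<n = trans (cong (_+ bit (edge g k i)) (∑-cong n λ b _ → cong (λ c → bit (if c then v else edge g k b)) (flip b)))
    (put-row n (λ e → i≢k (sym e)) v g i<n)
    where
    flip : ∀ b → joins i k k b ≡ joins k i k b
    flip b = ∨-comm ((k ≡ᵇ i) ∧ (b ≡ᵇ k)) _

  -- If i has a larger degree than j, then some k is joined to i but not to j, and its edge can be moved.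
  transfer : ∀ {n d d′} i j → i < n → j < n → i ≢ j → d j < d i → suc (d′ i) ≡ d i → d′ j ≡ suc (d j) →
             (∀ k → k ≢ i → k ≢ j → d′ k ≡ d k) → Realizable n d → Realizable n d′
  transfer {n} {d} {d′} i j i<n j<n i≢j dj<di at-i at-j same (g , real) with ∑-witness n f₁ f₂ gap
    where
    -- The possible edge between i and j adds the same amount to both degrees. Masking it keeps the
    -- inequality and ensures that the witness k differs from i and j.
    f₁ f₂ : ℕ → Bool
    f₁ k = if k ≡ᵇ j then false else edge g i k
    f₂ k = if k ≡ᵇ i then false else edge g j k
    s₁ : ∑ n (λ k → bit (f₁ k)) + bit (edge g i j) ≡ d i
    s₁ = trans (∑-change n j j<n λ k k≢j → cong (λ c → bit (if c then false else edge g i k)) (≡ᵇ-≢ k≢j))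
      (trans (cong (λ c → deg n g i + bit (if c then false else edge g i j)) (≡ᵇ-refl j)) (trans (+-identityʳ _) (real i i<n)))
    s₂ : ∑ n (λ k → bit (f₂ k)) + bit (edge g i j) ≡ d j
    s₂ = trans (cong (λ b → ∑ n (λ k → bit (f₂ k)) + bit b) (symmetric g i j)) (trans (∑-change n i i<n λ k k≢i → cong (λ c → bit (if c then false else edge g j k)) (≡ᵇ-≢ k≢i))
      (trans (cong (λ c → deg n g j + bit (if c then false else edge g j i)) (≡ᵇ-refl i)) (trans (+-identityʳ _) (real j j<n))))
    gap : ∑ n (λ k → bit (f₂ k)) < ∑ n (λ k → bit (f₁ k))
    gap = +-cancelʳ-< (bit (edge g i j)) _ _ (subst₂ _<_ (sym s₂) (sym s₁) dj<di)
  ... | k , k<n , p , q = g₂ , degrees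
    where
    k≢j : k ≢ j
    k≢j refl with () ← trans (sym p) (cong (λ c → if c then false else edge g i j) (≡ᵇ-refl j))
    ik : edge g i k ≡ true
    ik = trans (sym (cong (λ c → if c then false else edge g i k) (≡ᵇ-≢ k≢j))) p
    k≢i : k ≢ i
    k≢i refl with () ← trans (sym ik) (loopless g i)
    jk : edge g j k ≡ false
    jk = trans (sym (cong (λ c → if c then false else edge g j k) (≡ᵇ-≢ k≢i))) q
    i≢k : i ≢ k
    i≢k e = k≢i (sym e)
    j≢k : j ≢ k
    j≢k e = k≢j (sym e)
    g₁ g₂ : Graph
    g₁ = put i k i≢k false g
    g₂ = put j k j≢k true g₁
    unchanged : ∀ g v {x y} (x≢y : x ≢ y) a → a ≢ x → a ≢ y → deg n (put x y x≢y v g) a ≡ deg n g a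
    unchanged g v x≢y a p q = ∑-cong n λ b _ → cong bit (put-other-row x≢y v g a p q b)
    jk₁ : edge g₁ j k ≡ false
    jk₁ = trans (put-other-row i≢k false g j (λ e → i≢j (sym e)) j≢k k) jk
    degrees : Realizes n g₂ d′
    degrees a a<n with a ≟ i
    ... | yes refl = suc-injective (begin
        suc (deg n g₂ i) ≡⟨ cong suc (unchanged g₁ true j≢k i i≢j i≢k) ⟩
        suc (deg n g₁ i) ≡⟨ +-comm 1 _ ⟩
        deg n g₁ i + 1 ≡⟨ cong (λ b → deg n g₁ i + bit b) ik ⟨
        deg n g₁ i + bit (edge g i k) ≡⟨ put-row n i≢k false g k<n ⟩
        deg n g i + 0 ≡⟨ +-identityʳ _ ⟩
        deg n g i ≡⟨ real i i<n ⟩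
        d i ≡⟨ at-i ⟨
        suc (d′ i) ∎)
      where open ≡-Reasoning
    ... | no a≢i with a ≟ j
    ...   | yes refl = begin
        deg n g₂ j ≡⟨ +-identityʳ _ ⟨
        deg n g₂ j + 0 ≡⟨ cong (λ b → deg n g₂ j + bit b) jk₁ ⟨
        deg n g₂ j + bit (edge g₁ j k) ≡⟨ put-row n j≢k true g₁ k<n ⟩
        deg n g₁ j + 1 ≡⟨ cong (_+ 1) (trans (unchanged g false i≢k j a≢i j≢k) (real j j<n)) ⟩
        d j + 1 ≡⟨ trans (+-comm (d j) 1) (sym at-j) ⟩
        d′ j ∎
      where open ≡-Reasoning
    ...   | no a≢j with a ≟ k
    ...     | no a≢k = trans (unchanged g₁ true j≢k a a≢j a≢k) (trans (unchanged g false i≢k a a≢i a≢k) (trans (real a a<n) (sym (same a a≢i a≢j))))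
    ...     | yes refl = trans (+-cancelʳ-≡ 1 _ _ (begin
        deg n g₂ k + 1 ≡⟨ cong (_+ 1) (+-identityʳ _) ⟨
        deg n g₂ k + 0 + 1 ≡⟨ cong (λ b → deg n g₂ k + bit b + 1) (trans (symmetric g₁ k j) jk₁) ⟨
        deg n g₂ k + bit (edge g₁ k j) + 1 ≡⟨ cong (_+ 1) (put-row′ n j≢k true g₁ j<n) ⟩
        deg n g₁ k + 1 + 1 ≡⟨ cong (λ b → deg n g₁ k + bit b + 1) (trans (symmetric g k i) ik) ⟨
        deg n g₁ k + bit (edge g k i) + 1 ≡⟨ cong (_+ 1) (trans (put-row′ n i≢k false g i<n) (+-identityʳ _)) ⟩
        deg n g k + 1 ∎)) (trans (real k a<n) (sym (same k a≢i a≢j)))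
      where open ≡-Reasoning

-- Young diagrams read along their boundary

module Paths where

  open Graphs
  open import Data.Nat.Base
  open import Data.Nat.Properties
  open import Data.Nat.Tactic.RingSolver using (solve-∀)
  open import Data.Nat.ListAction using (sum)
  open import Data.Nat.ListAction.Properties using (sum-++)
  open import Data.Bool.Base using (Bool; true; false; not)
  open import Data.List.Base using (List; []; _∷_; _++_; _∷ʳ_; map; length; reverse)
  open import Data.List.Properties using (++-assoc; length-++; length-map; unfold-reverse; map-id)
  open import Data.Product using (∃-syntax; _×_; _,_)
  open import Data.Empty using (⊥-elim)
  open import Relation.Binary.PropositionalEquality

  nth : List ℕ → ℕ → ℕ
  nth [] i = 0
  nth (x ∷ xs) zero = x
  nth (x ∷ xs) (suc i) = nth xs i

  Real : List ℕ → Set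
  Real ds = Realizable (length ds) (nth ds)

  nth-at : ∀ X {v R} → nth (X ++ v ∷ R) (length X) ≡ v
  nth-at [] = refl
  nth-at (x ∷ X) = nth-at X

  nth-after : ∀ X {R} k → nth (X ++ R) (length X + k) ≡ nth R k
  nth-after [] k = refl
  nth-after (x ∷ X) k = nth-after X k

  nth-except : ∀ M {w w′ Z} k → k ≢ length M → nth (M ++ w ∷ Z) k ≡ nth (M ++ w′ ∷ Z) k
  nth-except [] zero h = ⊥-elim (h refl)
  nth-except [] (suc k) h = refl
  nth-except (x ∷ M) zero h = refl
  nth-except (x ∷ M) (suc k) h = nth-except M k λ e → h (cong suc e)

  nth-except₂ : ∀ X {v v′ M w w′ Z} k → k ≢ length X → k ≢ length X + suc (length M) →
                nth (X ++ v ∷ M ++ w ∷ Z) k ≡ nth (X ++ v′ ∷ M ++ w′ ∷ Z) k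
  nth-except₂ [] zero h h′ = ⊥-elim (h refl)
  nth-except₂ [] {M = M} (suc k) h h′ = nth-except M k λ e → h′ (cong suc e)
  nth-except₂ (x ∷ X) zero h h′ = refl
  nth-except₂ (x ∷ X) (suc k) h h′ = nth-except₂ X k (λ e → h (cong suc e)) (λ e → h′ (cong suc e))

  length-change : ∀ (X : List ℕ) {v v′ M w w′ Z} → length (X ++ v ∷ M ++ w ∷ Z) ≡ length (X ++ v′ ∷ M ++ w′ ∷ Z)
  length-change [] {M = M} = cong suc (trans (length-++ M) (sym (length-++ M)))
  length-change (x ∷ X) {v} {v′} {M} {w} {w′} {Z} = cong suc (length-change X {v} {v′} {M} {w} {w′} {Z})

  unit-transfer : ∀ X {v M w Z} → w < suc v → Real (X ++ suc v ∷ M ++ w ∷ Z) → Real (X ++ v ∷ M ++ suc w ∷ Z)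
  unit-transfer X {v} {M} {w} {Z} w<v real = transfer {length ℓ} {nth ℓ′} {nth ℓ} i j i<n j<n (λ e → m+1+n≢m i (sym e))
    (subst₂ _<_ (sym at-j) (sym at-i) w<v) (trans (cong suc (nth-at X)) (sym at-i)) (trans at-j′ (cong suc (sym at-j)))
    (λ k p q → nth-except₂ X {v} {suc v} {M} {suc w} {w} {Z} k p q) real′
    where
    ℓ ℓ′ : List ℕ
    ℓ = X ++ v ∷ M ++ suc w ∷ Z
    ℓ′ = X ++ suc v ∷ M ++ w ∷ Z
    i j : ℕ
    i = length X
    j = length X + suc (length M)
    same-length : length ℓ′ ≡ length ℓ
    same-length = length-change X {suc v} {v} {M} {w} {suc w} {Z}
    real′ : Realizable (length ℓ) (nth ℓ′)
    real′ = subst (λ n → Realizable n (nth ℓ′)) same-length real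
    at-i : nth ℓ′ i ≡ suc v
    at-i = nth-at X
    at-j : nth ℓ′ j ≡ w
    at-j = trans (nth-after X (suc (length M))) (nth-at M)
    at-j′ : nth ℓ j ≡ suc w
    at-j′ = trans (nth-after X (suc (length M))) (nth-at M)
    total : length ℓ ≡ length X + suc (length M + suc (length Z))
    total = trans (length-++ X) (cong (λ k → length X + suc k) (length-++ M))
    i<n : i < length ℓ
    i<n = subst (i <_) (sym total) (m<m+n i z<s)
    j<n : j < length ℓ
    j<n = subst (j <_) (sym total) (+-monoʳ-< (length X) (s<s (m<m+n (length M) z<s)))

  -- A list of booleans is read as the boundary of a Young diagram from its first row on: true is a row, false a column.
  rows cols : List Bool → ℕ
  rows [] = 0
  rows (true ∷ p) = suc (rows p)
  rows (false ∷ p) = rows p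
  cols [] = 0
  cols (true ∷ p) = cols p
  cols (false ∷ p) = suc (cols p)

  degs : List Bool → List ℕ
  degs [] = []
  degs (true ∷ p) = cols p ∷ degs p
  degs (false ∷ p) = degs p

  cols-++ : ∀ p q → cols (p ++ q) ≡ cols q + cols p
  cols-++ [] q = sym (+-identityʳ _)
  cols-++ (true ∷ p) q = cols-++ p q
  cols-++ (false ∷ p) q = trans (cong suc (cols-++ p q)) (sym (+-suc (cols q) (cols p)))

  rows-++ : ∀ p q → rows (p ++ q) ≡ rows p + rows q
  rows-++ [] q = refl
  rows-++ (true ∷ p) q = cong suc (rows-++ p q)
  rows-++ (false ∷ p) q = rows-++ p q

  rows+cols : ∀ p → rows p + cols p ≡ length p
  rows+cols [] = refl
  rows+cols (true ∷ p) = cong suc (rows+cols p)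
  rows+cols (false ∷ p) = trans (+-suc (rows p) (cols p)) (cong suc (rows+cols p))

  length-degs : ∀ p → length (degs p) ≡ rows p
  length-degs [] = refl
  length-degs (true ∷ p) = cong suc (length-degs p)
  length-degs (false ∷ p) = length-degs p

  degs-++ : ∀ p q → degs (p ++ q) ≡ map (cols q +_) (degs p) ++ degs q
  degs-++ [] q = refl
  degs-++ (true ∷ p) q = cong₂ _∷_ (cols-++ p q) (degs-++ p q)
  degs-++ (false ∷ p) q = degs-++ p q

  sum-map-+ : ∀ c xs → sum (map (c +_) xs) ≡ length xs * c + sum xs
  sum-map-+ c [] = refl
  sum-map-+ c (x ∷ xs) = trans (cong (c + x +_) (sum-map-+ c xs)) (lemma c x (length xs) (sum xs))
    where
    lemma : ∀ c x n s → c + x + (n * c + s) ≡ c + n * c + (x + s)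
    lemma = solve-∀

  -- Exchanging `true ∷ false` for `false ∷ true` removes a box from that row. The earlier row is
  -- the larger one, so a unit moves from a larger degree to a smaller.
  path-transfer : ∀ x m z → Real (degs (x ++ true ∷ false ∷ m ++ false ∷ true ∷ z)) → Real (degs (x ++ false ∷ true ∷ m ++ true ∷ false ∷ z))
  path-transfer x m z real = subst Real (sym before) (unit-transfer X {v} {M} {cols z} {degs z} w<v (subst Real after real))
    where
    v : ℕ
    v = suc (cols z) + cols m
    X M : List ℕ
    X = map (suc v +_) (degs x)
    M = map (suc (cols z) +_) (degs m)
    w<v : cols z < suc v
    w<v = s≤s (≤-trans (n≤1+n (cols z)) (m≤m+n (suc (cols z)) (cols m)))
    before : degs (x ++ false ∷ true ∷ m ++ true ∷ false ∷ z) ≡ X ++ v ∷ M ++ suc (cols z) ∷ degs z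
    before = trans (degs-++ x _) (cong₂ (λ c R → map (suc c +_) (degs x) ++ R) (cols-++ m (true ∷ false ∷ z))
      (cong₂ _∷_ (cols-++ m (true ∷ false ∷ z)) (degs-++ m (true ∷ false ∷ z))))
    after : degs (x ++ true ∷ false ∷ m ++ false ∷ true ∷ z) ≡ X ++ suc v ∷ M ++ cols z ∷ degs z
    after = trans (degs-++ x _) (cong₂ (λ c R → map (suc c +_) (degs x) ++ R) (cols-++ m (false ∷ true ∷ z))
      (cong₂ _∷_ (cong suc (cols-++ m (false ∷ true ∷ z))) (degs-++ m (false ∷ true ∷ z))))

  -- The boundary read from its other end with rows and columns exchanged, which is conjugation of
  -- the diagram.
  rev : List Bool → List Bool
  rev bs = reverse (map not bs)

  rev-∷ : ∀ b bs → rev (b ∷ bs) ≡ rev bs ∷ʳ not b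
  rev-∷ b bs = unfold-reverse (not b) (map not bs)

  -- The almost self-conjugate diagrams. Each layer of the path adds to a single vertex either a
  -- dominating vertex (`true`) or an isolated one (`false`), which is how threshold graphs arise.
  threshold-path : List Bool → List Bool
  threshold-path as = as ++ true ∷ rev as

  threshold-∷ : ∀ a as → threshold-path (a ∷ as) ≡ a ∷ (threshold-path as ∷ʳ not a)
  threshold-∷ a as = cong (a ∷_) (trans (cong (λ r → as ++ true ∷ r) (rev-∷ a as)) (sym (++-assoc as (true ∷ rev as) (not a ∷ []))))

  nth-map-suc : ∀ xs i → i < length xs → nth (map suc xs) i ≡ suc (nth xs i)
  nth-map-suc (x ∷ xs) zero _ = refl
  nth-map-suc (x ∷ xs) (suc i) (s<s h) = nth-map-suc xs i h

  nth-++-before : ∀ xs {ys} i → i < length xs → nth (xs ++ ys) i ≡ nth xs i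
  nth-++-before (x ∷ xs) zero _ = refl
  nth-++-before (x ∷ xs) (suc i) (s<s h) = nth-++-before xs i h

  threshold-real : ∀ as → Real (degs (threshold-path as)) × rows (threshold-path as) ≡ suc (length as) × cols (threshold-path as) ≡ length as
  threshold-real [] = (graph (λ _ _ → false) (λ _ _ → refl) (λ _ → refl) , λ { zero _ → refl ; (suc _) (s≤s ()) }) , refl , refl
  threshold-real (a ∷ as) rewrite threshold-∷ a as with threshold-real as
  threshold-real (true ∷ as) | real , r , c = subst Real (sym shape)
      (subst (λ n → Realizable (suc n) (nth (suc (cols q) ∷ map suc (degs q)))) (sym (length-map suc (degs q)))
        (dominating real (trans (cong suc c) (sym (trans (length-degs q) r))) (nth-map-suc (degs q))))
    , cong suc (trans (rows-++ q (false ∷ [])) (trans (+-identityʳ _) r)) , trans (cols-++ q (false ∷ [])) (cong suc c)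
    where
    q : List Bool
    q = threshold-path as
    shape : degs (true ∷ (q ∷ʳ false)) ≡ suc (cols q) ∷ map suc (degs q)
    shape = cong₂ _∷_ (cols-++ q (false ∷ [])) (trans (degs-++ q (false ∷ [])) (++-identityʳ′ _))
      where
      ++-identityʳ′ : ∀ (xs : List ℕ) → xs ++ [] ≡ xs
      ++-identityʳ′ [] = refl
      ++-identityʳ′ (x ∷ xs) = cong (x ∷_) (++-identityʳ′ xs)
  threshold-real (false ∷ as) | real , r , c = subst Real (sym shape)
      (subst (λ n → Realizable n (nth (degs q ++ 0 ∷ []))) (sym (trans (length-++ (degs q)) (+-comm (length (degs q)) 1)))
        (isolated real (nth-++-before (degs q)) (nth-at (degs q))))
    , trans (rows-++ q (true ∷ [])) (trans (+-comm (rows q) 1) (cong suc r)) , cong suc (trans (cols-++ q (true ∷ [])) c)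
    where
    q : List Bool
    q = threshold-path as
    shape : degs (q ∷ʳ true) ≡ degs q ++ 0 ∷ []
    shape = trans (degs-++ q (true ∷ [])) (cong (_++ 0 ∷ []) (map-id (degs q)))

  ∑-prefix : ∀ X R → ∑ (length X) (nth (X ++ R)) ≡ sum X
  ∑-prefix [] R = refl
  ∑-prefix (x ∷ X) R = cong (x +_) (∑-prefix X R)

  ∑-suffix : ∀ Y Z → ∑ (length Z) (λ j → nth (Y ++ Z) (length Y + j)) ≡ sum Z
  ∑-suffix [] [] = refl
  ∑-suffix [] (z ∷ Z) = cong (z +_) (∑-suffix [] Z)
  ∑-suffix (y ∷ Y) Z = ∑-suffix Y Z

  sum-even : ∀ ds → Real ds → ∃[ k ] sum ds ≡ k + k
  sum-even ds (g , real) with handshake (length ds) g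
  ... | k , e = k , trans (sym (∑-suffix [] ds)) (trans (∑-cong (length ds) λ i h → sym (real i h)) e)

  -- The rows of x consist of a full rectangle over the columns of `m ++ z` and the part of the
  -- diagram within x, whence the two terms on the left.
  path-bound : ∀ x m z → Real (degs (x ++ m ++ z)) → rows x * cols (m ++ z) + sum (degs x) ≤ rows x * (rows x + rows m ∸ 1) + sum (degs z)
  path-bound x m z real = subst₂ _≤_ left right (degree-sum-bound (rows x) (rows m) (rows z) (nth ℓ)
      (subst (λ n → Realizable n (nth ℓ)) total (subst Real split real)))
    where
    X M Z ℓ : List ℕ
    X = map (cols (m ++ z) +_) (degs x)
    M = map (cols z +_) (degs m)
    Z = degs z
    ℓ = X ++ M ++ Z
    split : degs (x ++ m ++ z) ≡ ℓ
    split = trans (degs-++ x (m ++ z)) (cong (X ++_) (degs-++ m z))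
    lX : length X ≡ rows x
    lX = trans (length-map _ (degs x)) (length-degs x)
    lM : length M ≡ rows m
    lM = trans (length-map _ (degs m)) (length-degs m)
    total : length ℓ ≡ rows x + rows m + rows z
    total = trans (length-++ X) (trans (cong₂ _+_ lX (trans (length-++ M) (cong₂ _+_ lM (length-degs z)))) (sym (+-assoc (rows x) _ _)))
    left : ∑ (rows x) (nth ℓ) ≡ rows x * cols (m ++ z) + sum (degs x)
    left = trans (cong (λ n → ∑ n (nth ℓ)) (sym lX)) (trans (∑-prefix X (M ++ Z)) (trans (sum-map-+ _ (degs x))
      (cong (λ n → n * cols (m ++ z) + sum (degs x)) (length-degs x))))
    right : rows x * (rows x + rows m ∸ 1) + ∑ (rows z) (λ j → nth ℓ (rows x + rows m + j)) ≡ rows x * (rows x + rows m ∸ 1) + sum (degs z)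
    right = cong (rows x * (rows x + rows m ∸ 1) +_) (trans (∑-cong (rows z) λ j _ →
        trans (cong (λ n → nth ℓ (n + j)) (sym (trans (length-++ X) (cong₂ _+_ lX lM)))) (cong (λ l → nth l (length (X ++ M) + j)) (sym (++-assoc X M Z))))
      (trans (cong (λ n → ∑ n (λ j → nth ((X ++ M) ++ Z) (length (X ++ M) + j))) (sym (length-degs z))) (∑-suffix (X ++ M) Z)))

  -- Sums the positions of the rows, counted from the end. It is linear in the bits, as the area of
  -- a walk is, and so links areas to sums of degrees.
  weight : List Bool → ℕ
  weight [] = 0
  weight (true ∷ p) = suc (length p) + weight p
  weight (false ∷ p) = weight p

  triangle : ℕ → ℕ
  triangle zero = 0
  triangle (suc n) = suc n + triangle n

  weight-degs : ∀ p → weight p ≡ sum (degs p) + triangle (rows p)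
  weight-degs [] = refl
  weight-degs (true ∷ p) = trans (cong₂ (λ l w → suc l + w) (sym (rows+cols p)) (weight-degs p)) (lemma (rows p) (cols p) (sum (degs p)) (triangle (rows p)))
    where
    lemma : ∀ r c s t → suc (r + c) + (s + t) ≡ c + s + (suc r + t)
    lemma = solve-∀
  weight-degs (false ∷ p) = weight-degs p

  rows-rev : ∀ bs → rows (rev bs) ≡ cols bs
  rows-rev [] = refl
  rows-rev (true ∷ bs) = trans (cong rows (rev-∷ true bs)) (trans (rows-++ (rev bs) (false ∷ [])) (trans (+-identityʳ _) (rows-rev bs)))
  rows-rev (false ∷ bs) = trans (cong rows (rev-∷ false bs)) (trans (rows-++ (rev bs) (true ∷ [])) (trans (+-comm _ 1) (cong suc (rows-rev bs))))

  cols-rev : ∀ bs → cols (rev bs) ≡ rows bs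
  cols-rev [] = refl
  cols-rev (true ∷ bs) = trans (cong cols (rev-∷ true bs)) (trans (cols-++ (rev bs) (false ∷ [])) (cong suc (cols-rev bs)))
  cols-rev (false ∷ bs) = trans (cong cols (rev-∷ false bs)) (trans (cols-++ (rev bs) (true ∷ [])) (cols-rev bs))

  -- Conjugation preserves the number of boxes, so `rev bs` may take the place of bs in
  -- `weight-degs`.
  weight-rev : ∀ bs → weight bs ≡ sum (degs (rev bs)) + triangle (rows bs)
  weight-rev [] = refl
  weight-rev (true ∷ bs) = begin
    suc (length bs) + weight bs ≡⟨ cong₂ (λ l w → suc l + w) (sym (rows+cols bs)) (weight-rev bs) ⟩
    suc (rows bs + cols bs) + (s + triangle (rows bs)) ≡⟨ lemma (rows bs) (cols bs) s (triangle (rows bs)) ⟩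
    (cols bs * 1 + s + 0) + (suc (rows bs) + triangle (rows bs)) ≡⟨ cong (_+ (suc (rows bs) + triangle (rows bs))) sums ⟨
    sum (degs (rev (true ∷ bs))) + (suc (rows bs) + triangle (rows bs)) ∎
    where
    open ≡-Reasoning
    s : ℕ
    s = sum (degs (rev bs))
    lemma : ∀ r c s t → suc (r + c) + (s + t) ≡ (c * 1 + s + 0) + (suc r + t)
    lemma = solve-∀
    sums : sum (degs (rev (true ∷ bs))) ≡ cols bs * 1 + s + 0
    sums = trans (cong (λ q → sum (degs q)) (rev-∷ true bs)) (trans (cong sum (degs-++ (rev bs) (false ∷ []))) (trans (sum-++ (map suc (degs (rev bs))) [])
      (cong (_+ 0) (trans (sum-map-+ 1 (degs (rev bs))) (cong (λ n → n * 1 + s) (trans (length-degs (rev bs)) (rows-rev bs)))))))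
  weight-rev (false ∷ bs) = trans (weight-rev bs) (cong (_+ triangle (rows bs)) (sym (trans (cong (λ q → sum (degs q)) (rev-∷ false bs))
    (trans (cong sum (degs-++ (rev bs) (true ∷ []))) (trans (sum-++ (map (0 +_) (degs (rev bs))) (0 ∷ []))
      (trans (+-identityʳ _) (cong sum (map-id (degs (rev bs))))))))))

-- Lowering a walk to that of a threshold graph

module Moves where

  open Graphs
  open Paths
  open import Data.Nat.Base
  open import Data.Nat.Properties
  open import Data.Bool.Base using (Bool; true; false; not)
  open import Data.List.Base using (List; []; _∷_; _++_; _∷ʳ_; length)
  open import Data.List.Properties using (++-assoc)
  open import Data.Product using (∃-syntax; _×_; _,_; proj₁)
  open import Data.Sum using (_⊎_; inj₁; inj₂)
  open import Relation.Binary.PropositionalEquality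

  RealPair : List Bool → List Bool → Set
  RealPair as bs = Real (degs (as ++ rev bs))

  -- In either list an `Up` move adds a box to the diagram of `as ++ rev bs`. It changes the area of
  -- the walk by 1, upwards in bs and downwards in as.
  data Up : List Bool → List Bool → Set where
    here  : ∀ {l} → Up (false ∷ true ∷ l) (true ∷ false ∷ l)
    there : ∀ {c l l′} → Up l l′ → Up (c ∷ l) (c ∷ l′)

  data Down : List Bool → List Bool → Set where
    here  : ∀ {l} → Down (true ∷ false ∷ l) (false ∷ true ∷ l)
    there : ∀ {c l l′} → Down l l′ → Down (c ∷ l) (c ∷ l′)

  -- The area between the two places drops by 1, while the final area and the number of boxes are
  -- kept.
  data DownUp : List Bool → List Bool → Set where
    here  : ∀ {l l′} → Up l l′ → DownUp (true ∷ false ∷ l) (false ∷ true ∷ l′)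
    there : ∀ {c l l′} → DownUp l l′ → DownUp (c ∷ l) (c ∷ l′)

  up-split : ∀ {l l′} → Up l l′ → ∃[ x ] ∃[ y ] l ≡ x ++ false ∷ true ∷ y × l′ ≡ x ++ true ∷ false ∷ y
  up-split here = [] , _ , refl , refl
  up-split (there {c} u) with up-split u
  ... | x , y , refl , refl = c ∷ x , y , refl , refl

  down-split : ∀ {l l′} → Down l l′ → ∃[ x ] ∃[ y ] l ≡ x ++ true ∷ false ∷ y × l′ ≡ x ++ false ∷ true ∷ y
  down-split here = [] , _ , refl , refl
  down-split (there {c} u) with down-split u
  ... | x , y , refl , refl = c ∷ x , y , refl , refl

  downUp-split : ∀ {l l′} → DownUp l l′ → ∃[ x ] ∃[ m ] ∃[ m′ ] l ≡ x ++ true ∷ false ∷ m × l′ ≡ x ++ false ∷ true ∷ m′ × Up m m′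
  downUp-split (here u) = [] , _ , _ , refl , refl , u
  downUp-split (there {c} d) with downUp-split d
  ... | x , m , m′ , refl , refl , u = c ∷ x , m , m′ , refl , refl , u

  rev-split : ∀ x a b y → rev (x ++ a ∷ b ∷ y) ≡ rev y ++ not b ∷ not a ∷ rev x
  rev-split [] a b y = trans (rev-∷ a (b ∷ y)) (trans (cong (_∷ʳ not a) (rev-∷ b y)) (++-assoc (rev y) (not b ∷ []) (not a ∷ [])))
  rev-split (c ∷ x) a b y = trans (rev-∷ c (x ++ a ∷ b ∷ y)) (trans (cong (_∷ʳ not c) (rev-split x a b y)) (trans (++-assoc (rev y) (not b ∷ not a ∷ rev x) (not c ∷ []))
    (cong (λ r → rev y ++ not b ∷ not a ∷ r) (sym (rev-∷ c x)))))

  -- The two moves shift a box from the low end to the high end and lower the final area by 2;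
  -- `path-transfer` shifts it back.
  real-up-down : ∀ {as as′ bs bs′} → Up as as′ → Down bs bs′ → RealPair as′ bs′ → RealPair as bs
  real-up-down u d real with up-split u | down-split d
  ... | x , y , refl , refl | x₂ , y₂ , refl , refl = subst (λ p → Real (degs p)) (sym (shape false true)) (path-transfer x (y ++ rev y₂) (rev x₂)
      (subst (λ p → Real (degs p)) (shape true false) real))
    where
    shape : ∀ a b → (x ++ a ∷ b ∷ y) ++ rev (x₂ ++ b ∷ a ∷ y₂) ≡ x ++ a ∷ b ∷ (y ++ rev y₂) ++ not a ∷ not b ∷ rev x₂
    shape a b = trans (cong ((x ++ a ∷ b ∷ y) ++_) (rev-split x₂ b a y₂)) (trans (++-assoc x (a ∷ b ∷ y) _)
      (cong (λ r → x ++ a ∷ b ∷ r) (sym (++-assoc y (rev y₂) _))))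

  real-down-up : ∀ {as bs bs′} → DownUp bs bs′ → RealPair as bs′ → RealPair as bs
  real-down-up {as} d real with downUp-split d
  ... | x , m , m′ , refl , refl , u with up-split u
  ...   | w , y , refl , refl = subst (λ p → Real (degs p)) (sym (shape true false)) (path-transfer (as ++ rev y) (rev w) (rev x)
      (subst (λ p → Real (degs p)) (shape false true) real))
    where
    shape : ∀ a b → as ++ rev (x ++ a ∷ b ∷ (w ++ b ∷ a ∷ y)) ≡ (as ++ rev y) ++ not a ∷ not b ∷ rev w ++ not b ∷ not a ∷ rev x
    shape a b = trans (cong (as ++_) (trans (rev-split x a b _) (trans (cong (_++ not b ∷ not a ∷ rev x) (rev-split w b a y))
      (++-assoc (rev y) (not a ∷ not b ∷ rev w) _)))) (sym (++-assoc as (rev y) _))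

  -- The termination measure: the first entry changed by a `DownUp` move goes from true to false.
  binary : List Bool → ℕ
  binary [] = 0
  binary (true ∷ l) = 2 ^ length l + binary l
  binary (false ∷ l) = binary l

  binary< : ∀ l → binary l < 2 ^ length l
  binary< [] = z<s
  binary< (true ∷ l) = subst (2 ^ length l + binary l <_) (cong (2 ^ length l +_) (sym (+-identityʳ _))) (+-monoʳ-< (2 ^ length l) (binary< l))
  binary< (false ∷ l) = <-≤-trans (binary< l) (m≤m+n _ _)

  up-length : ∀ {l l′} → Up l l′ → length l ≡ length l′
  up-length here = refl
  up-length (there u) = cong suc (up-length u)

  downUp-length : ∀ {l l′} → DownUp l l′ → length l ≡ length l′
  downUp-length (here u) = cong (λ n → suc (suc n)) (up-length u)
  downUp-length (there d) = cong suc (downUp-length d)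

  downUp-binary : ∀ {l l′} → DownUp l l′ → binary l′ < binary l
  downUp-binary (here {l} {l′} u) = <-≤-trans (binary< (true ∷ l′)) (≤-trans (≤-reflexive (cong (λ n → 2 ^ suc n) (sym (up-length u)))) (m≤m+n _ _))
  downUp-binary (there {true} {l} {l′} d) = subst (λ n → 2 ^ n + binary l′ < 2 ^ length l + binary l) (downUp-length d) (+-monoʳ-< (2 ^ length l) (downUp-binary d))
  downUp-binary (there {false} d) = downUp-binary d

  -- Pos y s f as bs (Neg k s f as bs): the walk with letters (as, bs), started at height y (height -1-k) and area s,
  -- returns to 0 with area f, its area never being negative. The last letter has no entry in as.
  mutual
    data Pos : ℕ → ℕ → ℕ → List Bool → List Bool → Set where
      fin   : ∀ {f} → Pos 0 f f [] (false ∷ [])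
      eq    : ∀ {c y s f as bs} → Pos y (s + y) f as bs → Pos y s f (c ∷ as) (c ∷ bs)
      up    : ∀ {y s f as bs} → Pos (suc y) (s + suc y) f as bs → Pos y s f (false ∷ as) (true ∷ bs)
      dn    : ∀ {y s f as bs} → Pos y (s + y) f as bs → Pos (suc y) s f (true ∷ as) (false ∷ bs)
      cross : ∀ {s f as bs} → Neg 0 s f as bs → Pos 0 (suc s) f (true ∷ as) (false ∷ bs)

    data Neg : ℕ → ℕ → ℕ → List Bool → List Bool → Set where
      fin   : ∀ {f} → Neg 0 f f [] (true ∷ [])
      eq    : ∀ {c k s t f as bs} → t ≡ s + suc k → Neg k s f as bs → Neg k t f (c ∷ as) (c ∷ bs)
      dn    : ∀ {k s t f as bs} → t ≡ s + suc (suc k) → Neg (suc k) s f as bs → Neg k t f (true ∷ as) (false ∷ bs)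
      up    : ∀ {k s t f as bs} → t ≡ s + suc k → Neg k s f as bs → Neg (suc k) t f (false ∷ as) (true ∷ bs)
      cross : ∀ {s f as bs} → Pos 0 s f as bs → Neg 0 s f (false ∷ as) (true ∷ bs)

  -- Walks from height y that stay nonnegative, with remaining area f.
  data Dyck : ℕ → ℕ → List Bool → List Bool → Set where
    fin : Dyck 0 0 [] (false ∷ [])
    eq  : ∀ {c y f g as bs} → g ≡ y + f → Dyck y f as bs → Dyck y g (c ∷ as) (c ∷ bs)
    up  : ∀ {y f g as bs} → g ≡ suc y + f → Dyck (suc y) f as bs → Dyck y g (false ∷ as) (true ∷ bs)
    dn  : ∀ {y f g as bs} → g ≡ y + f → Dyck y f as bs → Dyck (suc y) g (true ∷ as) (false ∷ bs)

  -- Height -1-k lifted by one, which reaches the axis when k is 0.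
  Raised : ℕ → ℕ → ℕ → List Bool → List Bool → Set
  Raised zero s f as bs = Pos 0 s f as bs
  Raised (suc k) s f as bs = Neg k s f as bs

  pos-area : ∀ {y s t f as bs} → s ≡ t → Pos y s f as bs → Pos y t f as bs
  pos-area refl d = d

  pos-0 : ∀ {s f as bs} → Pos 0 s f as bs → Pos 0 (s + 0) f as bs
  pos-0 {s} = pos-area (sym (+-identityʳ s))

  -- The part of a DownUp move below the axis: the area before it has been lowered by 1, and 1 is gained back at
  -- the first entry true of bs.
  raise : ∀ {k s f as bs} → Neg k s f as bs →
    (∃[ bs′ ] Up (false ∷ bs) (true ∷ bs′) × Raised k s f as bs′) ⊎
    (∃[ bs′ ] ∃[ s′ ] Up bs bs′ × s ≡ suc s′ × Neg k s′ f as bs′)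
  raise fin = inj₁ (false ∷ [] , here , fin)
  raise {zero} (eq {true} {s = s} refl d) = inj₁ (_ , here , pos-area (+-comm 1 s) (cross d))
  raise {suc k} (eq {true} e d) = inj₁ (_ , here , dn e d)
  raise {zero} (eq {false} {s = s} refl d) with raise d
  ... | inj₁ (bs′ , u , r) = inj₂ (true ∷ bs′ , s , u , +-comm s 1 , cross r)
  ... | inj₂ (bs′ , s′ , u , refl , d′) = inj₂ (false ∷ bs′ , s′ + 1 , there u , refl , eq refl d′)
  raise {suc k} (eq {false} {s = s} refl d) with raise d
  ... | inj₁ (bs′ , u , r) = inj₂ (true ∷ bs′ , s + suc k , u , +-suc s (suc k) , up refl r)
  ... | inj₂ (bs′ , s′ , u , refl , d′) = inj₂ (false ∷ bs′ , s′ + suc (suc k) , there u , refl , eq refl d′)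
  raise {k} (dn {s = s} refl d) with raise d
  ... | inj₁ (bs′ , u , r) = inj₂ (true ∷ bs′ , s + suc k , u , +-suc s (suc k) , eq refl r)
  ... | inj₂ (bs′ , s′ , u , refl , d′) = inj₂ (false ∷ bs′ , s′ + suc (suc k) , there u , refl , dn refl d′)
  raise {suc k} (up e d) = inj₁ (_ , here , eq e d)
  raise {zero} (cross d) = inj₁ (_ , here , eq (pos-0 d))

  DyckFrom : ℕ → ℕ → ℕ → List Bool → List Bool → Set
  DyckFrom y s f as bs = ∃[ g ] f ≡ s + g × Dyck y g as bs

  dyck-eq : ∀ {c y s f as bs} → DyckFrom y (s + y) f as bs → DyckFrom y s f (c ∷ as) (c ∷ bs)
  dyck-eq {y = y} {s} (g , e , d) = y + g , trans e (+-assoc s y g) , eq refl d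

  dyck-up : ∀ {y s f as bs} → DyckFrom (suc y) (s + suc y) f as bs → DyckFrom y s f (false ∷ as) (true ∷ bs)
  dyck-up {y} {s} (g , e , d) = suc y + g , trans e (+-assoc s (suc y) g) , up refl d

  dyck-dn : ∀ {y s f as bs} → DyckFrom y (s + y) f as bs → DyckFrom (suc y) s f (true ∷ as) (false ∷ bs)
  dyck-dn {y} {s} (g , e , d) = y + g , trans e (+-assoc s y g) , dn refl d

  -- One unit of area is withheld. It is given back by raising a letter at the first visit below the
  -- axis; without such a visit the walk is already a Dyck walk from here on.
  lower-until : ∀ {y s f as bs} → Pos y (suc s) f as bs → DyckFrom y (suc s) f as bs ⊎ (∃[ bs′ ] Up bs bs′ × Pos y s f as bs′)
  lower-until {s = s} fin = inj₁ (0 , sym (+-identityʳ (suc s)) , fin)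
  lower-until (eq d) with lower-until d
  ... | inj₁ n = inj₁ (dyck-eq n)
  ... | inj₂ (bs′ , u , d′) = inj₂ (_ , there u , eq d′)
  lower-until (up d) with lower-until d
  ... | inj₁ n = inj₁ (dyck-up n)
  ... | inj₂ (bs′ , u , d′) = inj₂ (_ , there u , up d′)
  lower-until (dn d) with lower-until d
  ... | inj₁ n = inj₁ (dyck-dn n)
  ... | inj₂ (bs′ , u , d′) = inj₂ (_ , there u , dn d′)
  lower-until (cross d) with raise d
  ... | inj₁ (bs′ , u , r) = inj₂ (true ∷ bs′ , u , eq (pos-0 r))
  ... | inj₂ (bs′ , s′ , u , refl , d′) = inj₂ (false ∷ bs′ , there u , cross d′)

  -- The preceding entry of bs is true, and it may be moved.
  descend : ∀ {y s f as bs} → Pos (suc y) (suc s) f as bs → DyckFrom (suc y) (suc s) f as bs ⊎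
    ((∃[ bs′ ] DownUp bs bs′ × Pos (suc y) (suc s) f as bs′) ⊎ (∃[ bs′ ] DownUp (true ∷ bs) (false ∷ bs′) × Pos y s f as bs′))
  descend (eq {true} {suc y} {suc s} d) with descend d
  ... | inj₁ n = inj₁ (dyck-eq n)
  ... | inj₂ (inj₁ (bs′ , m , d′)) = inj₂ (inj₁ (_ , there m , eq d′))
  ... | inj₂ (inj₂ (bs′ , m , d′)) = inj₂ (inj₁ (_ , m , dn (pos-area (+-suc s y) d′)))
  descend (eq {false} d) with lower-until d
  ... | inj₁ n = inj₁ (dyck-eq n)
  ... | inj₂ (bs′ , u , d′) = inj₂ (inj₂ (_ , here u , up d′))
  descend (up {suc y} {suc s} d) with descend d
  ... | inj₁ n = inj₁ (dyck-up n)
  ... | inj₂ (inj₁ (bs′ , m , d′)) = inj₂ (inj₁ (_ , there m , up d′))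
  ... | inj₂ (inj₂ (bs′ , m , d′)) = inj₂ (inj₁ (_ , m , eq (pos-area (+-suc s (suc y)) d′)))
  descend (dn d) with lower-until d
  ... | inj₁ n = inj₁ (dyck-dn n)
  ... | inj₂ (bs′ , u , d′) = inj₂ (inj₂ (_ , here u , eq d′))

  -- Starting with area 0, a walk can go below the axis only after an excursion above it has earned
  -- area. One unit of that can be given up and regained below, until nothing lies below.
  balance : ∀ {f as bs} → Pos 0 0 f as bs → Dyck 0 f as bs ⊎ (∃[ bs′ ] DownUp bs bs′ × Pos 0 0 f as bs′)
  balance fin = inj₁ fin
  balance (eq d) with balance d
  ... | inj₁ n = inj₁ (eq refl n)
  ... | inj₂ (bs′ , m , d′) = inj₂ (_ , there m , eq d′)
  balance (up d) with descend d
  ... | inj₁ (g , e , n) = inj₁ (up e n)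
  ... | inj₂ (inj₁ (bs′ , m , d′)) = inj₂ (_ , there m , up d′)
  ... | inj₂ (inj₂ (bs′ , m , d′)) = inj₂ (_ , m , eq d′)

  -- The case split is that of `descend`: in the second alternative, the entry `true` just before bs
  -- takes part in the move.
  lower-b : ∀ {y f as bs} → Dyck (suc y) f as bs →
    (∃[ bs′ ] ∃[ f′ ] Down bs bs′ × f ≡ suc f′ × Dyck (suc y) f′ as bs′) ⊎ (∃[ bs′ ] Down (true ∷ bs) (false ∷ bs′) × Dyck y f as bs′)
  lower-b {y} (eq {true} {f = f₁} refl d) with lower-b d
  ... | inj₁ (bs′ , f′ , m , refl , d′) = inj₁ (_ , suc y + f′ , there m , cong suc (+-suc y f′) , eq refl d′)
  ... | inj₂ (bs′ , m , d′) = inj₁ (_ , y + f₁ , m , refl , dn refl d′)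
  lower-b (eq {false} e d) = inj₂ (_ , here , up e d)
  lower-b {y} (up {f = f₁} refl d) with lower-b d
  ... | inj₁ (bs′ , f′ , m , refl , d′) = inj₁ (_ , suc (suc y) + f′ , there m , cong (λ n → suc (suc n)) (+-suc y f′) , up refl d′)
  ... | inj₂ (bs′ , m , d′) = inj₁ (_ , suc y + f₁ , m , refl , eq refl d′)
  lower-b (dn e d) = inj₂ (_ , here , eq e d)

  raise-a : ∀ {y f as bs} → Dyck (suc y) f as bs →
    (∃[ as′ ] ∃[ f′ ] Up as as′ × f ≡ suc f′ × Dyck (suc y) f′ as′ bs) ⊎ (∃[ as′ ] Up (false ∷ as) (true ∷ as′) × Dyck y f as′ bs)
  raise-a {y} (eq {false} {f = f₁} refl d) with raise-a d
  ... | inj₁ (as′ , f′ , m , refl , d′) = inj₁ (_ , suc y + f′ , there m , cong suc (+-suc y f′) , eq refl d′)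
  ... | inj₂ (as′ , m , d′) = inj₁ (_ , y + f₁ , m , refl , dn refl d′)
  raise-a (eq {true} e d) = inj₂ (_ , here , up e d)
  raise-a {y} (up {f = f₁} refl d) with raise-a d
  ... | inj₁ (as′ , f′ , m , refl , d′) = inj₁ (_ , suc (suc y) + f′ , there m , cong (λ n → suc (suc n)) (+-suc y f′) , up refl d′)
  ... | inj₂ (as′ , m , d′) = inj₁ (_ , suc y + f₁ , m , refl , eq refl d′)
  raise-a (dn e d) = inj₂ (_ , here , eq e d)

  lower-area-b : ∀ {f as bs} → Dyck 0 (suc f) as bs → ∃[ bs′ ] Down bs bs′ × Dyck 0 f as bs′
  lower-area-b (eq refl d) with lower-area-b d
  ... | bs′ , m , d′ = _ , there m , eq refl d′
  lower-area-b (up refl d) with lower-b d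
  ... | inj₁ (bs′ , f′ , m , refl , d′) = _ , there m , up refl d′
  ... | inj₂ (bs′ , m , d′) = _ , m , eq refl d′

  lower-area-a : ∀ {f as bs} → Dyck 0 (suc f) as bs → ∃[ as′ ] Up as as′ × Dyck 0 f as′ bs
  lower-area-a (eq refl d) with lower-area-a d
  ... | as′ , m , d′ = _ , there m , eq refl d′
  lower-area-a (up refl d) with raise-a d
  ... | inj₁ (as′ , f′ , m , refl , d′) = _ , there m , up refl d′
  ... | inj₂ (as′ , m , d′) = _ , m , eq refl d′

  -- Without area every letter is level, so the two ends agree except for the missing last step of
  -- the high end: exactly a threshold path.
  flat : ∀ {as bs} → Dyck 0 0 as bs → bs ≡ as ∷ʳ false
  flat fin = refl
  flat (eq {c} refl d) = cong (c ∷_) (flat d)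

  rev-∷ʳ : ∀ as → rev (as ∷ʳ false) ≡ true ∷ rev as
  rev-∷ʳ [] = refl
  rev-∷ʳ (a ∷ as) = trans (rev-∷ a (as ∷ʳ false)) (trans (cong (_∷ʳ not a) (rev-∷ʳ as)) (cong (true ∷_) (sym (rev-∷ a as))))

  -- One box is moved at a time, and each move costs area 2; this is where even area is used.
  real-dyck : ∀ k {as bs} → Dyck 0 (k + k) as bs → RealPair as bs
  real-dyck zero {as} d with flat d
  ... | refl = subst (λ r → Real (degs (as ++ r))) (sym (rev-∷ʳ as)) (proj₁ (threshold-real as))
  real-dyck (suc k) {as} {bs} d with lower-area-b (subst (λ n → Dyck 0 n as bs) (cong suc (+-suc k k)) d)
  ... | bs′ , m , d′ with lower-area-a d′
  ...   | as′ , m′ , d″ = real-up-down {as} {as′} {bs} {bs′} m′ m (real-dyck k {as′} {bs′} d″)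

  real-pos : ∀ k {as bs} → Pos 0 0 (k + k) as bs → RealPair as bs
  real-pos k {as} {bs} d = go (suc (binary bs)) d ≤-refl
    where
    go : ∀ n {bs} → Pos 0 0 (k + k) as bs → binary bs < n → RealPair as bs
    go (suc n) {bs} d (s≤s h) with balance d
    ... | inj₁ dyck = real-dyck k {as} {bs} dyck
    ... | inj₂ (bs′ , m , d′) = real-down-up {as} {bs} {bs′} m (go n {bs′} d′ (<-≤-trans (downUp-binary m) h))

-- From words to degree sequences

module Degrees where

  open import Defs
  open Graphs
  open Paths
  open Moves
  open Words using (Letter; dn; z₀; z₁; up; Word)
  open Walks using (nonneg; descends)
  open Reversal using (area; nonneg-unfold)
  open Bridges using (endsDescending)
  open import Data.Nat.Base
  open import Data.Nat.Properties
  open import Data.Nat.ListAction using (sum)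
  open import Data.Integer.Base as ℤ using (ℤ; +_; -[1+_])
  import Data.Integer.Properties as ℤ
  open import Data.Bool.Base using (Bool; true; false; not; if_then_else_)
  open import Data.Fin.Base as Fin using (Fin; toℕ; fromℕ<)
  open import Data.Fin.Properties using (toℕ<n; toℕ-fromℕ<)
  open import Data.List.Base using (List; []; _∷_; _++_; map; allFin)
  open import Data.List.Properties using (map-tabulate)
  open import Data.Product using (Σ; ∃-syntax; _×_; _,_)
  open import Data.Sum using (inj₁; inj₂)
  open import Relation.Binary.PropositionalEquality hiding (sym)
  open import Relation.Binary.PropositionalEquality using () renaming (sym to ≡-sym)

  sum-allFin : ∀ n (f : ℕ → ℕ) (g : Fin n → ℕ) → (∀ i → g i ≡ f (toℕ i)) → sum (map g (allFin n)) ≡ ∑ n f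
  sum-allFin zero f g p = refl
  sum-allFin (suc n) f g p = cong₂ _+_ (p Fin.zero) (trans (cong sum (trans (map-tabulate Fin.suc g) (≡-sym (map-tabulate (λ i → i) (λ i → g (Fin.suc i))))))
    (sum-allFin n (λ i → f (suc i)) (λ i → g (Fin.suc i)) λ i → p (Fin.suc i)))

  bit-if : ∀ b → (if b then 1 else 0) ≡ bit b
  bit-if true = refl
  bit-if false = refl

  realizable⇒degrees : ∀ {n d} → Realizable n d → Σ (SimpleGraph n) λ G → ∀ i → degree G i ≡ d (toℕ i)
  realizable⇒degrees {n} (g , real) = record { adj = λ i j → edge g (toℕ i) (toℕ j) ; sym = λ i j → symmetric g (toℕ i) (toℕ j) ; irrefl = λ i → loopless g (toℕ i) }
    , λ i → trans (sum-allFin n (λ j → bit (edge g (toℕ i) j)) _ λ j → bit-if _) (real (toℕ i) (toℕ<n i))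

  extend : ∀ {A : Set} n → A → (Fin n → A) → ℕ → A
  extend zero a f i = a
  extend (suc n) a f zero = f Fin.zero
  extend (suc n) a f (suc i) = extend n a (λ x → f (Fin.suc x)) i

  extend-toℕ : ∀ {A : Set} n (a : A) f x → extend n a f (toℕ x) ≡ f x
  extend-toℕ (suc n) a f Fin.zero = refl
  extend-toℕ (suc n) a f (Fin.suc x) = extend-toℕ n a (λ x → f (Fin.suc x)) x

  extend-outside : ∀ {A : Set} n (a : A) f i → n ≤ i → extend n a f i ≡ a
  extend-outside zero a f i _ = refl
  extend-outside (suc n) a f (suc i) (s≤s h) = extend-outside n a (λ x → f (Fin.suc x)) i h

  degrees⇒realizable : ∀ {n d} (G : SimpleGraph n) → (∀ i → degree G i ≡ d (toℕ i)) → Realizable n d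
  degrees⇒realizable {n} {d} G real = graph e e-sym e-irr , degrees
    where
    e : ℕ → ℕ → Bool
    e i j = extend n false (λ x → extend n false (adj G x) j) i
    inside : ∀ x y → e (toℕ x) (toℕ y) ≡ adj G x y
    inside x y = trans (extend-toℕ n false _ x) (extend-toℕ n false (adj G x) y)
    outsideˡ : ∀ i j → n ≤ i → e i j ≡ false
    outsideˡ i j h = extend-outside n false _ i h
    outsideʳ : ∀ i j → n ≤ j → e i j ≡ false
    outsideʳ i j h with <-≤-connex i n
    ... | inj₂ n≤i = outsideˡ i j n≤i
    ... | inj₁ i<n = trans (cong (λ k → e k j) (≡-sym (toℕ-fromℕ< i<n))) (trans (extend-toℕ n false _ (fromℕ< i<n)) (extend-outside n false _ j h))
    e-sym : ∀ i j → e i j ≡ e j i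
    e-sym i j with <-≤-connex i n | <-≤-connex j n
    ... | inj₂ h | _ = trans (outsideˡ i j h) (≡-sym (outsideʳ j i h))
    ... | inj₁ _ | inj₂ h = trans (outsideʳ i j h) (≡-sym (outsideˡ j i h))
    ... | inj₁ p | inj₁ q = subst₂ (λ i j → e i j ≡ e j i) (toℕ-fromℕ< p) (toℕ-fromℕ< q)
          (trans (inside (fromℕ< p) (fromℕ< q)) (trans (sym G _ _) (≡-sym (inside (fromℕ< q) (fromℕ< p)))))
    e-irr : ∀ i → e i i ≡ false
    e-irr i with <-≤-connex i n
    ... | inj₂ h = outsideˡ i i h
    ... | inj₁ p = subst (λ i → e i i ≡ false) (toℕ-fromℕ< p) (trans (inside (fromℕ< p) (fromℕ< p)) (irrefl G _))
    degrees : ∀ i → i < n → ∑ n (λ j → bit (e i j)) ≡ d i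
    degrees i i<n = subst (λ i → ∑ n (λ j → bit (e i j)) ≡ d i) (toℕ-fromℕ< i<n) (trans
      (≡-sym (sum-allFin n (λ j → bit (e (toℕ x) j)) _ λ y → trans (bit-if _) (cong bit (≡-sym (inside x y))))) (real x))
      where
      x : Fin n
      x = fromℕ< i<n

  -- A letter records one boundary step from each end of the diagram: `ascends` tells whether the low end makes a
  -- column, and `descends` whether the high end makes a row. The high end makes no step for the last letter.
  ascends : Letter → Bool
  ascends dn = false
  ascends z₀ = false
  ascends z₁ = true
  ascends up = true

  lows highs : Word → List Bool
  lows w = map ascends w
  highs [] = []
  highs (l ∷ []) = []
  highs (l ∷ m ∷ w) = descends l ∷ highs (m ∷ w)

  path : Word → List Bool
  path w = highs w ++ rev (lows w)

  area-step : ∀ t s w {f} → t ℤ.+ s ℤ.+ area s w ≡ f → t ℤ.+ (s ℤ.+ area s w) ≡ f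
  area-step t s w e = trans (≡-sym (ℤ.+-assoc t s (area s w))) e

  add-back : ∀ {t s : ℤ} {n : ℕ} → t ℤ.+ -[1+ n ] ≡ s → t ≡ s ℤ.+ + suc n
  add-back {t} {s} {n} refl = ≡-sym (trans (ℤ.+-assoc t -[1+ n ] (+ suc n)) (trans (cong (λ z → t ℤ.+ z) (ℤ.+-inverseˡ (+ suc n))) (ℤ.+-identityʳ t)))

  mutual
    above : ∀ y s l w → nonneg (+ y) (+ s) false (l ∷ w) ≡ true → endsDescending false (l ∷ w) ≡ false →
            ∃[ f ] Pos y s f (highs (l ∷ w)) (lows (l ∷ w)) × + s ℤ.+ area (+ y) (l ∷ w) ≡ + f
    above zero s z₀ [] p q = s , fin , ℤ.+-identityʳ (+ s)
    -- Stepping below the axis with area 0 would leave area -1, which `below` excludes; hence the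
    -- `suc s` in `cross`.
    above zero zero dn (m ∷ w) p q with below 0 -[1+ 0 ] m w p q
    ... | s′ , f , e , d , a with () ← e
    above zero (suc s) dn (m ∷ w) p q with below 0 (+ s) m w p q
    ... | s′ , f , refl , d , a = f , cross d , area-step (+ suc s) -[1+ 0 ] (m ∷ w) a
    above (suc y) s dn (m ∷ w) p q with above y (s + y) m w p q
    ... | f , d , a = f , dn d , area-step (+ s) (+ y) (m ∷ w) a
    above zero s z₀ (m ∷ w) p q with above zero (s + zero) m w p q
    ... | f , d , a = f , eq d , area-step (+ s) (+ 0) (m ∷ w) a
    above (suc y) s z₀ (m ∷ w) p q with above (suc y) (s + suc y) m w p q
    ... | f , d , a = f , eq d , area-step (+ s) (+ suc y) (m ∷ w) a
    above zero s z₁ (m ∷ w) p q with above zero (s + zero) m w p q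
    ... | f , d , a = f , eq d , area-step (+ s) (+ 0) (m ∷ w) a
    above (suc y) s z₁ (m ∷ w) p q with above (suc y) (s + suc y) m w p q
    ... | f , d , a = f , eq d , area-step (+ s) (+ suc y) (m ∷ w) a
    above zero s up (m ∷ w) p q with above 1 (s + 1) m w p q
    ... | f , d , a = f , up d , area-step (+ s) (+ 1) (m ∷ w) a
    above (suc y) s up (m ∷ w) p q with above (suc (suc y)) (s + suc (suc y)) m w p q
    ... | f , d , a = f , up d , area-step (+ s) (+ suc (suc y)) (m ∷ w) a

    -- Below the axis the area only falls until the next zero, where it has to be nonnegative. So it
    -- is a natural number all along, as `Neg` requires.
    below : ∀ k t l w → nonneg -[1+ k ] t false (l ∷ w) ≡ true → endsDescending false (l ∷ w) ≡ false →
            ∃[ s ] ∃[ f ] t ≡ + s × Neg k s f (highs (l ∷ w)) (lows (l ∷ w)) × t ℤ.+ area -[1+ k ] (l ∷ w) ≡ + f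
    below zero t up [] p q with nonneg-unfold (+ 0) (t ℤ.+ + 0) [] p
    below zero (+ s) up [] p q | _ = s , s , refl , fin , ℤ.+-identityʳ (+ s)
    below zero -[1+ s ] up [] p q | _ , h with () ← h refl
    below k t dn (m ∷ w) p q with below (suc k) (t ℤ.+ -[1+ suc k ]) m w p q
    ... | s , f , e , d , a = s + suc (suc k) , f , add-back e , dn refl d , area-step t -[1+ suc k ] (m ∷ w) a
    below k t z₀ (m ∷ w) p q with below k (t ℤ.+ -[1+ k ]) m w p q
    ... | s , f , e , d , a = s + suc k , f , add-back e , eq refl d , area-step t -[1+ k ] (m ∷ w) a
    below k t z₁ (m ∷ w) p q with below k (t ℤ.+ -[1+ k ]) m w p q
    ... | s , f , e , d , a = s + suc k , f , add-back e , eq refl d , area-step t -[1+ k ] (m ∷ w) a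
    below zero -[1+ s ] up (m ∷ w) p q with () ← p
    below zero (+ s) up (m ∷ w) p q with above 0 (s + 0) m w p q
    ... | f , d , a = s , f , refl , cross (pos-area (+-identityʳ s) d) , area-step (+ s) (+ 0) (m ∷ w) a
    below (suc k) t up (m ∷ w) p q with below k (t ℤ.+ -[1+ k ]) m w p q
    ... | s , f , e , d , a = s + suc k , f , add-back e , up refl d , area-step t -[1+ k ] (m ∷ w) a

  even : ℕ → Bool
  even zero = true
  even (suc n) = not (even n)

  even-sound : ∀ n → even n ≡ true → ∃[ k ] n ≡ k + k
  even-sound zero _ = 0 , refl
  even-sound (suc (suc n)) e with even-sound n (trans (≡-sym (not-not (even n))) e)
    where
    not-not : ∀ b → not (not b) ≡ b
    not-not true = refl
    not-not false = refl
  ... | k , refl = suc k , cong suc (≡-sym (+-suc k k))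

  even-+ : ∀ k n → even (k + k + n) ≡ even n
  even-+ zero n = refl
  even-+ (suc k) n = trans (cong (λ m → not (even (m + n))) (+-suc k k)) (trans (not-not (even (k + k + n))) (even-+ k n))
    where
    not-not : ∀ b → not (not b) ≡ b
    not-not true = refl
    not-not false = refl

  word-real : ∀ l w → nonneg (+ 0) (+ 0) false (l ∷ w) ≡ true → endsDescending false (l ∷ w) ≡ false →
              even ℤ.∣ area (+ 0) (l ∷ w) ∣ ≡ true → Real (degs (path (l ∷ w)))
  word-real l w p q ev with above 0 0 l w p q
  ... | f , d , a with even-sound f (subst (λ z → even ℤ.∣ z ∣ ≡ true) (trans (≡-sym (ℤ.+-identityˡ (area (+ 0) (l ∷ w)))) a) ev)
  ...   | k , refl = real-pos k d

-- From degree sequences to words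

module Necessity where

  open Graphs
  open Paths
  open Degrees
  open Words using (Letter; dn; z₀; z₁; up; Word)
  open Walks using (nonneg; descends)
  open Reversal using (end; area; nonneg-complete; area-shift; end-shift; value)
  open Bridges using (endsDescending)
  open import Data.Nat.Base
  open import Data.Nat.Properties
  open import Data.Nat.Tactic.RingSolver using (solve-∀)
  open import Data.Nat.ListAction using (sum)
  open import Data.Nat.ListAction.Properties using (sum-++)
  open import Data.Integer.Base as ℤ using (ℤ; +_; -[1+_])
  import Data.Integer.Properties as ℤ
  import Data.Integer.Tactic.RingSolver as ℤ-Solver
  open import Data.Bool.Base using (Bool; true; false; not)
  open import Data.List.Base using (List; []; _∷_; _++_; _∷ʳ_; map; length)
  open import Data.List.Properties using (++-assoc; length-map; map-++)
  open import Data.Product using (_,_)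
  open import Relation.Binary.PropositionalEquality

  end-rows : ∀ w → end (+ 0) w ℤ.+ + rows (map descends w) ≡ + rows (map ascends w)
  end-rows [] = refl
  end-rows (l ∷ w) = trans (cong (ℤ._+ + rows (map descends (l ∷ w))) (end-shift (value l) w)) (one l)
    where
    e : ℤ
    e = end (+ 0) w
    lemma₀ : ∀ c e a → e ℤ.+ ℤ.- c ℤ.+ (c ℤ.+ a) ≡ e ℤ.+ a
    lemma₀ = ℤ-Solver.solve-∀
    lemma₁ : ∀ c e a → e ℤ.+ c ℤ.+ a ≡ c ℤ.+ (e ℤ.+ a)
    lemma₁ = ℤ-Solver.solve-∀
    one : ∀ l → e ℤ.+ value l ℤ.+ + rows (map descends (l ∷ w)) ≡ + rows (map ascends (l ∷ w))
    one dn = trans (lemma₀ (+ 1) e (+ rows (map descends w))) (end-rows w)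
    one z₀ = trans (cong (ℤ._+ + rows (map descends w)) (ℤ.+-identityʳ e)) (end-rows w)
    one z₁ = trans (lemma₁ (+ 0) e (+ 1 ℤ.+ + rows (map descends w))) (trans (ℤ.+-identityˡ _)
      (trans (lemma₂ (+ 1) e (+ rows (map descends w))) (cong (λ z → + 1 ℤ.+ z) (end-rows w))))
      where
      lemma₂ : ∀ c e a → e ℤ.+ (c ℤ.+ a) ≡ c ℤ.+ (e ℤ.+ a)
      lemma₂ = ℤ-Solver.solve-∀
    one up = trans (lemma₁ (+ 1) e (+ rows (map descends w))) (cong (λ z → + 1 ℤ.+ z) (end-rows w))

  -- A letter shifts its own and all later heights by the difference of its bits, and `weight`
  -- counts just these heights.
  area-weight : ∀ w → area (+ 0) w ℤ.+ + weight (map descends w) ≡ + weight (map ascends w)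
  area-weight [] = refl
  area-weight (l ∷ w) = trans (cong (λ z → value l ℤ.+ z ℤ.+ + weight (map descends (l ∷ w))) (area-shift (value l) w)) (one l)
    where
    A n wd : ℤ
    A = area (+ 0) w
    n = + length w
    wd = + weight (map descends w)
    lemma₀ : ∀ c A n d → ℤ.- c ℤ.+ (A ℤ.+ n ℤ.* ℤ.- c) ℤ.+ (c ℤ.+ n ℤ.* c ℤ.+ d) ≡ A ℤ.+ d
    lemma₀ = ℤ-Solver.solve-∀
    lemma₁ : ∀ c A n d → c ℤ.+ (A ℤ.+ n ℤ.* c) ℤ.+ d ≡ c ℤ.+ n ℤ.* c ℤ.+ (A ℤ.+ d)
    lemma₁ = ℤ-Solver.solve-∀
    lemma₂ : ∀ z c A n d → z ℤ.+ (A ℤ.+ n ℤ.* z) ℤ.+ (c ℤ.+ n ℤ.* c ℤ.+ d) ≡ z ℤ.+ n ℤ.* z ℤ.+ (c ℤ.+ n ℤ.* c ℤ.+ (A ℤ.+ d))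
    lemma₂ = ℤ-Solver.solve-∀
    size : ∀ (f : Letter → Bool) d → + suc (length (map f w)) ℤ.+ d ≡ + 1 ℤ.+ n ℤ.* + 1 ℤ.+ d
    size f d = cong (ℤ._+ d) (trans (cong (λ k → + suc k) (length-map f w)) (cong (λ z → + 1 ℤ.+ z) (sym (ℤ.*-identityʳ n))))
    drop-zero : ∀ x → + 0 ℤ.+ n ℤ.* + 0 ℤ.+ x ≡ x
    drop-zero x = trans (cong (λ z → + 0 ℤ.+ z ℤ.+ x) (ℤ.*-zeroʳ n)) (ℤ.+-identityˡ x)
    one : ∀ l → value l ℤ.+ (A ℤ.+ n ℤ.* value l) ℤ.+ + weight (map descends (l ∷ w)) ≡ + weight (map ascends (l ∷ w))
    one dn = trans (cong (λ z → -[1+ 0 ] ℤ.+ (A ℤ.+ n ℤ.* -[1+ 0 ]) ℤ.+ z) (size descends wd)) (trans (lemma₀ (+ 1) A n wd) (area-weight w))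
    one z₀ = trans (lemma₁ (+ 0) A n wd) (trans (drop-zero _) (area-weight w))
    one z₁ = trans (cong (λ z → + 0 ℤ.+ (A ℤ.+ n ℤ.* + 0) ℤ.+ z) (size descends wd)) (trans (lemma₂ (+ 0) (+ 1) A n wd) (trans (drop-zero _)
      (trans (cong (λ z → + 1 ℤ.+ n ℤ.* + 1 ℤ.+ z) (area-weight w)) (sym (size ascends _)))))
    one up = trans (lemma₁ (+ 1) A n wd) (trans (cong (λ z → + 1 ℤ.+ n ℤ.* + 1 ℤ.+ z) (area-weight w)) (sym (size ascends _)))

  difference≥0 : ∀ {x : ℤ} {a b} → x ℤ.+ + a ≡ + b → a ≤ b → + 0 ℤ.≤ x
  difference≥0 {x} {a} {b} e a≤b = subst (+ 0 ℤ.≤_) (trans (cong (ℤ._- + a) (sym e)) (cancel x (+ a))) (ℤ.i≤j⇒0≤j-i (ℤ.+≤+ a≤b))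
    where
    cancel : ∀ x a → x ℤ.+ a ℤ.- a ≡ x
    cancel = ℤ-Solver.solve-∀

  highs-++ : ∀ u l v → highs (u ++ l ∷ v) ≡ map descends u ++ highs (l ∷ v)
  highs-++ [] l v = refl
  highs-++ (x ∷ []) l v = refl
  highs-++ (x ∷ y ∷ u) l v = cong (descends x ∷_) (highs-++ (y ∷ u) l v)

  highs-∷ʳ : ∀ f l w → endsDescending f (l ∷ w) ≡ false → map descends (l ∷ w) ≡ highs (l ∷ w) ∷ʳ false
  highs-∷ʳ f l [] e = cong (_∷ []) e
  highs-∷ʳ f l (m ∷ w) e = cong (descends l ∷_) (highs-∷ʳ (descends l) m w e)

  rev-++ : ∀ xs ys → rev (xs ++ ys) ≡ rev ys ++ rev xs
  rev-++ [] ys = ++-identityʳ′ _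
    where
    ++-identityʳ′ : ∀ (xs : List Bool) → xs ≡ xs ++ []
    ++-identityʳ′ [] = refl
    ++-identityʳ′ (x ∷ xs) = cong (x ∷_) (++-identityʳ′ xs)
  rev-++ (x ∷ xs) ys = trans (rev-∷ x (xs ++ ys)) (trans (cong (_∷ʳ not x) (rev-++ xs ys)) (trans (++-assoc (rev ys) (rev xs) _)
    (cong (rev ys ++_) (sym (rev-∷ x xs)))))

  same-rows : ∀ u → end (+ 0) u ≡ + 0 → rows (map descends u) ≡ rows (map ascends u)
  same-rows u z = ℤ.+-injective (trans (sym (ℤ.+-identityˡ _)) (trans (cong (λ e → e ℤ.+ + rows (map descends u)) (sym z)) (end-rows u)))

  triangles : ∀ r → r * suc r ≡ triangle r + triangle r
  triangles zero = refl
  triangles (suc r) = trans (expand r) (trans (cong (λ t → suc r + suc r + t) (triangles r)) (collect (suc r) (triangle r)))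
    where
    expand : ∀ r → suc r * suc (suc r) ≡ suc r + suc r + r * suc r
    expand = solve-∀
    collect : ∀ r t → r + r + (t + t) ≡ r + t + (r + t)
    collect = solve-∀

  record Shape (w : Word) : Set where
    field
      ends-high : endsDescending false w ≡ false
      more-rows : rows (path w) ≡ suc (cols (path w))
      size      : length w ≡ rows (path w)
      real      : Real (degs (path w))

  module _ {l : Letter} {w : Word} (shape : Shape (l ∷ w)) where
    open Shape shape

    private
      W : Word
      W = l ∷ w
      x z : List Bool
      x = highs W
      z = rev (lows W)

      descends-W : map descends W ≡ x ∷ʳ false
      descends-W = highs-∷ʳ false l w ends-high

      balanced-rows : rows x ≡ rows (lows W)
      balanced-rows = +-cancelʳ-≡ (cols (lows W)) _ _ (begin
        rows x + cols (lows W)         ≡⟨ cong (λ t → rows x + t) (rows-rev (lows W)) ⟨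
        rows x + rows z                ≡⟨ rows-++ x z ⟨
        rows (path W)                  ≡⟨ size ⟨
        length W                       ≡⟨ length-map ascends W ⟨
        length (lows W)                ≡⟨ rows+cols (lows W) ⟨
        rows (lows W) + cols (lows W)  ∎)
        where open ≡-Reasoning

      rows-W : rows (map descends W) ≡ rows x
      rows-W = trans (cong rows descends-W) (trans (rows-++ x (false ∷ [])) (+-identityʳ _))

      degs-W : sum (degs (map descends W)) ≡ rows x + sum (degs x)
      degs-W = trans (cong (λ p → sum (degs p)) descends-W) (trans (cong sum (degs-++ x (false ∷ []))) (trans (sum-++ (map suc (degs x)) [])
        (trans (+-identityʳ _) (trans (sum-map-+ 1 (degs x)) (cong (_+ sum (degs x)) (trans (*-identityʳ _) (length-degs x)))))))

    final-height : end (+ 0) W ≡ + 0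
    final-height = trans (sym (cancel (end (+ 0) W) (+ rows x))) (trans (cong (ℤ._- + rows x)
      (trans (cong (λ r → end (+ 0) W ℤ.+ + r) (sym rows-W)) (trans (end-rows W) (cong +_ (sym balanced-rows))))) (ℤ.+-inverseʳ (+ rows x)))
      where
      cancel : ∀ x a → x ℤ.+ a ℤ.- a ≡ x
      cancel = ℤ-Solver.solve-∀

    private
      area-of : ∀ u → end (+ 0) u ≡ + 0 → sum (degs (map descends u)) ≤ sum (degs (rev (map ascends u))) → + 0 ℤ.≤ area (+ 0) u
      area-of u e h = difference≥0 (area-weight u) (subst₂ _≤_ (sym (weight-degs (map descends u))) (sym (weight-rev (map ascends u)))
        (+-mono-≤ h (≤-reflexive (cong triangle (same-rows u e)))))

      -- A zero of the walk means equally many rows at both ends. With `count`, the clique term of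
      -- Erdős and Gallai equals the rectangle on the left of `path-bound`, and cancelling it leaves
      -- the comparison of areas.
      proper-prefix : ∀ u m v → W ≡ u ++ m ∷ v → end (+ 0) u ≡ + 0 → sum (degs (map descends u)) ≤ sum (degs (rev (map ascends u)))
      proper-prefix u m v e at0 = +-cancelˡ-≤ (rows X * cols (M ++ Z)) _ _
          (≤-trans (path-bound X M Z (subst (λ p → Real (degs p)) split real)) (≤-reflexive (cong (λ c → rows X * (c ∸ 1) + sum (degs Z)) (sym count))))
        where
        X M Z : List Bool
        X = map descends u
        M = highs (m ∷ v) ++ rev (lows (m ∷ v))
        Z = rev (map ascends u)
        split : path W ≡ X ++ M ++ Z
        split = trans (cong path e) (trans (cong₂ _++_ (highs-++ u m v) (trans (cong rev (map-++ ascends u (m ∷ v))) (rev-++ (map ascends u) _)))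
          (trans (++-assoc X (highs (m ∷ v)) _) (cong (X ++_) (sym (++-assoc (highs (m ∷ v)) _ Z)))))
        rows-Z : rows Z ≡ cols X
        rows-Z = +-cancelˡ-≡ (rows X) _ _ (begin
          rows X + rows Z ≡⟨ cong₂ _+_ (same-rows u at0) (rows-rev (map ascends u)) ⟩
          rows (map ascends u) + cols (map ascends u) ≡⟨ trans (rows+cols (map ascends u)) (length-map ascends u) ⟩
          length u ≡⟨ trans (sym (length-map descends u)) (sym (rows+cols X)) ⟩
          rows X + cols X ∎)
          where open ≡-Reasoning
        count : suc (cols (M ++ Z)) ≡ rows X + rows M
        count = +-cancelʳ-≡ (cols X) _ _ (begin
          suc (cols (M ++ Z)) + cols X ≡⟨ cong suc (cols-++ X (M ++ Z)) ⟨
          suc (cols (X ++ M ++ Z)) ≡⟨ cong (λ p → suc (cols p)) split ⟨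
          suc (cols (path W)) ≡⟨ more-rows ⟨
          rows (path W) ≡⟨ cong rows split ⟩
          rows (X ++ M ++ Z) ≡⟨ trans (rows-++ X (M ++ Z)) (cong (λ t → rows X + t) (rows-++ M Z)) ⟩
          rows X + (rows M + rows Z) ≡⟨ +-assoc (rows X) (rows M) (rows Z) ⟨
          rows X + rows M + rows Z ≡⟨ cong (λ t → rows X + rows M + t) rows-Z ⟩
          rows X + rows M + cols X ∎)
          where open ≡-Reasoning

      cols-z : cols z ≡ rows x
      cols-z = trans (cols-rev (lows W)) (sym balanced-rows)

      -- At the end of the walk the middle part is empty, and the rectangle exceeds the clique term
      -- r (r - 1) by r. The extra r is the contribution of the column made by the padded last bit.
      whole : sum (degs (map descends W)) ≤ sum (degs z)
      whole = subst (_≤ sum (degs z)) (sym degs-W) (bound (rows x) (subst (λ c → rows x * c + sum (degs x) ≤ rows x * (rows x + 0 ∸ 1) + sum (degs z)) cols-z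
        (path-bound x [] z real)))
        where
        bound : ∀ r → r * r + sum (degs x) ≤ r * (r + 0 ∸ 1) + sum (degs z) → r + sum (degs x) ≤ sum (degs z)
        bound zero h = h
        bound (suc r) h = +-cancelˡ-≤ (suc r * r) _ _ (subst₂ _≤_ (expand r (sum (degs x))) (cong (λ k → suc r * k + sum (degs z)) (+-identityʳ r)) h)
          where
          expand : ∀ r s → suc r * suc r + s ≡ suc r * r + (suc r + s)
          expand = solve-∀

    shape-nonneg : nonneg (+ 0) (+ 0) false W ≡ true
    shape-nonneg = nonneg-complete (+ 0) (+ 0) W final-height λ u v e at0 → subst (+ 0 ℤ.≤_) (sym (ℤ.+-identityˡ _)) (prefix u v e at0)
      where
      prefix : ∀ u v → W ≡ u ++ v → end (+ 0) u ≡ + 0 → + 0 ℤ.≤ area (+ 0) u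
      prefix u (m ∷ v) e at0 = area-of u at0 (proper-prefix u m v e at0)
      prefix u [] e at0 with trans e (++-identityʳ′ u)
        where
        ++-identityʳ′ : ∀ (xs : Word) → xs ++ [] ≡ xs
        ++-identityʳ′ [] = refl
        ++-identityʳ′ (x ∷ xs) = cong (x ∷_) (++-identityʳ′ xs)
      ... | refl = area-of W at0 whole

    shape-even : even ℤ.∣ area (+ 0) W ∣ ≡ true
    shape-even with area (+ 0) W | area-of W final-height whole | area-weight W
    ... | + f | _ | weights with sum-even (degs (path W)) real
    ...   | k , total = trans (sym (even-+ (sum (degs x) + triangle (rows x)) f)) (trans (cong even (trans regroup (sym (+-identityʳ (k + k))))) (even-+ k 0))
      where
      weights-ℕ : f + (rows x + sum (degs x)) ≡ sum (degs z)
      weights-ℕ = +-cancelʳ-≡ (triangle (rows x)) _ _ (begin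
        f + (rows x + sum (degs x)) + triangle (rows x) ≡⟨ +-assoc f _ _ ⟩
        f + (rows x + sum (degs x) + triangle (rows x)) ≡⟨ cong (λ t → f + t) (trans (weight-degs (map descends W)) (cong₂ _+_ degs-W (cong triangle rows-W))) ⟨
        f + weight (map descends W) ≡⟨ ℤ.+-injective weights ⟩
        weight (map ascends W) ≡⟨ trans (weight-rev (map ascends W)) (cong (λ r → sum (degs z) + triangle r) (sym balanced-rows)) ⟩
        sum (degs z) + triangle (rows x) ∎)
        where open ≡-Reasoning
      -- The final area and the degree sum differ by twice a number: the degree sum is r² + sum x +
      -- sum z, the area is sum z - sum x - r, and r² + r is twice a triangular number.
      regroup : (sum (degs x) + triangle (rows x)) + (sum (degs x) + triangle (rows x)) + f ≡ k + k
      regroup = begin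
        (sum (degs x) + triangle (rows x)) + (sum (degs x) + triangle (rows x)) + f ≡⟨ lemma₁ (sum (degs x)) (triangle (rows x)) f ⟩
        sum (degs x) + sum (degs x) + (triangle (rows x) + triangle (rows x)) + f ≡⟨ cong (λ t → sum (degs x) + sum (degs x) + t + f) (sym (triangles (rows x))) ⟩
        sum (degs x) + sum (degs x) + rows x * suc (rows x) + f ≡⟨ lemma₂ (sum (degs x)) (rows x) f ⟩
        rows x * rows x + sum (degs x) + (f + (rows x + sum (degs x))) ≡⟨ cong₂ (λ c s → rows x * c + sum (degs x) + s) (sym cols-z) weights-ℕ ⟩
        rows x * cols z + sum (degs x) + sum (degs z) ≡⟨ cong (λ r → r * cols z + sum (degs x) + sum (degs z)) (length-degs x) ⟨
        length (degs x) * cols z + sum (degs x) + sum (degs z) ≡⟨ cong (_+ sum (degs z)) (sum-map-+ (cols z) (degs x)) ⟨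
        sum (map (λ t → cols z + t) (degs x)) + sum (degs z) ≡⟨ sum-++ (map (λ t → cols z + t) (degs x)) (degs z) ⟨
        sum (map (λ t → cols z + t) (degs x) ++ degs z) ≡⟨ cong sum (degs-++ x z) ⟨
        sum (degs (path W)) ≡⟨ total ⟩
        k + k ∎
        where
        open ≡-Reasoning
        lemma₁ : ∀ s t f → (s + t) + (s + t) + f ≡ s + s + (t + t) + f
        lemma₁ = solve-∀
        lemma₂ : ∀ s r f → s + s + r * suc r + f ≡ r * r + s + (f + (r + s))
        lemma₂ = solve-∀

-- The bijection between words and degree sequences

module Count where

  open import Defs using (GraphicSeq; GraphicCount; SimpleGraph; degree; AsymptoticToC4nOverN34)
  open Rationals using (ℚ; 0ℚ; 1ℚ; ½; ¼; ι; ι-*; ι-+; ℚ-ring; neg-neg) renaming (_+_ to _+ℚ_; _*_ to _*ℚ_; -_ to -ℚ_)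
  open Graphs
  open Paths
  open Degrees
  open Necessity
  open Words using (Letter; dn; z₀; z₁; up; Word; ⟦_⟧; Σ₄-expand; E; E-cong)
  open Walks using (nonneg; descends)
  open Reversal using (area; ∧-true)
  open Bridges using (endsDescending)
  open Signed using (signℕ)
  open Assemble using (ends; evenly; asymptotic)
  open import Data.Nat.Base
  open import Data.Nat.Properties
  open import Data.Integer.Base as ℤ using (ℤ; +_)
  open import Data.Bool.Base using (Bool; true; false; not; _∧_)
  open import Data.Bool.Properties using (not-involutive; not-injective)
  open import Data.Fin.Base as Fin using (Fin; toℕ; fromℕ<)
  open import Data.Fin.Properties using (toℕ-fromℕ<)
  open import Data.List.Base using (List; []; _∷_; _++_; map; length; reverse; replicate; take; drop)
  open import Data.List.Properties using (length-++; length-map; length-reverse; ∷-injectiveˡ; ∷-injectiveʳ; reverse-involutive; take++drop≡id; map-∘; map-id; length-take; length-drop)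
  open import Data.List.Membership.Propositional using (_∈_)
  open import Data.List.Membership.Propositional.Properties using (∈-map⁺; ∈-map⁻; ∈-++⁺ˡ; ∈-++⁺ʳ; ∈-++⁻)
  open import Data.List.Membership.Propositional.Properties.WithK using (unique∧set⇒bag)
  open import Data.List.Relation.Binary.BagAndSetEquality using (∼bag⇒↭)
  open import Data.List.Relation.Binary.Permutation.Propositional.Properties using (↭-length)
  open import Data.List.Relation.Unary.All as All using (All; []; _∷_)
  open import Data.List.Relation.Unary.AllPairs using ([]; _∷_)
  open import Data.List.Relation.Unary.Any using (here; there)
  open import Data.List.Relation.Unary.Unique.Propositional using (Unique)
  import Data.List.Relation.Unary.Unique.Propositional.Properties as Unique
  open import Data.Vec.Base using (Vec; []; _∷_; lookup; tabulate; toList)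
  open import Data.Vec.Properties using (lookup∘tabulate; tabulate∘lookup; tabulate-cong)
  open import Data.Product using (Σ; ∃-syntax; _×_; _,_; proj₁; proj₂)
  open import Data.Sum using (_⊎_; inj₁; inj₂)
  open import Data.Empty using (⊥; ⊥-elim)
  open import Function.Bundles using (_⇔_; mk⇔; Equivalence)
  open import Relation.Binary.PropositionalEquality
  open import Tactic.RingSolver using (solve-∀)

  valid : Word → Bool
  valid w = ends w ∧ even ℤ.∣ area (+ 0) w ∣

  signℕ-even : ∀ n → (even n ≡ true × signℕ n ≡ 1ℚ) ⊎ (even n ≡ false × signℕ n ≡ -ℚ 1ℚ)
  signℕ-even zero = inj₁ (refl , refl)
  signℕ-even (suc n) with signℕ-even n
  ... | inj₁ (e , s) = inj₂ (cong not e , cong -ℚ_ s)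
  ... | inj₂ (e , s) = inj₁ (cong not e , trans (cong -ℚ_ s) (neg-neg 1ℚ))

  opaque
    unfolding _+ℚ_

    half-double : 1ℚ ≡ ½ *ℚ (1ℚ +ℚ 1ℚ *ℚ 1ℚ)
    half-double = refl

    half-cancel : 0ℚ ≡ ½ *ℚ (1ℚ +ℚ 1ℚ *ℚ (-ℚ 1ℚ))
    half-cancel = refl

    half-zero : ∀ s → 0ℚ ≡ ½ *ℚ (0ℚ +ℚ 0ℚ *ℚ s)
    half-zero = solve-∀ ℚ-ring

    scale : ∀ n a b c d → n *ℚ a +ℚ (n *ℚ b +ℚ (n *ℚ c +ℚ n *ℚ d)) ≡ (1ℚ +ℚ (1ℚ +ℚ (1ℚ +ℚ (1ℚ +ℚ 0ℚ)))) *ℚ n *ℚ (¼ *ℚ ((a +ℚ b) +ℚ (c +ℚ d)))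
    scale = solve-∀ ℚ-ring

    scale-zero : (1ℚ +ℚ 0ℚ) *ℚ 0ℚ ≡ 0ℚ
    scale-zero = refl

    scale-one : (1ℚ +ℚ 0ℚ) *ℚ 1ℚ ≡ 1ℚ +ℚ 0ℚ
    scale-one = refl

  ⟦valid⟧ : ∀ w → ⟦ valid w ⟧ ≡ evenly w
  ⟦valid⟧ w with ends w
  ... | false = half-zero _
  ... | true with signℕ-even ℤ.∣ area (+ 0) w ∣
  ...   | inj₁ (e , s) = trans (cong ⟦_⟧ e) (trans half-double (cong (λ z → ½ *ℚ (1ℚ +ℚ 1ℚ *ℚ z)) (sym s)))
  ...   | inj₂ (e , s) = trans (cong ⟦_⟧ e) (trans half-cancel (cong (λ z → ½ *ℚ (1ℚ +ℚ 1ℚ *ℚ z)) (sym s)))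

  mutual
    -- The recursion mirrors that of `E`, so the length of the list is 4ⁿ times a mean by
    -- construction.
    select : (Word → Bool) → ℕ → List Word
    select P zero with P []
    ... | true = [] ∷ []
    ... | false = []
    select P (suc n) = part P dn n ++ part P z₀ n ++ part P z₁ n ++ part P up n

    part : (Word → Bool) → Letter → ℕ → List Word
    part P l n = map (l ∷_) (select (λ w → P (l ∷ w)) n)

  select-sound : ∀ P n {w} → w ∈ select P n → length w ≡ n × P w ≡ true
  select-sound P zero h with P [] in eq
  select-sound P zero (here refl) | true = refl , eq
  select-sound P (suc n) {w} h with ∈-++⁻ (part P dn n) h
  ... | inj₁ p with ∈-map⁻ (dn ∷_) p
  ...   | v , q , refl with select-sound (λ w → P (dn ∷ w)) n q
  ...     | e , t = cong suc e , t
  select-sound P (suc n) {w} h | inj₂ h′ with ∈-++⁻ (part P z₀ n) h′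
  ... | inj₁ p with ∈-map⁻ (z₀ ∷_) p
  ...   | v , q , refl with select-sound (λ w → P (z₀ ∷ w)) n q
  ...     | e , t = cong suc e , t
  select-sound P (suc n) {w} h | inj₂ h′ | inj₂ h″ with ∈-++⁻ (part P z₁ n) h″
  ... | inj₁ p with ∈-map⁻ (z₁ ∷_) p
  ...   | v , q , refl with select-sound (λ w → P (z₁ ∷ w)) n q
  ...     | e , t = cong suc e , t
  select-sound P (suc n) {w} h | inj₂ h′ | inj₂ h″ | inj₂ p with ∈-map⁻ (up ∷_) p
  ...   | v , q , refl with select-sound (λ w → P (up ∷ w)) n q
  ...     | e , t = cong suc e , t

  select-complete : ∀ P w → P w ≡ true → w ∈ select P (length w)
  select-complete P [] p with P []
  select-complete P [] p | true = here refl
  select-complete P (dn ∷ w) p = ∈-++⁺ˡ (∈-map⁺ (dn ∷_) (select-complete (λ w → P (dn ∷ w)) w p))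
  select-complete P (z₀ ∷ w) p = ∈-++⁺ʳ (part P dn (length w)) (∈-++⁺ˡ (∈-map⁺ (z₀ ∷_) (select-complete (λ w → P (z₀ ∷ w)) w p)))
  select-complete P (z₁ ∷ w) p = ∈-++⁺ʳ (part P dn (length w)) (∈-++⁺ʳ (part P z₀ (length w))
    (∈-++⁺ˡ (∈-map⁺ (z₁ ∷_) (select-complete (λ w → P (z₁ ∷ w)) w p))))
  select-complete P (up ∷ w) p = ∈-++⁺ʳ (part P dn (length w)) (∈-++⁺ʳ (part P z₀ (length w)) (∈-++⁺ʳ (part P z₁ (length w))
    (∈-map⁺ (up ∷_) (select-complete (λ w → P (up ∷ w)) w p))))

  select-unique : ∀ P n → Unique (select P n)
  select-unique P zero with P []
  ... | true = [] ∷ []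
  ... | false = []
  select-unique P (suc n) = Unique.++⁺ (unique-part dn) (Unique.++⁺ (unique-part z₀) (Unique.++⁺ (unique-part z₁) (unique-part up)
      λ (p , q) → apart z₁ up (λ ()) p q)
      λ (p , q) → apart₂ p q)
      λ (p , q) → apart₃ p q
    where
    unique-part : ∀ l → Unique (part P l n)
    unique-part l = Unique.map⁺ ∷-injectiveʳ (select-unique (λ w → P (l ∷ w)) n)
    apart : ∀ l m {v} → l ≢ m → v ∈ part P l n → v ∈ part P m n → ⊥
    apart l m l≢m p q with ∈-map⁻ (l ∷_) p | ∈-map⁻ (m ∷_) q
    ... | _ , _ , refl | _ , _ , e = l≢m (∷-injectiveˡ e)
    apart₂ : ∀ {v} → v ∈ part P z₀ n → v ∈ part P z₁ n ++ part P up n → ⊥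
    apart₂ p q with ∈-++⁻ (part P z₁ n) q
    ... | inj₁ q = apart z₀ z₁ (λ ()) p q
    ... | inj₂ q = apart z₀ up (λ ()) p q
    apart₃ : ∀ {v} → v ∈ part P dn n → v ∈ part P z₀ n ++ part P z₁ n ++ part P up n → ⊥
    apart₃ p q with ∈-++⁻ (part P z₀ n) q
    ... | inj₁ q = apart dn z₀ (λ ()) p q
    ... | inj₂ q with ∈-++⁻ (part P z₁ n) q
    ...   | inj₁ q = apart dn z₁ (λ ()) p q
    ...   | inj₂ q = apart dn up (λ ()) p q

  select-length : ∀ P n → ι (length (select P n)) ≡ ι (4 ^ n) *ℚ E n λ w → ⟦ P w ⟧
  select-length P zero with P []
  ... | true = sym scale-one
  ... | false = sym scale-zero
  select-length P (suc n) = begin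
    ι (length (part P dn n ++ part P z₀ n ++ part P z₁ n ++ part P up n))
      ≡⟨ trans (split (part P dn n) _) (cong (λ t → size dn +ℚ t) (trans (split (part P z₀ n) _) (cong (λ t → size z₀ +ℚ t) (split (part P z₁ n) (part P up n))))) ⟩
    size dn +ℚ (size z₀ +ℚ (size z₁ +ℚ size up))
      ≡⟨ cong₂ _+ℚ_ (size-value dn) (cong₂ _+ℚ_ (size-value z₀) (cong₂ _+ℚ_ (size-value z₁) (size-value up))) ⟩
    N *ℚ e dn +ℚ (N *ℚ e z₀ +ℚ (N *ℚ e z₁ +ℚ N *ℚ e up)) ≡⟨ scale N _ _ _ _ ⟩
    ι 4 *ℚ N *ℚ (¼ *ℚ ((e dn +ℚ e z₀) +ℚ (e z₁ +ℚ e up)))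
      ≡⟨ cong₂ (λ u v → u *ℚ (¼ *ℚ v)) (sym (ι-* 4 (4 ^ n))) (sym (Σ₄-expand e)) ⟩
    ι (4 ^ suc n) *ℚ E (suc n) (λ w → ⟦ P w ⟧) ∎
    where
    open ≡-Reasoning
    size e : Letter → ℚ
    size l = ι (length (part P l n))
    e l = E n λ w → ⟦ P (l ∷ w) ⟧
    N : ℚ
    N = ι (4 ^ n)
    split : ∀ (xs ys : List Word) → ι (length (xs ++ ys)) ≡ ι (length xs) +ℚ ι (length ys)
    split xs ys = trans (cong ι (length-++ xs)) (ι-+ (length xs) (length ys))
    size-value : ∀ l → size l ≡ N *ℚ e l
    size-value l = trans (cong ι (length-map (l ∷_) (select (λ w → P (l ∷ w)) n))) (select-length (λ w → P (l ∷ w)) n)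

  nth-degs≤cols : ∀ p i → nth (degs p) i ≤ cols p
  nth-degs≤cols [] i = z≤n
  nth-degs≤cols (true ∷ p) zero = ≤-refl
  nth-degs≤cols (true ∷ p) (suc i) = nth-degs≤cols p i
  nth-degs≤cols (false ∷ p) i = m≤n⇒m≤1+n (nth-degs≤cols p i)

  degs-antitone : ∀ p {i j} → i ≤ j → nth (degs p) j ≤ nth (degs p) i
  degs-antitone [] _ = z≤n
  degs-antitone (true ∷ p) {zero} {zero} _ = ≤-refl
  degs-antitone (true ∷ p) {zero} {suc j} _ = nth-degs≤cols p j
  degs-antitone (true ∷ p) (s≤s h) = degs-antitone p h
  degs-antitone (false ∷ p) h = degs-antitone p h

  -- Columns before the first row leave no trace in the degrees; fixing the number of columns
  -- recovers them.
  degs-injective : ∀ p p′ → cols p ≡ cols p′ → degs p ≡ degs p′ → p ≡ p′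
  degs-injective [] [] c e = refl
  degs-injective [] (true ∷ p′) c ()
  degs-injective [] (false ∷ p′) () e
  degs-injective (true ∷ p) [] c ()
  degs-injective (false ∷ p) [] () e
  degs-injective (true ∷ p) (true ∷ p′) c e = cong (true ∷_) (degs-injective p p′ c (∷-injectiveʳ e))
  degs-injective (false ∷ p) (false ∷ p′) c e = cong (false ∷_) (degs-injective p p′ (suc-injective c) e)
  degs-injective (true ∷ p) (false ∷ p′) c e = ⊥-elim (1+n≰n (subst₂ _≤_ (trans (cong (λ ds → nth ds 0) (sym e)) c) refl (nth-degs≤cols p′ 0)))
  degs-injective (false ∷ p) (true ∷ p′) c e = ⊥-elim (1+n≰n (subst₂ _≤_ (trans (cong (λ ds → nth ds 0) e) (sym c)) refl (nth-degs≤cols p 0)))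

  data Descending : ℕ → List ℕ → Set where
    []  : ∀ {κ} → Descending κ []
    _∷_ : ∀ {κ x xs} → x ≤ κ → Descending x xs → Descending κ (x ∷ xs)

  columns : ∀ k q → degs (replicate k false ++ q) ≡ degs q × cols (replicate k false ++ q) ≡ k + cols q × rows (replicate k false ++ q) ≡ rows q
  columns zero q = refl , refl , refl
  columns (suc k) q with columns k q
  ... | a , b , c = a , cong suc b , c

  decode : ∀ κ xs → Descending κ xs → ∃[ p ] degs p ≡ xs × cols p ≡ κ × rows p ≡ length xs
  decode κ [] _ = replicate κ false ++ [] , proj₁ (columns κ []) , trans (proj₁ (proj₂ (columns κ []))) (+-identityʳ κ) , proj₂ (proj₂ (columns κ []))
  decode κ (x ∷ xs) (x≤κ ∷ d) with decode x xs d
  ... | p , a , b , c with columns (κ ∸ x) (true ∷ p)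
  ...   | a′ , b′ , c′ = replicate (κ ∸ x) false ++ true ∷ p , trans a′ (cong₂ _∷_ b a) , trans b′ (trans (cong (λ t → κ ∸ x + t) b) (m∸n+n≡m x≤κ)) , trans c′ (cong suc c)

  letter : Bool → Bool → Letter
  letter true true = z₁
  letter true false = up
  letter false true = dn
  letter false false = z₀

  ascends-letter : ∀ b a → ascends (letter b a) ≡ b
  ascends-letter true true = refl
  ascends-letter true false = refl
  ascends-letter false true = refl
  ascends-letter false false = refl

  descends-letter : ∀ b a → descends (letter b a) ≡ a
  descends-letter true true = refl
  descends-letter true false = refl
  descends-letter false true = refl
  descends-letter false false = refl

  letter-injective : ∀ l m → ascends l ≡ ascends m → descends l ≡ descends m → l ≡ m
  letter-injective dn dn _ _ = refl
  letter-injective z₀ z₀ _ _ = refl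
  letter-injective z₁ z₁ _ _ = refl
  letter-injective up up _ _ = refl

  unzip-words : ∀ as bs → length bs ≡ suc (length as) → ∃[ l ] ∃[ w ]
    (highs (l ∷ w) ≡ as × lows (l ∷ w) ≡ bs × (∀ f → endsDescending f (l ∷ w) ≡ false))
  -- The high end has no step for the last letter, and false is the default.
  unzip-words [] (b ∷ []) refl = letter b false , [] , refl , cong (_∷ []) (ascends-letter b false) , λ _ → descends-letter b false
  unzip-words (a ∷ as) (b ∷ bs) e with unzip-words as bs (suc-injective e)
  ... | l , w , p , q , r = letter b a , l ∷ w , cong₂ _∷_ (descends-letter b a) p , cong₂ _∷_ (ascends-letter b a) q , λ _ → r false

  words-injective : ∀ w v → length w ≡ length v → endsDescending false w ≡ false → endsDescending false v ≡ false →
    highs w ≡ highs v → lows w ≡ lows v → w ≡ v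
  words-injective [] [] _ _ _ _ _ = refl
  words-injective (l ∷ []) (m ∷ []) _ p q _ e = cong (_∷ []) (letter-injective l m (∷-injectiveˡ e) (trans p (sym q)))
  words-injective (l ∷ l′ ∷ w) (m ∷ m′ ∷ v) n p q h e = cong₂ _∷_ (letter-injective l m (∷-injectiveˡ e) (∷-injectiveˡ h))
    (words-injective (l′ ∷ w) (m′ ∷ v) (suc-injective n) p q (∷-injectiveʳ h) (∷-injectiveʳ e))

  length-highs : ∀ l w → length (highs (l ∷ w)) ≡ length w
  length-highs l [] = refl
  length-highs l (m ∷ w) = cong suc (length-highs m w)

  length-rev : ∀ bs → length (rev bs) ≡ length bs
  length-rev bs = trans (length-reverse (map not bs)) (length-map not bs)

  rev-involutive : ∀ bs → rev (rev bs) ≡ bs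
  rev-involutive bs = begin
    reverse (map not (reverse (map not bs))) ≡⟨ cong reverse (reverse-map not (map not bs)) ⟩
    reverse (reverse (map not (map not bs))) ≡⟨ reverse-involutive _ ⟩
    map not (map not bs) ≡⟨ map-∘ bs ⟨
    map (λ b → not (not b)) bs ≡⟨ trans (map-cong not-involutive bs) (map-id bs) ⟩
    bs ∎
    where
    open ≡-Reasoning
    open import Data.List.Properties using (reverse-map; map-cong)

  ++-injective : ∀ {A : Set} (xs ys : List A) {us vs} → length xs ≡ length ys → xs ++ us ≡ ys ++ vs → xs ≡ ys × us ≡ vs
  ++-injective [] [] _ e = refl , e
  ++-injective (x ∷ xs) (y ∷ ys) n e with ++-injective xs ys (suc-injective n) (∷-injectiveʳ e)
  ... | p , q = cong₂ _∷_ (∷-injectiveˡ e) p , q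

  path-injective : ∀ w v → length w ≡ length v → endsDescending false w ≡ false → endsDescending false v ≡ false → path w ≡ path v → w ≡ v
  path-injective [] [] _ _ _ _ = refl
  path-injective (l ∷ w) (m ∷ v) n p q e with ++-injective (highs (l ∷ w)) (highs (m ∷ v))
      (trans (length-highs l w) (trans (suc-injective n) (sym (length-highs m v)))) e
  ... | h , r = words-injective (l ∷ w) (m ∷ v) n p q h (trans (sym (rev-involutive _)) (trans (cong rev r) (rev-involutive _)))

  nth-ext : ∀ xs ys → length xs ≡ length ys → (∀ i → i < length xs → nth xs i ≡ nth ys i) → xs ≡ ys
  nth-ext [] [] _ _ = refl
  nth-ext (x ∷ xs) (y ∷ ys) n p = cong₂ _∷_ (p 0 z<s) (nth-ext xs ys (suc-injective n) λ i h → p (suc i) (s<s h))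

  nth-toList : ∀ {n} (d : Vec ℕ n) i → nth (toList d) (toℕ i) ≡ lookup d i
  nth-toList (x ∷ d) Fin.zero = refl
  nth-toList (x ∷ d) (Fin.suc i) = nth-toList d i

  length-toList : ∀ {n} (d : Vec ℕ n) → length (toList d) ≡ n
  length-toList [] = refl
  length-toList (x ∷ d) = cong suc (length-toList d)

  descending-toList : ∀ {n} κ (d : Vec ℕ n) → (∀ i → lookup d i ≤ κ) → (∀ i j → i Fin.≤ j → lookup d j ≤ lookup d i) → Descending κ (toList d)
  descending-toList κ [] _ _ = []
  descending-toList κ (x ∷ d) b s = b Fin.zero ∷ descending-toList x d (λ i → s Fin.zero (Fin.suc i) z≤n) (λ i j h → s (Fin.suc i) (Fin.suc j) (s≤s h))

  sequence : ∀ n → Word → Vec ℕ n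
  sequence n w = tabulate λ i → nth (degs (path w)) (toℕ i)

  lookup-sequence : ∀ n w i → lookup (sequence n w) i ≡ nth (degs (path w)) (toℕ i)
  lookup-sequence n w i = lookup∘tabulate (λ i → nth (degs (path w)) (toℕ i)) i

  valid-parts : ∀ w → valid w ≡ true → nonneg (+ 0) (+ 0) false w ≡ true × endsDescending false w ≡ false × even ℤ.∣ area (+ 0) w ∣ ≡ true
  valid-parts w v with ∧-true {ends w} v
  ... | e , ev with ∧-true {nonneg (+ 0) (+ 0) false w} e
  ...   | p , q = p , not-injective q , ev

  valid-intro : ∀ w → nonneg (+ 0) (+ 0) false w ≡ true → endsDescending false w ≡ false → even ℤ.∣ area (+ 0) w ∣ ≡ true → valid w ≡ true
  valid-intro w p q r rewrite p | q | r = refl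

  -- The walk returns to 0, so both ends contain equally many rows, and the rows of one end together
  -- with the columns of the other number n.
  path-counts : ∀ l w → valid (l ∷ w) ≡ true → rows (path (l ∷ w)) ≡ suc (length w) × cols (path (l ∷ w)) ≡ length w
  path-counts l w v with valid-parts (l ∷ w) v
  ... | p , q , _ = row-count , suc-injective (+-cancelˡ-≡ (suc (length w)) _ _ (begin
        suc (length w) + suc (cols (path W)) ≡⟨ +-suc (suc (length w)) (cols (path W)) ⟩
        suc (suc (length w) + cols (path W)) ≡⟨ cong (λ r → suc (r + cols (path W))) row-count ⟨
        suc (rows (path W) + cols (path W)) ≡⟨ cong suc (rows+cols (path W)) ⟩
        suc (length (path W)) ≡⟨ cong suc (trans (length-++ (highs W)) (cong₂ _+_ (length-highs l w) (trans (length-rev (lows W)) (length-map ascends W)))) ⟩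
        suc (length w + suc (length w)) ≡⟨ refl ⟩
        suc (length w) + suc (length w) ∎))
    where
    open ≡-Reasoning
    open Reversal using (nonneg-end)
    W : Word
    W = l ∷ w
    row-count : rows (path W) ≡ suc (length w)
    row-count = begin
      rows (path W) ≡⟨ rows-++ (highs W) (rev (lows W)) ⟩
      rows (highs W) + rows (rev (lows W)) ≡⟨ cong₂ _+_ (trans (sym (+-identityʳ _)) (trans (sym (rows-++ (highs W) (false ∷ []))) (trans (cong rows (sym (highs-∷ʳ false l w q)))
          (same-rows W (nonneg-end (+ 0) (+ 0) false W p))))) (rows-rev (lows W)) ⟩
      rows (lows W) + cols (lows W) ≡⟨ trans (rows+cols (lows W)) (length-map ascends W) ⟩
      suc (length w) ∎

  sequence-graphic : ∀ m w → length w ≡ suc m → valid w ≡ true → GraphicSeq (sequence (suc m) w)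
  sequence-graphic m (l ∷ w) refl v with path-counts l w v | valid-parts (l ∷ w) v
  ... | r , c | p , q , ev =
      (λ i → ≤-trans (≤-reflexive (lookup-sequence (suc m) (l ∷ w) i)) (≤-trans (nth-degs≤cols (path (l ∷ w)) (toℕ i)) (≤-reflexive c)))
    , (λ i j h → subst₂ _≤_ (sym (lookup-sequence (suc m) (l ∷ w) j)) (sym (lookup-sequence (suc m) (l ∷ w) i)) (degs-antitone (path (l ∷ w)) h))
    , proj₁ realization , λ i → trans (proj₂ realization i) (sym (lookup-sequence (suc m) (l ∷ w) i))
    where
    realization : Σ (SimpleGraph (suc m)) λ G → ∀ i → degree G i ≡ nth (degs (path (l ∷ w))) (toℕ i)
    realization = realizable⇒degrees (subst (λ n → Realizable n (nth (degs (path (l ∷ w))))) (trans (length-degs (path (l ∷ w))) r) (word-real l w p q ev))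

  sequence-injective : ∀ m w v → length w ≡ suc m → valid w ≡ true → length v ≡ suc m → valid v ≡ true →
    sequence (suc m) w ≡ sequence (suc m) v → w ≡ v
  sequence-injective m (l ∷ w) (l′ ∷ v) refl p n q e = path-injective (l ∷ w) (l′ ∷ v) (sym n)
      (proj₁ (proj₂ (valid-parts (l ∷ w) p))) (proj₁ (proj₂ (valid-parts (l′ ∷ v) q)))
      (degs-injective _ _ (trans c (trans (sym (suc-injective n)) (sym c′))) (nth-ext _ _ (trans len (sym len′)) same))
    where
    r = proj₁ (path-counts l w p)
    c = proj₂ (path-counts l w p)
    r′ = proj₁ (path-counts l′ v q)
    c′ = proj₂ (path-counts l′ v q)
    len : length (degs (path (l ∷ w))) ≡ suc m
    len = trans (length-degs (path (l ∷ w))) r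
    len′ : length (degs (path (l′ ∷ v))) ≡ suc m
    len′ = trans (length-degs (path (l′ ∷ v))) (trans r′ n)
    same : ∀ i → i < length (degs (path (l ∷ w))) → nth (degs (path (l ∷ w))) i ≡ nth (degs (path (l′ ∷ v))) i
    same i h = subst (λ i → nth (degs (path (l ∷ w))) i ≡ nth (degs (path (l′ ∷ v))) i) (toℕ-fromℕ< h′)
      (trans (sym (lookup-sequence (suc m) (l ∷ w) x)) (trans (cong (λ d → lookup d x) e) (lookup-sequence (suc m) (l′ ∷ v) x)))
      where
      h′ : i < suc m
      h′ = subst (i <_) len h
      x : Fin (suc m)
      x = fromℕ< h′

  graphic-word : ∀ m d → GraphicSeq d → ∃[ w ] length w ≡ suc m × valid w ≡ true × sequence (suc m) w ≡ d
  graphic-word m d (bounded , sorted , G , real) with decode m (toList d) (descending-toList m d bounded sorted)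
  -- The boundary has 2m + 1 steps: m are read from the high end, the remaining m + 1 from the low
  -- end.
  ... | p , e , c , r with unzip-words (take m p) (rev (drop m p)) sizes
    where
    total : length p ≡ suc m + m
    total = trans (sym (rows+cols p)) (cong₂ _+_ (trans r (length-toList d)) c)
    sizes : length (rev (drop m p)) ≡ suc (length (take m p))
    sizes = trans (length-rev (drop m p)) (trans (length-drop m p) (trans (cong (_∸ m) total) (trans (m+n∸n≡m (suc m) m)
      (cong suc (sym (trans (length-take m p) (m≤n⇒m⊓n≡m (≤-trans (m≤n+m m (suc m)) (≤-reflexive (sym total))))))))))
  ... | l , w , hs , ls , last = l ∷ w , size′ , valid-intro (l ∷ w) (shape-nonneg shape) (last false) (shape-even shape) , seq
    where
    n-rows : rows p ≡ suc m
    n-rows = trans r (length-toList d)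
    path≡p : path (l ∷ w) ≡ p
    path≡p = trans (cong₂ _++_ hs (trans (cong rev ls) (rev-involutive (drop m p)))) (take++drop≡id m p)
    size′ : length (l ∷ w) ≡ suc m
    size′ = cong suc (trans (sym (length-highs l w)) (trans (cong length hs) (trans (length-take m p)
      (m≤n⇒m⊓n≡m (≤-trans (m≤n+m m (suc m)) (≤-reflexive (sym (trans (sym (rows+cols p)) (cong₂ _+_ n-rows c)))))))))
    realizable : Real (degs (path (l ∷ w)))
    realizable = subst Real (trans (sym e) (cong degs (sym path≡p))) (subst (λ n → Realizable n (nth (toList d))) (sym (length-toList d))
      (degrees⇒realizable G λ i → trans (real i) (sym (nth-toList d i))))
    shape : Shape (l ∷ w)
    shape = record { ends-high = last false
                   ; more-rows = trans (cong rows path≡p) (trans n-rows (cong suc (sym (trans (cong cols path≡p) c))))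
                   ; size = trans size′ (sym (trans (cong rows path≡p) n-rows))
                   ; real = realizable }
    seq : sequence (suc m) (l ∷ w) ≡ d
    seq = trans (tabulate-cong λ i → trans (cong (λ q → nth q (toℕ i)) (trans (cong degs path≡p) e)) (nth-toList d i)) (tabulate∘lookup d)

  map-unique : ∀ {A B : Set} (f : A → B) (P : A → Set) → (∀ x y → P x → P y → f x ≡ f y → x ≡ y) →
               ∀ xs → (∀ x → x ∈ xs → P x) → Unique xs → Unique (map f xs)
  map-unique {A} {B} f P inj [] p [] = []
  map-unique {A} {B} f P inj (x ∷ xs) p (x∉ ∷ u) = distinct xs (λ y q → p y (there q)) x∉ ∷ map-unique f P inj xs (λ y q → p y (there q)) u
    where
    distinct : ∀ ys → (∀ y → y ∈ ys → P y) → All (x ≢_) ys → All (λ z → f x ≢ z) (map f ys)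
    distinct [] _ [] = []
    distinct (y ∷ ys) q (x≢y ∷ rest) = (λ e → x≢y (inj x y (p x (here refl)) (q y (here refl)) e)) ∷ distinct ys (λ z r → q z (there r)) rest

  -- Lists without repetition and with the same members are permutations of each other. So the count
  -- does not depend on the list by which it is witnessed.
  parametrization-length : ∀ {A B : Set} (f : A → B) (P : A → Set) (Q : B → Set) →
    (∀ x y → P x → P y → f x ≡ f y → x ≡ y) → (∀ x → P x → Q (f x)) → (∀ z → Q z → ∃[ x ] P x × f x ≡ z) →
    ∀ xs → (∀ x → x ∈ xs → P x) → (∀ x → P x → x ∈ xs) → Unique xs →
    ∀ zs → (∀ z → (z ∈ zs) ⇔ Q z) → Unique zs → length zs ≡ length xs
  parametrization-length {A} {B} f P Q inj maps onto xs sound complete unique zs member zs-unique =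
    trans (↭-length (∼bag⇒↭ (unique∧set⇒bag zs-unique (map-unique f P inj xs sound unique) (λ {z} → mk⇔ (to z) (from z))))) (length-map f xs)
    where
    to : ∀ z → z ∈ zs → z ∈ map f xs
    to z h with onto z (Equivalence.to (member z) h)
    ... | x , p , e = subst (_∈ map f xs) e (∈-map⁺ f (complete x p))
    from : ∀ z → z ∈ map f xs → z ∈ zs
    from z h with ∈-map⁻ f h
    ... | x , q , e = Equivalence.from (member z) (subst Q (sym e) (maps x (sound x q)))

  IsWord : ℕ → Word → Set
  IsWord m w = length w ≡ suc m × valid w ≡ true

  theorem : (G : ℕ → ℕ) → (∀ n → GraphicCount n (G n)) → AsymptoticToC4nOverN34 G
  theorem G graphic = asymptotic G λ m → trans (cong ι (count m (graphic (suc m))))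
      (trans (select-length valid (suc m)) (cong (λ t → ι (4 ^ suc m) *ℚ t) (E-cong (suc m) ⟦valid⟧)))
    where
    count : ∀ m → GraphicCount (suc m) (G (suc m)) → G (suc m) ≡ length (select valid (suc m))
    count m (ds , ds-unique , member , e) = trans (sym e) (parametrization-length (sequence (suc m)) (IsWord m) GraphicSeq
      (λ w v (n , p) (n′ , q) → sequence-injective m w v n p n′ q)
      (λ w (n , p) → sequence-graphic m w n p)
      (λ d g → let w , n , p , s = graphic-word m d g in w , (n , p) , s)
      (select valid (suc m)) (λ w → select-sound valid (suc m)) (λ w (n , p) → subst (λ k → w ∈ select valid k) n (select-complete valid w p))
      (select-unique valid (suc m)) ds member ds-unique)

open import Defs
open import Data.Nat using (ℕ)

theorem1p1 : (G : ℕ → ℕ) → (∀ n → GraphicCount n (G n)) → AsymptoticToC4nOverN34 G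
theorem1p1 = Count.theorem
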